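{- Let $m,n$ be positive integers and let $C$ be an $n\times n$ integer matrix. Let \[ \mathcal{T}_m(\mathcal{M}_n(\mathbb{Z};H),C)=\{(A_1,\ldots,A_m)\in \mathcal{M}_n(\mathbb{Z};H)^m : A_1\cdots A_m=C\}. \] Then, uniformly in $C$, as $H\to\infty$, \[ \#\mathcal{T}_m(\mathcal{M}_n(\mathbb{Z};H),C)\le \begin{cases} H^{(m-1)(n^2-n)+o(1)}, & \text{if } C \text{ is nonsingular (for all } m),\\ H^{n^2+o(1)}, & \text{if } C\neq O_n \text{ is singular and } m=2,\\ H^{mn^2-n}, & \text{if } C\neq O_n \text{ is singular and } m\ge 3. \end{cases} \] Furthermore, when $C=O_n$ is the $n\times n$ zero matrix, \[ H^{(m-1)n^2}\ll \#\mathcal{T}_m(\mathcal{M}_n(\mathbb{Z};H),O_n)\le H^{(m-1)n^2+o(1)}. \]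
   Context: For positive integers $n,H$, $\mathcal{M}_n(\mathbb{Z};H)$ denotes the set of $n\times n$ integer matrices all of whose entries have absolute value at most $H$. $O_n$ is the $n\times n$ zero matrix. A bound $X\le H^{a+o(1)}$ means: for every $\varepsilon>0$, $X\le H^{a+\varepsilon}$ for all sufficiently large $H$. $U\ll V$ means $|U|\le cV$ for a constant $c>0$ depending only on $m$ and $n$. -}

module Defs where

open import Data.Nat as ℕ using (ℕ; zero; suc)
open import Data.Integer as ℤ using (ℤ; +_; -_)
open import Data.Fin using (Fin; zero; suc; punchIn)
open import Data.List using (List; []; _∷_; map; concatMap; length; filter; upTo)
open import Data.Vec using (Vec; []; _∷_; lookup; tabulate)
open import Data.Vec.Properties using (≡-dec)
open import Relation.Binary.PropositionalEquality using (_≡_)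
open import Relation.Nullary using (Dec)

Matrix : ℕ → Set
Matrix n = Vec (Vec ℤ n) n

entry : ∀ {n} → Matrix n → Fin n → Fin n → ℤ
entry A i j = lookup (lookup A i) j

sumFin : ∀ n → (Fin n → ℤ) → ℤ
sumFin zero    f = + 0
sumFin (suc n) f = f zero ℤ.+ sumFin n (λ k → f (suc k))

_⊗_ : ∀ {n} → Matrix n → Matrix n → Matrix n
_⊗_ {n} A B = tabulate λ i → tabulate λ j → sumFin n (λ k → entry A i k ℤ.* entry B k j)

identity : ∀ n → Matrix n
identity n = tabulate λ i → tabulate λ j → Data.Fin._≟_ i j |> λ where
    (Relation.Nullary.yes _) → + 1
    (Relation.Nullary.no _)  → + 0
  where open import Function using (_|>_)

prodMats : ∀ {n m} → Vec (Matrix n) m → Matrix n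
prodMats {n} []       = identity n
prodMats     (A ∷ As) = A ⊗ prodMats As

zeroMat : ∀ n → Matrix n
zeroMat n = tabulate λ _ → tabulate λ _ → + 0

detF : ∀ n → (Fin n → Fin n → ℤ) → ℤ
detF zero    A = + 1
detF (suc n) A = sumFin (suc n) λ j →
  sign j ℤ.* (A zero j ℤ.* detF n (λ i k → A (suc i) (punchIn j k)))
  where
  sign : ∀ {k} → Fin k → ℤ
  sign zero    = + 1
  sign (suc j) = - sign j

det : ∀ {n} → Matrix n → ℤ
det {n} A = detF n (entry A)

range : ℕ → List ℤ
range H = map (λ k → (+ k) ℤ.- (+ H)) (upTo (suc (2 ℕ.* H)))

vecsOf : ∀ {A : Set} k → List A → List (Vec A k)
vecsOf zero    xs = [] ∷ []
vecsOf (suc k) xs = concatMap (λ x → map (x ∷_) (vecsOf k xs)) xs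

-- M_n(Z;H), as a (duplicate-free) list
boundedMats : ∀ n → ℕ → List (Matrix n)
boundedMats n H = vecsOf n (vecsOf n (range H))

_≟M_ : ∀ {n} (A B : Matrix n) → Dec (A ≡ B)
_≟M_ = ≡-dec (≡-dec ℤ._≟_)

countT : ∀ m n → ℕ → Matrix n → ℕ
countT m n H C = length (filter (λ As → prodMats As ≟M C) (vecsOf m (boundedMats n H)))

{-# OPTIONS --safe #-}
module Submission where

-- Everything rests on counting integer matrices of given rank, or of given determinant d ≠ 0, with entries at
-- most H.  The rows of a matrix of rank r lie in a primitive lattice L of rank r.  Let x₁, …, x_k (k ≤ r) be
-- successive minima of L: xᵢ has size about 2^eᵢ, and every vector of L with entries below 2^eᵢ lies in the rational
-- span of x₁, …, xᵢ₋₁.  In a basis of L adapted to these spans, a vector of L with entries below 2^h, where 2^h is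
-- about H, is determined by its coordinates modulo the numbers 2^(h - eᵢ), so there are O(∏ H / 2^eᵢ) such vectors,
-- whereas there are O(∏ 2^(n eᵢ)) choices of x₁, …, x_k.  The eᵢ cancel, so there are O(H^(nr) log^r H) matrices of
-- rank at most r.  If instead det A = d ≠ 0, apply this to all rows of A but one; modulo the hyperplane which they
-- span the remaining row is a divisor of d, and d has H^o(1) divisors.
-- Nonsingular C: every factor of C divides det C.  C = 0: by Sylvester's inequality the ranks of the factors add up
-- to at most (m - 1) n.  m = 2: a factor A₁ of rank r leaves O(H^(n (n - r))) choices of A₂.  m ≥ 3: either A₁ is
-- nonsingular and cancels, or A₁ is singular and A₁ ⋯ Aₘ₋₁ ≠ 0 restricts each column of Aₘ to a proper affine
-- subspace.

open import Defs
open import Algebra.Bundles using (AbelianGroup; CommutativeRing)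
import Algebra.Properties.AbelianGroup as AbelianGroupₚ
import Algebra.Properties.CommutativeSemigroup as CommutativeSemigroupₚ
import Algebra.Properties.Semiring.Sum as Sum
open import Data.Empty using (⊥-elim)
open import Data.Fin as Fin using (Fin; zero; suc; punchIn; punchOut)
import Data.Fin.Properties as Finₚ
open import Data.Integer as ℤ using (ℤ; +_; -_; ∣_∣; 0ℤ; 1ℤ)
import Data.Integer.DivMod as ℤ/
import Data.Integer.Properties as ℤₚ
open import Data.Integer.Tactic.RingSolver using (solve-∀)
open import Data.List as List using (List; []; _∷_; length)
open import Data.List.Membership.Propositional using (_∈_; find; lose)
import Data.List.Membership.Propositional.Properties as ∈ₚ
import Data.List.Properties as Listₚ
open import Data.List.Relation.Binary.Sublist.Propositional using (_⊆_; []; _∷_; _∷ʳ_)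
open import Data.List.Relation.Binary.Sublist.Propositional.Properties using (All-resp-⊆)
open import Data.List.Relation.Unary.All as All using (All; []; _∷_)
import Data.List.Relation.Unary.All.Properties as Allₚ
open import Data.List.Relation.Unary.AllPairs using (AllPairs; []; _∷_)
import Data.List.Relation.Unary.AllPairs.Properties as AllPairsₚ
open import Data.List.Relation.Unary.Any as Any using (Any; here; there)
open import Data.List.Relation.Unary.Unique.Propositional using (Unique)
import Data.List.Relation.Unary.Unique.DecPropositional.Properties as DecUniqueₚ
import Data.List.Relation.Unary.Unique.Propositional.Properties as Uniqueₚ
open import Data.Nat using
  ( ℕ; zero; suc; NonZero; _+_; _*_; _∸_; _^_; _!; _/_; _%_; _⊔_; _⊓_; _≤_; _<_; _≥_
  ; z≤n; s≤s; s≤s⁻¹; >-nonZero; nonTrivial⇒n>1 )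
open import Data.Nat.Divisibility using (divides; ∣-trans; ∣⇒≤; ∣1⇒≡1; n∣m*n) renaming (_∣_ to _∣ℕ_; _∣?_ to _∣ℕ?_)
open import Data.Nat.DivMod using (m/n*n≤m; m≡m%n+[m/n]*n; m%n<n)
open import Data.Nat.Induction using (<-wellFounded)
open import Data.Nat.ListAction.Properties using (∈⇒∣product)
open import Data.Nat.Primality using (Prime; prime?; euclidsLemma; prime⇒nonZero; prime⇒nonTrivial)
open import Data.Nat.Primality.Factorisation using (factorise)
import Data.Nat.Properties as ℕₚ
open import Data.Nat.Tactic.RingSolver using () renaming (solve-∀ to solve-∀ℕ)
open import Data.Product using (_×_; ∃; ∃-syntax; Σ-syntax; _,_; proj₁; proj₂)
import Data.Sign as Sign
open import Data.Sum using (_⊎_; inj₁; inj₂)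
open import Data.Vec as Vec using (Vec; []; _∷_; _++_; head; tail; lookup; replicate; tabulate; zipWith)
import Data.Vec.Properties as Vecₚ
open import Data.Vec.Relation.Binary.Pointwise.Inductive using (Pointwise; []; _∷_)
open import Data.Vec.Relation.Unary.All as VAll using ([]; _∷_)
import Data.Vec.Relation.Unary.All.Properties as VAllₚ
open import Function using (id; _∘_; const; _∋_)
open import Induction.WellFounded using (Acc; acc)
open import Level using (0ℓ)
open import Relation.Binary.Definitions using (DecidableEquality)
open import Relation.Binary.PropositionalEquality using
  ( _≡_; _≢_; refl; sym; trans; cong; cong₂; subst; module ≡-Reasoning )
import Relation.Binary.PropositionalEquality.Algebra as ≡
open import Relation.Nullary using (Dec; ¬_; yes; no)
open import Relation.Nullary.Decidable using (_×-dec_; ¬?; decidable-stable)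

open CommutativeSemigroupₚ ℕₚ.*-commutativeSemigroup using (x∙yz≈y∙xz)
open Sum (CommutativeRing.semiring ℤₚ.+-*-commutativeRing) using
  ( sum; sum-cong-≗; sum-replicate-zero; ∑-distrib-+; *-distribˡ-sum )

private
  variable
    k l m n r s t M N : ℕ
    A B X Y : Set
    P Q : X → Set

-- Integer vectors and linear maps

infixl 6 _⊕_ _⊖_
infixr 7 _⊙_

_⊕_ _⊖_ : Vec ℤ n → Vec ℤ n → Vec ℤ n
_⊕_   = zipWith ℤ._+_
x ⊖ y = x ⊕ Vec.map -_ y

_⊙_ : ℤ → Vec ℤ n → Vec ℤ n
c ⊙ x = Vec.map (c ℤ.*_) x

𝟘 : Vec ℤ n
𝟘 = replicate _ 0ℤ

e₁ : Vec ℤ (suc n)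
e₁ = 1ℤ ∷ 𝟘

_≟ᵛ_ : DecidableEquality (Vec ℤ n)
_≟ᵛ_ = Vecₚ.≡-dec ℤ._≟_

⊕-𝟘-abelianGroup : ℕ → AbelianGroup 0ℓ 0ℓ
⊕-𝟘-abelianGroup n = record
  { Carrier = Vec ℤ n
  ; _≈_     = _≡_
  ; _∙_     = _⊕_
  ; ε       = 𝟘
  ; _⁻¹     = Vec.map -_
  ; isAbelianGroup = record
    { isGroup = record
      { isMonoid = record
        { isSemigroup = record
          { isMagma = ≡.isMagma _⊕_
          ; assoc   = Vecₚ.zipWith-assoc ℤₚ.+-assoc
          }
        ; identity = Vecₚ.zipWith-identityˡ ℤₚ.+-identityˡ , Vecₚ.zipWith-identityʳ ℤₚ.+-identityʳ
        }
      ; inverse = Vecₚ.zipWith-inverseˡ ℤₚ.+-inverseˡ , Vecₚ.zipWith-inverseʳ ℤₚ.+-inverseʳ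
      ; ⁻¹-cong = cong (Vec.map -_)
      }
    ; comm = Vecₚ.zipWith-comm ℤₚ.+-comm
    }
  }

module _ {n : ℕ} where
  open AbelianGroup (⊕-𝟘-abelianGroup n) public using () renaming
    ( comm to ⊕-comm; identityˡ to ⊕-identityˡ; identityʳ to ⊕-identityʳ )
  open AbelianGroupₚ (⊕-𝟘-abelianGroup n) public using () renaming
    ( x∙y⁻¹≈ε⇒x≈y to x⊖y≡𝟘⇒x≡y; x≈y⇒x∙y⁻¹≈ε to x≡y⇒x⊖y≡𝟘; inverseˡ-unique to x⊕y≡𝟘⇒x≡-y
    ; //-rightDividesˡ to y⊖x⊕x≡y )
  open CommutativeSemigroupₚ (AbelianGroup.commutativeSemigroup (⊕-𝟘-abelianGroup n)) public using () renaming
    ( interchange to ⊕-interchange )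

[x⊕z]⊖[y⊕z]≡x⊖y : (x y z : Vec ℤ n) → (x ⊕ z) ⊖ (y ⊕ z) ≡ x ⊖ y
[x⊕z]⊖[y⊕z]≡x⊖y []      []      []      = refl
[x⊕z]⊖[y⊕z]≡x⊖y (a ∷ x) (b ∷ y) (c ∷ z) = cong₂ _∷_ (eq a b c) ([x⊕z]⊖[y⊕z]≡x⊖y x y z)
  where
  eq : ∀ a b c → (a ℤ.+ c) ℤ.- (b ℤ.+ c) ≡ a ℤ.- b
  eq = solve-∀

x⊖[x⊖y]≡y : (x y : Vec ℤ n) → x ⊖ (x ⊖ y) ≡ y
x⊖[x⊖y]≡y []      []      = refl
x⊖[x⊖y]≡y (a ∷ x) (b ∷ y) = cong₂ _∷_ (eq a b) (x⊖[x⊖y]≡y x y)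
  where
  eq : ∀ a b → a ℤ.- (a ℤ.- b) ≡ b
  eq = solve-∀

⊙-distribˡ-⊕ : ∀ c (x y : Vec ℤ n) → c ⊙ (x ⊕ y) ≡ c ⊙ x ⊕ c ⊙ y
⊙-distribˡ-⊕ c []      []      = refl
⊙-distribˡ-⊕ c (a ∷ x) (b ∷ y) = cong₂ _∷_ (ℤₚ.*-distribˡ-+ c a b) (⊙-distribˡ-⊕ c x y)

⊙-distribʳ-+ : ∀ b c (x : Vec ℤ n) → (b ℤ.+ c) ⊙ x ≡ b ⊙ x ⊕ c ⊙ x
⊙-distribʳ-+ b c []      = refl
⊙-distribʳ-+ b c (a ∷ x) = cong₂ _∷_ (ℤₚ.*-distribʳ-+ a b c) (⊙-distribʳ-+ b c x)

⊙-assoc : ∀ b c (x : Vec ℤ n) → (b ℤ.* c) ⊙ x ≡ b ⊙ c ⊙ x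
⊙-assoc b c x = trans (Vecₚ.map-cong (ℤₚ.*-assoc b c) x) (Vecₚ.map-∘ (b ℤ.*_) (c ℤ.*_) x)

⊙-comm : ∀ b c (x : Vec ℤ n) → b ⊙ c ⊙ x ≡ c ⊙ b ⊙ x
⊙-comm b c x = trans (sym (⊙-assoc b c x)) (trans (cong (_⊙ x) (ℤₚ.*-comm b c)) (⊙-assoc c b x))

⊙-zeroˡ : (x : Vec ℤ n) → 0ℤ ⊙ x ≡ 𝟘
⊙-zeroˡ x = Vecₚ.map-const x 0ℤ

⊙-zeroʳ : ∀ c → c ⊙ 𝟘 {n} ≡ 𝟘
⊙-zeroʳ {n} c = trans (Vecₚ.map-replicate (c ℤ.*_) 0ℤ n) (cong (replicate n) (ℤₚ.*-zeroʳ c))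

-1⊙x≡-x : (x : Vec ℤ n) → (- 1ℤ) ⊙ x ≡ Vec.map -_ x
-1⊙x≡-x = Vecₚ.map-cong ℤₚ.-1*i≡-i

e₁≢𝟘 : e₁ {n} ≢ 𝟘
e₁≢𝟘 ()

c⊙e₁≡c∷𝟘 : ∀ c → c ⊙ e₁ {n} ≡ c ∷ 𝟘
c⊙e₁≡c∷𝟘 c = cong₂ _∷_ (ℤₚ.*-identityʳ c) (⊙-zeroʳ c)

c⊙x≡𝟘⇒c≡0∨x≡𝟘 : ∀ c (x : Vec ℤ n) → c ⊙ x ≡ 𝟘 → c ≡ 0ℤ ⊎ x ≡ 𝟘
c⊙x≡𝟘⇒c≡0∨x≡𝟘 c []      _  = inj₂ refl
c⊙x≡𝟘⇒c≡0∨x≡𝟘 c (a ∷ x) eq with ℤₚ.i*j≡0⇒i≡0∨j≡0 c (cong head eq) | c⊙x≡𝟘⇒c≡0∨x≡𝟘 c x (cong tail eq)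
... | inj₁ c≡0 | _        = inj₁ c≡0
... | inj₂ _   | inj₁ c≡0 = inj₁ c≡0
... | inj₂ a≡0 | inj₂ x≡𝟘 = inj₂ (cong₂ _∷_ a≡0 x≡𝟘)

c⊙x≡𝟘⇒x≡𝟘 : ∀ {c} {x : Vec ℤ n} → c ≢ 0ℤ → c ⊙ x ≡ 𝟘 → x ≡ 𝟘
c⊙x≡𝟘⇒x≡𝟘 {c = c} {x} c≢0 eq with c⊙x≡𝟘⇒c≡0∨x≡𝟘 c x eq
... | inj₁ c≡0 = ⊥-elim (c≢0 c≡0)
... | inj₂ x≡𝟘 = x≡𝟘

c⊙x≡𝟘⇒c≡0 : ∀ {c} {x : Vec ℤ n} → x ≢ 𝟘 → c ⊙ x ≡ 𝟘 → c ≡ 0ℤ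
c⊙x≡𝟘⇒c≡0 {c = c} {x} x≢𝟘 eq with c⊙x≡𝟘⇒c≡0∨x≡𝟘 c x eq
... | inj₁ c≡0 = c≡0
... | inj₂ x≡𝟘 = ⊥-elim (x≢𝟘 x≡𝟘)

head∷tail : ∀ {A : Set} (x : Vec A (suc n)) → x ≡ head x ∷ tail x
head∷tail (_ ∷ _) = refl

Vec₀-irrelevant : ∀ {A : Set} {x y : Vec A n} → n ≡ 0 → x ≡ y
Vec₀-irrelevant {x = []} {[]} refl = refl

record Linear {m n} (f : Vec ℤ m → Vec ℤ n) : Set where
  field
    ⊕-homo : ∀ x y → f (x ⊕ y) ≡ f x ⊕ f y
    ⊙-homo : ∀ c x → f (c ⊙ x) ≡ c ⊙ f x

  𝟘-homo : f 𝟘 ≡ 𝟘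
  𝟘-homo = trans (cong f (sym (⊙-zeroˡ 𝟘))) (trans (⊙-homo 0ℤ 𝟘) (⊙-zeroˡ (f 𝟘)))

  ⊖-homo : ∀ x y → f (x ⊖ y) ≡ f x ⊖ f y
  ⊖-homo x y = trans (⊕-homo x (Vec.map -_ y)) (cong (f x ⊕_) (begin
    f (Vec.map -_ y)   ≡⟨ cong f (-1⊙x≡-x y) ⟨
    f ((- 1ℤ) ⊙ y)     ≡⟨ ⊙-homo (- 1ℤ) y ⟩
    (- 1ℤ) ⊙ f y       ≡⟨ -1⊙x≡-x (f y) ⟩
    Vec.map -_ (f y)   ∎))
    where open ≡-Reasoning

open Linear public

module _ {f : Vec ℤ m → Vec ℤ n} (F : Linear f) where

  ker-⊕ : ∀ {x y} → f x ≡ 𝟘 → f y ≡ 𝟘 → f (x ⊕ y) ≡ 𝟘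
  ker-⊕ {x} {y} fx≡𝟘 fy≡𝟘 = trans (⊕-homo F x y) (trans (cong₂ _⊕_ fx≡𝟘 fy≡𝟘) (⊕-identityʳ 𝟘))

  ker-⊙ : ∀ c {x} → f x ≡ 𝟘 → f (c ⊙ x) ≡ 𝟘
  ker-⊙ c {x} fx≡𝟘 = trans (⊙-homo F c x) (trans (cong (c ⊙_) fx≡𝟘) (⊙-zeroʳ c))

  ker-⊖ : ∀ {x y} → f x ≡ f y → f (x ⊖ y) ≡ 𝟘
  ker-⊖ {x} {y} fx≡fy = trans (⊖-homo F x y) (x≡y⇒x⊖y≡𝟘 fx≡fy)

  ker-saturated : ∀ {c x} → c ≢ 0ℤ → f (c ⊙ x) ≡ 𝟘 → f x ≡ 𝟘
  ker-saturated {c} {x} c≢0 f[cx]≡𝟘 = c⊙x≡𝟘⇒x≡𝟘 c≢0 (trans (sym (⊙-homo F c x)) f[cx]≡𝟘)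

id-linear : Linear {n} id
id-linear = record { ⊕-homo = λ _ _ → refl ; ⊙-homo = λ _ _ → refl }

∘-linear : {f : Vec ℤ m → Vec ℤ n} {g : Vec ℤ l → Vec ℤ m} → Linear f → Linear g → Linear (f ∘ g)
∘-linear {f = f} F G = record
  { ⊕-homo = λ x y → trans (cong f (⊕-homo G x y)) (⊕-homo F _ _)
  ; ⊙-homo = λ c x → trans (cong f (⊙-homo G c x)) (⊙-homo F c _)
  }

⊙-linear : ∀ c → Linear {n} (c ⊙_)
⊙-linear c = record { ⊕-homo = ⊙-distribˡ-⊕ c ; ⊙-homo = ⊙-comm c }

[]-linear : Linear {m} (const [])
[]-linear = record { ⊕-homo = λ _ _ → refl ; ⊙-homo = λ _ _ → refl }

tail-linear : Linear {suc n} tail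
tail-linear = record { ⊕-homo = λ { (_ ∷ _) (_ ∷ _) → refl } ; ⊙-homo = λ { _ (_ ∷ _) → refl } }

onTail : (Vec ℤ m → Vec ℤ n) → Vec ℤ (suc m) → Vec ℤ (suc n)
onTail f x = head x ∷ f (tail x)

onTail-linear : {f : Vec ℤ m → Vec ℤ n} → Linear f → Linear (onTail f)
onTail-linear F = record
  { ⊕-homo = λ { (a ∷ x) (b ∷ y) → cong (a ℤ.+ b ∷_) (⊕-homo F x y) }
  ; ⊙-homo = λ { c (a ∷ x) → cong (c ℤ.* a ∷_) (⊙-homo F c x) }
  }

-- Scalar products and matrices

infix  8 _·_
infixr 9 _*ᵛ_
infixl 9 _ᵛ*_

Mat : ℕ → ℕ → Set
Mat m n = Vec (Vec ℤ n) m

_·_ : Vec ℤ n → Vec ℤ n → ℤ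
[]      · []      = 0ℤ
(a ∷ x) · (b ∷ y) = a ℤ.* b ℤ.+ x · y

_*ᵛ_ : Mat m n → Vec ℤ n → Vec ℤ m
A *ᵛ x = Vec.map (_· x) A

_ᵛ*_ : Vec ℤ m → Mat m n → Vec ℤ n
[]      ᵛ* []      = 𝟘
(c ∷ z) ᵛ* (b ∷ B) = c ⊙ b ⊕ z ᵛ* B

·-comm : (x y : Vec ℤ n) → x · y ≡ y · x
·-comm []      []      = refl
·-comm (a ∷ x) (b ∷ y) = cong₂ ℤ._+_ (ℤₚ.*-comm a b) (·-comm x y)

·-distribˡ-⊕ : (x y z : Vec ℤ n) → x · (y ⊕ z) ≡ x · y ℤ.+ x · z
·-distribˡ-⊕ []      []      []      = refl
·-distribˡ-⊕ (a ∷ x) (b ∷ y) (c ∷ z) =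
  trans (cong (λ t → a ℤ.* (b ℤ.+ c) ℤ.+ t) (·-distribˡ-⊕ x y z)) (eq a b c (x · y) (x · z))
  where
  eq : ∀ a b c s t → a ℤ.* (b ℤ.+ c) ℤ.+ (s ℤ.+ t) ≡ (a ℤ.* b ℤ.+ s) ℤ.+ (a ℤ.* c ℤ.+ t)
  eq = solve-∀

·-⊙ : ∀ c (x y : Vec ℤ n) → x · (c ⊙ y) ≡ c ℤ.* x · y
·-⊙ c []      []      = sym (ℤₚ.*-zeroʳ c)
·-⊙ c (a ∷ x) (b ∷ y) = trans (cong (λ t → a ℤ.* (c ℤ.* b) ℤ.+ t) (·-⊙ c x y)) (eq a b c (x · y))
  where
  eq : ∀ a b c t → a ℤ.* (c ℤ.* b) ℤ.+ c ℤ.* t ≡ c ℤ.* (a ℤ.* b ℤ.+ t)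
  eq = solve-∀

·-distribʳ-⊕ : (x y z : Vec ℤ n) → (x ⊕ y) · z ≡ x · z ℤ.+ y · z
·-distribʳ-⊕ x y z = trans (·-comm (x ⊕ y) z) (trans (·-distribˡ-⊕ z x y) (cong₂ ℤ._+_ (·-comm z x) (·-comm z y)))

⊙-· : ∀ c (x y : Vec ℤ n) → (c ⊙ x) · y ≡ c ℤ.* x · y
⊙-· c x y = trans (·-comm (c ⊙ x) y) (trans (·-⊙ c y x) (cong (c ℤ.*_) (·-comm y x)))

·-zeroˡ : (x : Vec ℤ n) → 𝟘 · x ≡ 0ℤ
·-zeroˡ []      = refl
·-zeroˡ (a ∷ x) = trans (ℤₚ.+-identityˡ (𝟘 · x)) (·-zeroˡ x)

·-zeroʳ : (x : Vec ℤ n) → x · 𝟘 ≡ 0ℤ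
·-zeroʳ x = trans (·-comm x 𝟘) (·-zeroˡ x)

·-linear : (y : Vec ℤ n) → Linear (λ x → x · y ∷ [])
·-linear y = record
  { ⊕-homo = λ x z → cong (_∷ []) (·-distribʳ-⊕ x z y)
  ; ⊙-homo = λ c x → cong (_∷ []) (⊙-· c x y)
  }

*ᵛ-linear : (A : Mat m n) → Linear (A *ᵛ_)
*ᵛ-linear []      = []-linear
*ᵛ-linear (a ∷ A) = record
  { ⊕-homo = λ x y → cong₂ _∷_ (·-distribˡ-⊕ a x y) (⊕-homo (*ᵛ-linear A) x y)
  ; ⊙-homo = λ c x → cong₂ _∷_ (·-⊙ c a x) (⊙-homo (*ᵛ-linear A) c x)
  }

ᵛ*-linear : (B : Mat m n) → Linear (_ᵛ* B)
ᵛ*-linear []      = record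
  { ⊕-homo = λ { [] [] → sym (⊕-identityʳ 𝟘) } ; ⊙-homo = λ { c [] → sym (⊙-zeroʳ c) } }
ᵛ*-linear (b ∷ B) = record
  { ⊕-homo = λ { (a ∷ x) (c ∷ y) →
      trans (cong₂ _⊕_ (⊙-distribʳ-+ a c b) (⊕-homo (ᵛ*-linear B) x y)) (⊕-interchange _ _ _ _) }
  ; ⊙-homo = λ { c (a ∷ x) →
      trans (cong₂ _⊕_ (⊙-assoc c a b) (⊙-homo (ᵛ*-linear B) c x)) (sym (⊙-distribˡ-⊕ c _ _)) }
  }

ᵛ*-· : (z : Vec ℤ m) (B : Mat m n) (x : Vec ℤ n) → z ᵛ* B · x ≡ z · B *ᵛ x
ᵛ*-· []      []      x = ·-zeroˡ x
ᵛ*-· (c ∷ z) (b ∷ B) x =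
  trans (·-distribʳ-⊕ (c ⊙ b) (z ᵛ* B) x) (cong₂ ℤ._+_ (⊙-· c b x) (ᵛ*-· z B x))

ker-ᵛ* : {f : Vec ℤ m → Vec ℤ n} → Linear f → (z : Vec ℤ k) {B : Mat k m} →
  VAll.All (λ b → f b ≡ 𝟘) B → f (z ᵛ* B) ≡ 𝟘
ker-ᵛ* F []      []        = 𝟘-homo F
ker-ᵛ* F (c ∷ z) (fb ∷ fB) = ker-⊕ F (ker-⊙ F c fb) (ker-ᵛ* F z fB)

-- Unimodular transformations and gcd reduction

-- Products of elementary transformations, kept as syntax so that inverse and inverse transpose are again
-- of this form.
data Unimodular : ℕ → Set where
  idᵁ   : Unimodular n
  _⨾_   : Unimodular n → Unimodular n → Unimodular n
  shear : ℤ → Unimodular (suc (suc n))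
  swap  : Unimodular (suc (suc n))
  lift  : Unimodular n → Unimodular (suc n)

infixl 5 _⨾_
infix  10 _⁻¹ _⁻ᵀ

⟦_⟧ : Unimodular n → Vec ℤ n → Vec ℤ n
⟦ idᵁ ⟧     x           = x
⟦ u ⨾ v ⟧   x           = ⟦ v ⟧ (⟦ u ⟧ x)
⟦ shear c ⟧ (a ∷ b ∷ x) = a ℤ.+ c ℤ.* b ∷ b ∷ x
⟦ swap ⟧    (a ∷ b ∷ x) = b ∷ a ∷ x
⟦ lift u ⟧  x           = onTail ⟦ u ⟧ x

_⁻¹ : Unimodular n → Unimodular n
idᵁ ⁻¹       = idᵁ
(u ⨾ v) ⁻¹   = v ⁻¹ ⨾ u ⁻¹
(shear c) ⁻¹ = shear (- c)
swap ⁻¹      = swap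
(lift u) ⁻¹  = lift (u ⁻¹)

_⁻ᵀ : Unimodular n → Unimodular n
idᵁ ⁻ᵀ       = idᵁ
(u ⨾ v) ⁻ᵀ   = u ⁻ᵀ ⨾ v ⁻ᵀ
(shear c) ⁻ᵀ = swap ⨾ shear (- c) ⨾ swap
swap ⁻ᵀ      = swap
(lift u) ⁻ᵀ  = lift (u ⁻ᵀ)

⟦⟧-linear : (u : Unimodular n) → Linear ⟦ u ⟧
⟦⟧-linear idᵁ       = id-linear
⟦⟧-linear (u ⨾ v)   = ∘-linear (⟦⟧-linear v) (⟦⟧-linear u)
⟦⟧-linear (shear c) = record
  { ⊕-homo = λ { (a ∷ b ∷ x) (a′ ∷ b′ ∷ y) → cong (_∷ _) (+-shear c a b a′ b′) }
  ; ⊙-homo = λ { d (a ∷ b ∷ x) → cong (_∷ _) (*-shear c d a b) }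
  }
  where
  +-shear : ∀ c a b a′ b′ → (a ℤ.+ a′) ℤ.+ c ℤ.* (b ℤ.+ b′) ≡ (a ℤ.+ c ℤ.* b) ℤ.+ (a′ ℤ.+ c ℤ.* b′)
  +-shear = solve-∀
  *-shear : ∀ c d a b → d ℤ.* a ℤ.+ c ℤ.* (d ℤ.* b) ≡ d ℤ.* (a ℤ.+ c ℤ.* b)
  *-shear = solve-∀
⟦⟧-linear swap      = record
  { ⊕-homo = λ { (_ ∷ _ ∷ _) (_ ∷ _ ∷ _) → refl } ; ⊙-homo = λ { _ (_ ∷ _ ∷ _) → refl } }
⟦⟧-linear (lift u)  = onTail-linear (⟦⟧-linear u)

⁻¹-inverseˡ : (u : Unimodular n) → ∀ x → ⟦ u ⁻¹ ⟧ (⟦ u ⟧ x) ≡ x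
⁻¹-inverseˡ idᵁ       x           = refl
⁻¹-inverseˡ (u ⨾ v)   x           = trans (cong ⟦ u ⁻¹ ⟧ (⁻¹-inverseˡ v (⟦ u ⟧ x))) (⁻¹-inverseˡ u x)
⁻¹-inverseˡ (shear c) (a ∷ b ∷ x) = cong (_∷ _) (eq c a b)
  where
  eq : ∀ c a b → (a ℤ.+ c ℤ.* b) ℤ.+ (- c) ℤ.* b ≡ a
  eq = solve-∀
⁻¹-inverseˡ swap      (a ∷ b ∷ x) = refl
⁻¹-inverseˡ (lift u)  (a ∷ x)     = cong (a ∷_) (⁻¹-inverseˡ u x)

⁻¹-inverseʳ : (u : Unimodular n) → ∀ x → ⟦ u ⟧ (⟦ u ⁻¹ ⟧ x) ≡ x
⁻¹-inverseʳ idᵁ       x           = refl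
⁻¹-inverseʳ (u ⨾ v)   x           = trans (cong ⟦ v ⟧ (⁻¹-inverseʳ u (⟦ v ⁻¹ ⟧ x))) (⁻¹-inverseʳ v x)
⁻¹-inverseʳ (shear c) (a ∷ b ∷ x) = cong (_∷ _) (eq c a b)
  where
  eq : ∀ c a b → (a ℤ.+ (- c) ℤ.* b) ℤ.+ c ℤ.* b ≡ a
  eq = solve-∀
⁻¹-inverseʳ swap      (a ∷ b ∷ x) = refl
⁻¹-inverseʳ (lift u)  (a ∷ x)     = cong (a ∷_) (⁻¹-inverseʳ u x)

⟦⟧-⁻ᵀ-· : (u : Unimodular n) → ∀ x y → ⟦ u ⟧ x · ⟦ u ⁻ᵀ ⟧ y ≡ x · y
⟦⟧-⁻ᵀ-· idᵁ       x           y           = refl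
⟦⟧-⁻ᵀ-· (u ⨾ v)   x           y           = trans (⟦⟧-⁻ᵀ-· v (⟦ u ⟧ x) (⟦ u ⁻ᵀ ⟧ y)) (⟦⟧-⁻ᵀ-· u x y)
⟦⟧-⁻ᵀ-· (shear c) (a ∷ b ∷ x) (a′ ∷ b′ ∷ y) = eq c a b a′ b′ (x · y)
  where
  eq : ∀ c a b a′ b′ t →
    (a ℤ.+ c ℤ.* b) ℤ.* a′ ℤ.+ (b ℤ.* (b′ ℤ.+ (- c) ℤ.* a′) ℤ.+ t) ≡ a ℤ.* a′ ℤ.+ (b ℤ.* b′ ℤ.+ t)
  eq = solve-∀
⟦⟧-⁻ᵀ-· swap      (a ∷ b ∷ x) (a′ ∷ b′ ∷ y) = eq (a ℤ.* a′) (b ℤ.* b′) (x · y)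
  where
  eq : ∀ s t u → t ℤ.+ (s ℤ.+ u) ≡ s ℤ.+ (t ℤ.+ u)
  eq = solve-∀
⟦⟧-⁻ᵀ-· (lift u)  (a ∷ x)     (a′ ∷ y)    = cong (λ t → a ℤ.* a′ ℤ.+ t) (⟦⟧-⁻ᵀ-· u x y)

⟦⟧≡𝟘⇒≡𝟘 : (u : Unimodular n) → ∀ {x} → ⟦ u ⟧ x ≡ 𝟘 → x ≡ 𝟘
⟦⟧≡𝟘⇒≡𝟘 u {x} eq = trans (sym (⁻¹-inverseˡ u x)) (trans (cong ⟦ u ⁻¹ ⟧ eq) (𝟘-homo (⟦⟧-linear (u ⁻¹))))

reduce-pair : ∀ a b → ∃[ u ] ∃[ g ] ∀ (x : Vec ℤ n) → ⟦ u ⟧ (a ∷ b ∷ x) ≡ g ∷ 0ℤ ∷ x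
reduce-pair {n} a b = euclid a b (<-wellFounded ∣ b ∣)
  where
  open ≡-Reasoning
  eq : ∀ r q b → (r ℤ.+ q ℤ.* b) ℤ.+ (- q) ℤ.* b ≡ r
  eq = solve-∀
  euclid : ∀ a b → Acc _<_ ∣ b ∣ → ∃[ u ] ∃[ g ] ∀ (x : Vec ℤ n) → ⟦ u ⟧ (a ∷ b ∷ x) ≡ g ∷ 0ℤ ∷ x
  euclid a b (acc rec) with b ℤ.≟ 0ℤ
  ... | yes refl = idᵁ , a , λ _ → refl
  ... | no b≢0 =
    let instance _ = ℤ.≢-nonZero b≢0
        q = a ℤ/./ b
        r = a ℤ/.% b
        u , g , reduced = euclid b (+ r) (rec (ℤ/.n%d<d a b))
    in shear (- q) ⨾ swap ⨾ u , g , λ x → trans (cong (λ t → ⟦ u ⟧ (b ∷ t ∷ x)) (begin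
         a ℤ.+ (- q) ℤ.* b                    ≡⟨ cong (ℤ._+ (- q) ℤ.* b) (ℤ/.a≡a%n+[a/n]*n a b) ⟩
         (+ r ℤ.+ q ℤ.* b) ℤ.+ (- q) ℤ.* b    ≡⟨ eq (+ r) q b ⟩
         + r                                  ∎)) (reduced x)

reduce : (x : Vec ℤ (suc n)) → ∃[ u ] ∃[ g ] ⟦ u ⟧ x ≡ g ∷ 𝟘
reduce (a ∷ [])    = idᵁ , a , refl
reduce (a ∷ b ∷ x) =
  let u , g , ux≡  = reduce (b ∷ x)
      v , d , vag≡ = reduce-pair a g
  in lift u ⨾ v , d , trans (cong (λ t → ⟦ v ⟧ (a ∷ t)) ux≡) (vag≡ 𝟘)

kernel-nontrivial : {f : Vec ℤ n → Vec ℤ m} → Linear f → m < n → ∃[ x ] x ≢ 𝟘 × f x ≡ 𝟘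
kernel-nontrivial {suc n} {zero}  {f} F _         = e₁ , e₁≢𝟘 , Vec₀-irrelevant refl
kernel-nontrivial {suc n} {suc m} {f} F (s≤s m<n) with reduce (f e₁)
... | u , g , ufe₁≡ with g ℤ.≟ 0ℤ
...   | yes refl = e₁ , e₁≢𝟘 , ⟦⟧≡𝟘⇒≡𝟘 u ufe₁≡
...   | no g≢0   = x , x≢𝟘 , ⟦⟧≡𝟘⇒≡𝟘 u (begin
    uf x                                 ≡⟨ ⊖-homo uf-linear (g ⊙ (0ℤ ∷ y)) (c ⊙ e₁) ⟩
    uf (g ⊙ (0ℤ ∷ y)) ⊖ uf (c ⊙ e₁)      ≡⟨ cong₂ _⊖_ (⊙-homo uf-linear g (0ℤ ∷ y)) (⊙-homo uf-linear c e₁) ⟩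
    g ⊙ uf (0ℤ ∷ y) ⊖ c ⊙ uf e₁          ≡⟨ cong₂ (λ s t → g ⊙ s ⊖ c ⊙ t) uf[0∷y]≡ uf[e₁]≡ ⟩
    g ⊙ c ⊙ e₁ ⊖ c ⊙ g ⊙ e₁              ≡⟨ x≡y⇒x⊖y≡𝟘 (⊙-comm g c e₁) ⟩
    𝟘                                    ∎)
  where
  open ≡-Reasoning
  uf = ⟦ u ⟧ ∘ f
  uf-linear : Linear uf
  uf-linear = ∘-linear (⟦⟧-linear u) F
  0∷-linear : Linear {n} (0ℤ ∷_)
  0∷-linear = record { ⊕-homo = λ _ _ → refl ; ⊙-homo = λ c x → cong (_∷ c ⊙ x) (sym (ℤₚ.*-zeroʳ c)) }
  smaller = kernel-nontrivial (∘-linear tail-linear (∘-linear uf-linear 0∷-linear)) m<n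
  y = proj₁ smaller
  c = head (uf (0ℤ ∷ y))
  uf[e₁]≡ : uf e₁ ≡ g ⊙ e₁
  uf[e₁]≡ = trans ufe₁≡ (sym (c⊙e₁≡c∷𝟘 g))
  uf[0∷y]≡ : uf (0ℤ ∷ y) ≡ c ⊙ e₁
  uf[0∷y]≡ = trans (head∷tail (uf (0ℤ ∷ y))) (trans (cong (c ∷_) (proj₂ (proj₂ smaller))) (sym (c⊙e₁≡c∷𝟘 c)))
  x = g ⊙ (0ℤ ∷ y) ⊖ c ⊙ e₁
  x≢𝟘 : x ≢ 𝟘
  x≢𝟘 x≡𝟘 = proj₁ (proj₂ smaller) (c⊙x≡𝟘⇒x≡𝟘 g≢0
    (trans (cong tail (x⊖y≡𝟘⇒x≡y (g ⊙ (0ℤ ∷ y)) (c ⊙ e₁) x≡𝟘)) (⊙-zeroʳ c)))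

-- Cardinality bounds

-- Bounding the length of every duplicate-free list of elements makes sense for undecidable P.
Atmost : (X → Set) → ℕ → Set
Atmost P N = ∀ xs → Unique xs → All P xs → length xs ≤ N

atmost-≤ : M ≤ N → Atmost P M → Atmost P N
atmost-≤ M≤N bound xs u ps = ℕₚ.≤-trans (bound xs u ps) M≤N

atmost-⊆ : (∀ {x} → P x → Q x) → Atmost Q N → Atmost P N
atmost-⊆ P⊆Q bound xs u ps = bound xs u (All.map P⊆Q ps)

atmost-inhabited : (∀ x → P x → Atmost P N) → Atmost P N
atmost-inhabited bound []         _ _          = z≤n
atmost-inhabited bound xs@(x ∷ _) u ps@(p ∷ _) = bound x p xs u ps

atmost-1 : (∀ x y → P x → P y → x ≡ y) → Atmost P 1
atmost-1 unique []          _               _           = z≤n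
atmost-1 unique (x ∷ [])    _               _           = s≤s z≤n
atmost-1 unique (x ∷ y ∷ _) ((x≢y ∷ _) ∷ _) (p ∷ q ∷ _) = ⊥-elim (x≢y (unique x y p q))

atmost-injection : (f : X → Y) → (∀ {x} → P x → Q (f x)) → (∀ {x y} → P x → P y → f x ≡ f y → x ≡ y) →
  Atmost Q N → Atmost P N
atmost-injection {P = P} {N = N} f P⇒Qf injective bound xs u ps = subst (_≤ N) (Listₚ.length-map f xs)
  (bound (List.map f xs) (AllPairsₚ.map⁺ (distinct u ps)) (Allₚ.map⁺ (All.map P⇒Qf ps)))
  where
  distinct : ∀ {xs} → Unique xs → All P xs → AllPairs (λ x y → f x ≢ f y) xs
  distinct []        []       = []
  distinct (x≢ ∷ u) (p ∷ ps) =
    All.zipWith (λ (x≢y , q) fx≡fy → x≢y (injective p q fx≡fy)) (x≢ , ps) ∷ distinct u ps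

unique-⊆ : ∀ {xs ys : List X} → xs ⊆ ys → Unique ys → Unique xs
unique-⊆ []         []       = []
unique-⊆ (_ ∷ʳ τ)   (_ ∷ u)  = unique-⊆ τ u
unique-⊆ (refl ∷ τ) (x≢ ∷ u) = All-resp-⊆ τ x≢ ∷ unique-⊆ τ u

partition-⊎ : ∀ {xs} → All (λ x → P x ⊎ Q x) xs →
  ∃[ ys ] ∃[ zs ] ys ⊆ xs × zs ⊆ xs × All P ys × All Q zs × length xs ≡ length ys + length zs
partition-⊎ []            = [] , [] , [] , [] , [] , [] , refl
partition-⊎ (inj₁ p ∷ rs) =
  let ys , zs , σ , τ , ps , qs , len = partition-⊎ rs
  in _ ∷ ys , zs , refl ∷ σ , _ ∷ʳ τ , p ∷ ps , qs , cong suc len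
partition-⊎ (inj₂ q ∷ rs) =
  let ys , zs , σ , τ , ps , qs , len = partition-⊎ rs
  in ys , _ ∷ zs , _ ∷ʳ σ , refl ∷ τ , ps , q ∷ qs , trans (cong suc len) (sym (ℕₚ.+-suc (length ys) (length zs)))

atmost-⊎ : Atmost P M → Atmost Q N → Atmost (λ x → P x ⊎ Q x) (M + N)
atmost-⊎ {M = M} {N = N} boundP boundQ xs u rs =
  let ys , zs , σ , τ , ps , qs , len = partition-⊎ rs
  in subst (_≤ M + N) (sym len) (ℕₚ.+-mono-≤ (boundP ys (unique-⊆ σ u) ps) (boundQ zs (unique-⊆ τ u) qs))

atmost-by-cases : (∀ x → Dec (Q x)) → Atmost (λ x → P x × Q x) M → Atmost (λ x → P x × ¬ Q x) N → Atmost P (M + N)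
atmost-by-cases {Q = Q} {P = P} Q? yes-bound no-bound = atmost-⊆ split (atmost-⊎ yes-bound no-bound)
  where
  split : ∀ {x} → P x → (P x × Q x) ⊎ (P x × ¬ Q x)
  split {x} p with Q? x
  ... | yes q = inj₁ (p , q)
  ... | no ¬q = inj₂ (p , ¬q)

atmost-cover : (R : X → Y → Set) (ys : List Y) → (∀ {x} → P x → Any (R x) ys) →
  (∀ y → Atmost (λ x → P x × R x y) M) → Atmost P (length ys * M)
atmost-cover {P = P} {M = M} R ys cover fibre = atmost-⊆ (λ p → p , cover p) (union ys)
  where
  union : ∀ ys → Atmost (λ x → P x × Any (R x) ys) (length ys * M)
  union []       = λ { [] _ _ → z≤n ; (_ ∷ _) _ ((_ , ()) ∷ _) }
  union (y ∷ ys) = atmost-⊆ (λ { (p , here r) → inj₁ (p , r) ; (p , there r) → inj₂ (p , r) })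
    (atmost-⊎ (fibre y) (union ys))

atmost-list : (ys : List X) → (∀ {x} → P x → x ∈ ys) → Atmost P (length ys)
atmost-list ys P⊆ys = atmost-≤ (ℕₚ.≤-reflexive (ℕₚ.*-identityʳ (length ys)))
  (atmost-cover _≡_ ys P⊆ys λ y → atmost-1 λ { _ _ (_ , refl) (_ , refl) → refl })

atmost-fibre : DecidableEquality Y → (f : X → Y) → (∀ {x} → P x → Q (f x)) → Atmost Q N →
  (∀ y → Atmost (λ x → P x × f x ≡ y) M) → Atmost P (N * M)
atmost-fibre {P = P} {Q = Q} {M = M} _≟_ f P⇒Qf bound fibre xs u ps = ℕₚ.≤-trans
  (atmost-cover (λ x y → f x ≡ y) images (∈ₚ.∈-deduplicate⁺ _≟_ ∘ ∈ₚ.∈-map⁺ f)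
    (λ y → atmost-⊆ (λ (x∈ , fx≡y) → All.lookup ps x∈ , fx≡y) (fibre y))
    xs u (All.tabulate id))
  (ℕₚ.*-monoˡ-≤ M (bound images (DecUniqueₚ.deduplicate-! _≟_ (List.map f xs))
    (All.tabulate λ y∈ → imageQ (∈ₚ.∈-map⁻ f (∈ₚ.∈-deduplicate⁻ _≟_ (List.map f xs) y∈)))))
  where
  images = List.deduplicate _≟_ (List.map f xs)
  imageQ : ∀ {y} → ∃ (λ x → x ∈ xs × y ≡ f x) → Q y
  imageQ (x , x∈ , refl) = P⇒Qf (All.lookup ps x∈)

atmost-∷ : {P : Vec X (suc k) → Set} → DecidableEquality X → (∀ {x xs} → P (x ∷ xs) → Q x) → Atmost Q N →
  (∀ x → Atmost (λ xs → P (x ∷ xs)) M) → Atmost P (N * M)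
atmost-∷ _≟_ P⇒Q bound rest = atmost-fibre _≟_ head (λ { {_ ∷ _} p → P⇒Q p }) bound λ x →
  atmost-injection tail (λ { {_ ∷ _} (p , refl) → p })
    (λ { {_ ∷ _} {_ ∷ _} (_ , refl) (_ , refl) refl → refl }) (rest x)

atmost-lookup : {P : Fin k → X → Set} → DecidableEquality X → (∀ i → Atmost (P i) N) →
  Atmost (λ v → ∀ i → P i (lookup v i)) (N ^ k)
atmost-lookup {k = zero}  _≟_ bound = atmost-1 λ { [] [] _ _ → refl }
atmost-lookup {k = suc k} _≟_ bound = atmost-∷ _≟_ (λ p → p zero) (bound zero) λ _ →
  atmost-⊆ (λ p i → p (suc i)) (atmost-lookup _≟_ (λ i → bound (suc i)))

atmost-all : {P : X → Set} → DecidableEquality X → Atmost P N → Atmost (VAll.All P {k}) (N ^ k)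
atmost-all _≟_ bound = atmost-⊆ VAllₚ.lookup⁺ (atmost-lookup _≟_ (λ _ → bound))

-- Lists of vectors with prescribed entries

∏ : Vec ℕ k → ℕ
∏ = Vec.foldr _ _*_ 1

length-cartesianProductWith : ∀ {C : Set} (f : A → B → C) xs ys →
  length (List.cartesianProductWith f xs ys) ≡ length xs * length ys
length-cartesianProductWith f []       ys = refl
length-cartesianProductWith f (x ∷ xs) ys = trans (Listₚ.length-++ (List.map (f x) ys))
  (cong₂ _+_ (Listₚ.length-map (f x) ys) (length-cartesianProductWith f xs ys))

choices : Vec (List A) k → List (Vec A k)
choices []         = [] ∷ []
choices (xs ∷ xss) = List.cartesianProductWith _∷_ xs (choices xss)

∈-choices : ∀ {v : Vec A k} {xss} → Pointwise _∈_ v xss → v ∈ choices xss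
∈-choices []        = here refl
∈-choices (x∈ ∷ v∈) = ∈ₚ.∈-cartesianProductWith⁺ _∷_ x∈ (∈-choices v∈)

length-choices : (xss : Vec (List A) k) → length (choices xss) ≡ ∏ (Vec.map length xss)
length-choices []         = refl
length-choices (xs ∷ xss) = trans (length-cartesianProductWith _∷_ xs (choices xss))
  (cong (length xs *_) (length-choices xss))

vecsOf-suc : ∀ k (xs : List A) → vecsOf (suc k) xs ≡ List.cartesianProductWith _∷_ xs (vecsOf k xs)
vecsOf-suc k xs = prepend xs
  where
  prepend : ∀ ys → List.concatMap (λ y → List.map (y ∷_) (vecsOf k xs)) ys ≡
    List.cartesianProductWith _∷_ ys (vecsOf k xs)
  prepend []       = refl
  prepend (y ∷ ys) = cong (List.map (y ∷_) (vecsOf k xs) List.++_) (prepend ys)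

∈-vecsOf⁺ : ∀ {xs : List A} {v : Vec A k} → VAll.All (_∈ xs) v → v ∈ vecsOf k xs
∈-vecsOf⁺           []        = here refl
∈-vecsOf⁺ {xs = xs} (x∈ ∷ v∈) = subst (_ ∈_) (sym (vecsOf-suc _ xs))
  (∈ₚ.∈-cartesianProductWith⁺ _∷_ x∈ (∈-vecsOf⁺ v∈))

∈-vecsOf⁻ : ∀ {xs : List A} {v : Vec A k} → v ∈ vecsOf k xs → VAll.All (_∈ xs) v
∈-vecsOf⁻                     {v = []}    _  = []
∈-vecsOf⁻ {k = suc k} {xs} {v = x ∷ v} v∈
  with ∈ₚ.∈-cartesianProductWith⁻ _∷_ xs (vecsOf k xs) (subst (x ∷ v ∈_) (vecsOf-suc k xs) v∈)
... | _ , _ , x∈ , v∈′ , refl = x∈ ∷ ∈-vecsOf⁻ v∈′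

vecsOf-unique : ∀ k {xs : List A} → Unique xs → Unique (vecsOf k xs)
vecsOf-unique zero         u = [] ∷ []
vecsOf-unique (suc k) {xs} u = subst Unique (sym (vecsOf-suc k xs))
  (Uniqueₚ.cartesianProductWith⁺ _∷_ Vecₚ.∷-injective u (vecsOf-unique k u))

length-vecsOf : ∀ k (xs : List A) → length (vecsOf k xs) ≡ length xs ^ k
length-vecsOf zero    xs = refl
length-vecsOf (suc k) xs = begin
  length (vecsOf (suc k) xs)                                   ≡⟨ cong length (vecsOf-suc k xs) ⟩
  length (List.cartesianProductWith _∷_ xs (vecsOf k xs))      ≡⟨ length-cartesianProductWith _∷_ xs (vecsOf k xs) ⟩
  length xs * length (vecsOf k xs)                             ≡⟨ cong (length xs *_) (length-vecsOf k xs) ⟩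
  length xs * length xs ^ k                                    ∎
  where open ≡-Reasoning

atmost-cover-≤ : (R : X → ℕ → Set) → (∀ {x} → P x → ∃[ i ] i ≤ N × R x i) →
  (∀ {i} → i ≤ N → Atmost (λ x → P x × R x i) M) → Atmost P (suc N * M)
atmost-cover-≤ {P = P} {N} {M} R cover fibre = subst (λ t → Atmost P (t * M)) (Listₚ.length-upTo (suc N))
  (atmost-cover (λ x i → i ≤ N × R x i) (List.upTo (suc N))
    (λ p → let i , i≤N , r = cover p in lose (∈ₚ.∈-upTo⁺ (s≤s i≤N)) (i≤N , r))
    λ i → atmost-inhabited λ _ (_ , i≤N , _) → atmost-⊆ (λ (p , _ , r) → p , r) (fibre i≤N))

atmost-cover-all-≤ : (R : X → Vec ℕ k → Set) → (∀ {x} → P x → ∃[ v ] VAll.All (_≤ N) v × R x v) →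
  (∀ {v} → VAll.All (_≤ N) v → Atmost (λ x → P x × R x v) M) → Atmost P (suc N ^ k * M)
atmost-cover-all-≤ {k = k} {P} {N} {M} R cover fibre = subst (λ t → Atmost P (t * M)) length≡
  (atmost-cover (λ x v → VAll.All (_≤ N) v × R x v) (vecsOf k (List.upTo (suc N)))
    (λ p → let v , v≤N , r = cover p in lose (∈-vecsOf⁺ (VAll.map (∈ₚ.∈-upTo⁺ ∘ s≤s) v≤N)) (v≤N , r))
    λ v → atmost-inhabited λ _ (_ , v≤N , _) → atmost-⊆ (λ (p , _ , r) → p , r) (fibre v≤N))
  where
  length≡ : length (vecsOf k (List.upTo (suc N))) ≡ suc N ^ k
  length≡ = trans (length-vecsOf k (List.upTo (suc N))) (cong (_^ k) (Listₚ.length-upTo (suc N)))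

-- Boxes

length-range : ∀ H → length (range H) ≡ suc (2 * H)
length-range H = trans (Listₚ.length-map _ (List.upTo (suc (2 * H)))) (Listₚ.length-upTo (suc (2 * H)))

range-unique : ∀ H → Unique (range H)
range-unique H = Uniqueₚ.map⁺
  (λ {i} {j} eq → ℤₚ.+-injective (AbelianGroupₚ.∙-cancelʳ ℤₚ.+-0-abelianGroup (- + H) (+ i) (+ j) eq))
  (Uniqueₚ.upTo⁺ (suc (2 * H)))

∈-range⁺ : ∀ {H a} → ∣ a ∣ ≤ H → a ∈ range H
∈-range⁺ {H} {+ i} i≤H = subst (_∈ range H) (begin
    + (i + H) ℤ.- + H        ≡⟨ ℤₚ.m-n≡m⊖n (i + H) H ⟩
    (i + H) ℤ.⊖ H            ≡⟨ ℤₚ.⊖-≥ (ℕₚ.m≤n+m H i) ⟩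
    + (i + H ∸ H)            ≡⟨ cong +_ (ℕₚ.m+n∸n≡m i H) ⟩
    + i                      ∎)
  (∈ₚ.∈-map⁺ _ (∈ₚ.∈-upTo⁺ (s≤s (ℕₚ.+-mono-≤ i≤H (ℕₚ.m≤m+n H 0)))))
  where open ≡-Reasoning
∈-range⁺ {H} {ℤ.-[1+ i ]} i<H = subst (_∈ range H) (begin
    + (H ∸ suc i) ℤ.- + H       ≡⟨ ℤₚ.m-n≡m⊖n (H ∸ suc i) H ⟩
    (H ∸ suc i) ℤ.⊖ H           ≡⟨ ℤₚ.⊖-≤ (ℕₚ.m∸n≤m H (suc i)) ⟩
    - + (H ∸ (H ∸ suc i))       ≡⟨ cong (λ t → - + t) (ℕₚ.m∸[m∸n]≡n i<H) ⟩
    ℤ.-[1+ i ]                  ∎)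
  (∈ₚ.∈-map⁺ _ (∈ₚ.∈-upTo⁺ (s≤s (ℕₚ.≤-trans (ℕₚ.m∸n≤m H (suc i)) (ℕₚ.m≤n*m H 2)))))
  where open ≡-Reasoning

∈-range⁻ : ∀ {H a} → a ∈ range H → ∣ a ∣ ≤ H
∈-range⁻ {H} a∈ with ∈ₚ.∈-map⁻ _ a∈
... | i , i∈ , refl = subst (_≤ H) (cong ∣_∣ (sym (ℤₚ.m-n≡m⊖n i H))) (distance (ℕₚ.≤-total H i))
  where
  open ℕₚ.≤-Reasoning
  distance : H ≤ i ⊎ i ≤ H → ∣ i ℤ.⊖ H ∣ ≤ H
  distance (inj₁ H≤i) = begin
    ∣ i ℤ.⊖ H ∣      ≡⟨ ℤₚ.∣m⊖n∣≡∣n⊖m∣ i H ⟩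
    ∣ H ℤ.⊖ i ∣      ≡⟨ ℤₚ.∣⊖∣-≤ H≤i ⟩
    i ∸ H            ≤⟨ ℕₚ.∸-monoˡ-≤ H (s≤s⁻¹ (∈ₚ.∈-upTo⁻ i∈)) ⟩
    H + (H + 0) ∸ H  ≡⟨ ℕₚ.m+n∸m≡n H (H + 0) ⟩
    H + 0            ≡⟨ ℕₚ.+-identityʳ H ⟩
    H                ∎
  distance (inj₂ i≤H) = begin
    ∣ i ℤ.⊖ H ∣      ≡⟨ ℤₚ.∣⊖∣-≤ i≤H ⟩
    H ∸ i            ≤⟨ ℕₚ.m∸n≤m H i ⟩
    H                ∎

Bounded : ℕ → Vec ℤ n → Set
Bounded H = VAll.All (λ a → ∣ a ∣ ≤ H)

box : ∀ n → ℕ → List (Vec ℤ n)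
box n H = vecsOf n (range H)

∈-box⁺ : ∀ {H} {x : Vec ℤ n} → Bounded H x → x ∈ box n H
∈-box⁺ bx = ∈-vecsOf⁺ (VAll.map ∈-range⁺ bx)

∈-box⁻ : ∀ {H} {x : Vec ℤ n} → x ∈ box n H → Bounded H x
∈-box⁻ x∈ = VAll.map ∈-range⁻ (∈-vecsOf⁻ x∈)

length-box : ∀ n H → length (box n H) ≡ suc (2 * H) ^ n
length-box n H = trans (length-vecsOf n (range H)) (cong (_^ n) (length-range H))

atmost-box : ∀ H → Atmost (Bounded {n} H) (suc (2 * H) ^ n)
atmost-box {n} H = subst (Atmost _) (length-box n H) (atmost-list _ ∈-box⁺)

bounded-⊕ : {x y : Vec ℤ n} → Bounded M x → Bounded N y → Bounded (M + N) (x ⊕ y)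
bounded-⊕ = VAll.zipWith λ {a} {b} p q → ℕₚ.≤-trans (ℤₚ.∣i+j∣≤∣i∣+∣j∣ a b) (ℕₚ.+-mono-≤ p q)

bounded-⊖ : {x y : Vec ℤ n} → Bounded M x → Bounded N y → Bounded (M + N) (x ⊖ y)
bounded-⊖ {N = N} bx by = bounded-⊕ bx (VAllₚ.map⁺ (VAll.map (λ {b} → subst (_≤ N) (sym (ℤₚ.∣-i∣≡∣i∣ b))) by))

bounded-⊙ : ∀ {c} {x : Vec ℤ n} → ∣ c ∣ ≤ M → Bounded N x → Bounded (M * N) (c ⊙ x)
bounded-⊙ {M = M} {N = N} {c} bc bx =
  VAllₚ.map⁺ (VAll.map (λ {a} ba → subst (_≤ M * N) (sym (ℤₚ.∣i*j∣≡∣i∣*∣j∣ c a)) (ℕₚ.*-mono-≤ bc ba)) bx)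

bounded-𝟘 : Bounded M (𝟘 {n})
bounded-𝟘 {n = zero}  = []
bounded-𝟘 {n = suc n} = z≤n ∷ bounded-𝟘

bounded-ᵛ* : {z : Vec ℤ m} {B : Mat m n} → Bounded M z → VAll.All (Bounded N) B → Bounded (m * (M * N)) (z ᵛ* B)
bounded-ᵛ*             []        []        = bounded-𝟘
bounded-ᵛ* {z = c ∷ _} (bc ∷ bz) (bb ∷ bB) = bounded-⊕ (bounded-⊙ {c = c} bc bb) (bounded-ᵛ* bz bB)

short-multiple : ∀ {c} {x : Vec ℤ n} → M < ∣ c ∣ → Bounded M (c ⊙ x) → x ≡ 𝟘
short-multiple         {x = []}    M<c []       = refl
short-multiple {c = c} {x = a ∷ x} M<c (p ∷ ps) = cong₂ _∷_ a≡0 (short-multiple {c = c} M<c ps)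
  where
  open ℕₚ.≤-Reasoning
  a≡0 : a ≡ 0ℤ
  a≡0 = ℤₚ.∣i∣≡0⇒i≡0 (ℕₚ.n<1⇒n≡0 (ℕₚ.*-cancelˡ-< ∣ c ∣ ∣ a ∣ 1 (begin-strict
    ∣ c ∣ * ∣ a ∣   ≡⟨ ℤₚ.∣i*j∣≡∣i∣*∣j∣ c a ⟨
    ∣ c ℤ.* a ∣     ≤⟨ p ⟩
    _               <⟨ M<c ⟩
    ∣ c ∣           ≡⟨ ℕₚ.*-identityʳ ∣ c ∣ ⟨
    ∣ c ∣ * 1       ∎)))

Short : ℕ → Vec ℤ n → Set
Short e = VAll.All (λ a → ∣ a ∣ < 2 ^ e)

short⇒bounded : ∀ e {x : Vec ℤ n} → Short e x → Bounded (2 ^ e) x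
short⇒bounded e = VAll.map ℕₚ.<⇒≤

bounded⇒short : ∀ e {x : Vec ℤ n} → M < 2 ^ e → Bounded M x → Short e x
bounded⇒short e M<2^e = VAll.map λ a≤M → ℕₚ.≤-<-trans a≤M M<2^e

short-0 : {x : Vec ℤ n} → Short 0 x → x ≡ 𝟘
short-0 []       = refl
short-0 (p ∷ ps) = cong₂ _∷_ (ℤₚ.∣i∣≡0⇒i≡0 (ℕₚ.n<1⇒n≡0 p)) (short-0 ps)

-- Spans

i*j≢0 : ∀ {i j} → i ≢ 0ℤ → j ≢ 0ℤ → i ℤ.* j ≢ 0ℤ
i*j≢0 {i} i≢0 j≢0 ij≡0 with ℤₚ.i*j≡0⇒i≡0∨j≡0 i ij≡0
... | inj₁ i≡0 = i≢0 i≡0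
... | inj₂ j≡0 = j≢0 j≡0

_∈⟨_⟩ : Vec ℤ n → Mat k n → Set
x ∈⟨ B ⟩ = ∃[ z ] x ≡ z ᵛ* B

_∈ℚ⟨_⟩ : Vec ℤ n → Mat k n → Set
x ∈ℚ⟨ B ⟩ = ∃[ c ] c ≢ 0ℤ × (c ⊙ x) ∈⟨ B ⟩

module _ {B : Mat k n} where

  ∈⟨⟩-⊖ : ∀ {x y} → x ∈⟨ B ⟩ → y ∈⟨ B ⟩ → (x ⊖ y) ∈⟨ B ⟩
  ∈⟨⟩-⊖ (z , refl) (w , refl) = z ⊖ w , sym (⊖-homo (ᵛ*-linear B) z w)

  ∈⟨⟩-∷ : ∀ {b x} → x ∈⟨ B ⟩ → x ∈⟨ b ∷ B ⟩
  ∈⟨⟩-∷ {b} (z , refl) = 0ℤ ∷ z , sym (trans (cong (_⊕ z ᵛ* B) (⊙-zeroˡ b)) (⊕-identityˡ (z ᵛ* B)))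

  ∈ℚ⟨⟩-∷ : ∀ {b x} → x ∈ℚ⟨ B ⟩ → x ∈ℚ⟨ b ∷ B ⟩
  ∈ℚ⟨⟩-∷ (c , c≢0 , cx∈) = c , c≢0 , ∈⟨⟩-∷ cx∈

  ∈ℚ⟨⟩-divide : ∀ {a x} → a ≢ 0ℤ → (a ⊙ x) ∈ℚ⟨ B ⟩ → x ∈ℚ⟨ B ⟩
  ∈ℚ⟨⟩-divide {a} {x} a≢0 (c , c≢0 , z , cax≡) = c ℤ.* a , i*j≢0 c≢0 a≢0 , z , trans (⊙-assoc c a x) cax≡

  ∈ℚ⟨⟩-⊙ : ∀ {x} a → x ∈ℚ⟨ B ⟩ → (a ⊙ x) ∈ℚ⟨ B ⟩
  ∈ℚ⟨⟩-⊙ {x} a (c , c≢0 , z , cx≡) = c , c≢0 , a ⊙ z , (begin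
    c ⊙ a ⊙ x        ≡⟨ ⊙-comm c a x ⟩
    a ⊙ c ⊙ x        ≡⟨ cong (a ⊙_) cx≡ ⟩
    a ⊙ z ᵛ* B       ≡⟨ ⊙-homo (ᵛ*-linear B) a z ⟨
    (a ⊙ z) ᵛ* B     ∎)
    where open ≡-Reasoning

  ∈ℚ⟨⟩-⊕ : ∀ {x y} → x ∈ℚ⟨ B ⟩ → y ∈ℚ⟨ B ⟩ → (x ⊕ y) ∈ℚ⟨ B ⟩
  ∈ℚ⟨⟩-⊕ {x} {y} (c , c≢0 , z , cx≡) (d , d≢0 , w , dy≡) = c ℤ.* d , i*j≢0 c≢0 d≢0 , d ⊙ z ⊕ c ⊙ w , (begin
    (c ℤ.* d) ⊙ (x ⊕ y)                 ≡⟨ ⊙-distribˡ-⊕ (c ℤ.* d) x y ⟩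
    (c ℤ.* d) ⊙ x ⊕ (c ℤ.* d) ⊙ y       ≡⟨ cong₂ _⊕_ (trans (⊙-assoc c d x) (⊙-comm c d x)) (⊙-assoc c d y) ⟩
    d ⊙ c ⊙ x ⊕ c ⊙ d ⊙ y               ≡⟨ cong₂ (λ u v → d ⊙ u ⊕ c ⊙ v) cx≡ dy≡ ⟩
    d ⊙ z ᵛ* B ⊕ c ⊙ w ᵛ* B             ≡⟨ cong₂ _⊕_ (⊙-homo (ᵛ*-linear B) d z) (⊙-homo (ᵛ*-linear B) c w) ⟨
    (d ⊙ z) ᵛ* B ⊕ (c ⊙ w) ᵛ* B         ≡⟨ ⊕-homo (ᵛ*-linear B) (d ⊙ z) (c ⊙ w) ⟨
    (d ⊙ z ⊕ c ⊙ w) ᵛ* B                ∎)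
    where open ≡-Reasoning

  ∈ℚ⟨⟩-ᵛ* : (z : Vec ℤ l) {C : Mat l n} → VAll.All (_∈ℚ⟨ B ⟩) C → (z ᵛ* C) ∈ℚ⟨ B ⟩
  ∈ℚ⟨⟩-ᵛ* []      []        = 1ℤ , (λ ()) , 𝟘 , trans (⊙-zeroʳ 1ℤ) (sym (𝟘-homo (ᵛ*-linear B)))
  ∈ℚ⟨⟩-ᵛ* (c ∷ z) (c∈ ∷ C∈) = ∈ℚ⟨⟩-⊕ (∈ℚ⟨⟩-⊙ c c∈) (∈ℚ⟨⟩-ᵛ* z C∈)

  ∈ℚ⟨⟩-⊖ : ∀ {x y} → x ∈ℚ⟨ B ⟩ → y ∈ℚ⟨ B ⟩ → (x ⊖ y) ∈ℚ⟨ B ⟩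
  ∈ℚ⟨⟩-⊖ {x} {y} x∈ y∈ = ∈ℚ⟨⟩-⊕ x∈ (subst (_∈ℚ⟨ B ⟩) (-1⊙x≡-x y) (∈ℚ⟨⟩-⊙ (- 1ℤ) y∈))

ker-ℚ-span : {f : Vec ℤ m → Vec ℤ n} → Linear f → {B : Mat k m} → VAll.All (λ b → f b ≡ 𝟘) B →
  ∀ {x} → x ∈ℚ⟨ B ⟩ → f x ≡ 𝟘
ker-ℚ-span {f = f} F fB (c , c≢0 , z , cx≡) = ker-saturated F c≢0 (trans (cong f cx≡) (ker-ᵛ* F z fB))

head∈ℚ⟨⟩ : (b : Vec ℤ n) (B : Mat k n) → b ∈ℚ⟨ b ∷ B ⟩
head∈ℚ⟨⟩ b B = 1ℤ , (λ ()) , e₁ , sym (trans (cong (1ℤ ⊙ b ⊕_) (𝟘-homo (ᵛ*-linear B))) (⊕-identityʳ (1ℤ ⊙ b)))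

-- Lattices

-- A primitive sublattice of ℤⁿ of rank t: the integral solutions of a system of linear equations,
-- with coordinates that identify it with ℤᵗ.
record Lattice (n t : ℕ) : Set where
  field
    {codim}           : ℕ
    equations         : Vec ℤ n → Vec ℤ codim
    equations-linear  : Linear equations
    coords            : Vec ℤ n → Vec ℤ t
    coords-linear     : Linear coords
    coords-surjective : ∀ w → ∃[ x ] equations x ≡ 𝟘 × coords x ≡ w
    coords-injective  : ∀ {x} → equations x ≡ 𝟘 → coords x ≡ 𝟘 → x ≡ 𝟘

open Lattice

_∈ᴸ_ : Vec ℤ n → Lattice n t → Set
x ∈ᴸ L = equations L x ≡ 𝟘

full-lattice : Lattice n n
full-lattice = record
  { equations         = const []
  ; equations-linear  = []-linear
  ; coords            = id
  ; coords-linear     = id-linear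
  ; coords-surjective = λ w → w , refl , refl
  ; coords-injective  = λ _ x≡𝟘 → x≡𝟘
  }

zero-lattice : Lattice n 0
zero-lattice = record
  { equations         = id
  ; equations-linear  = id-linear
  ; coords            = const []
  ; coords-linear     = []-linear
  ; coords-surjective = λ { [] → 𝟘 , refl , refl }
  ; coords-injective  = λ x≡𝟘 _ → x≡𝟘
  }

module _ (u : Unimodular (suc n)) (L : Lattice n t) where

  cylinder : Lattice (suc n) (suc t)
  cylinder = record
    { equations         = equations L ∘ tail ∘ ⟦ u ⟧
    ; equations-linear  = ∘-linear (equations-linear L) (∘-linear tail-linear (⟦⟧-linear u))
    ; coords            = onTail (coords L) ∘ ⟦ u ⟧
    ; coords-linear     = ∘-linear (onTail-linear (coords-linear L)) (⟦⟧-linear u)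
    ; coords-surjective = λ { (a ∷ w) →
        let x , x∈ , cx≡w = coords-surjective L w
            uu⁻¹≡ = ⁻¹-inverseʳ u (a ∷ x)
        in ⟦ u ⁻¹ ⟧ (a ∷ x) , trans (cong (equations L ∘ tail) uu⁻¹≡) x∈
         , trans (cong (onTail (coords L)) uu⁻¹≡) (cong (a ∷_) cx≡w) }
    ; coords-injective  = λ {x} x∈ cx≡𝟘 → ⟦⟧≡𝟘⇒≡𝟘 u (trans (head∷tail (⟦ u ⟧ x))
        (cong₂ _∷_ (cong head cx≡𝟘) (coords-injective L x∈ (cong tail cx≡𝟘))))
    }

  slice : Lattice (suc n) t
  slice = record
    { equations         = onTail (equations L) ∘ ⟦ u ⟧
    ; equations-linear  = ∘-linear (onTail-linear (equations-linear L)) (⟦⟧-linear u)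
    ; coords            = coords L ∘ tail ∘ ⟦ u ⟧
    ; coords-linear     = ∘-linear (coords-linear L) (∘-linear tail-linear (⟦⟧-linear u))
    ; coords-surjective = λ w →
        let x , x∈ , cx≡w = coords-surjective L w
            uu⁻¹≡ = ⁻¹-inverseʳ u (0ℤ ∷ x)
        in ⟦ u ⁻¹ ⟧ (0ℤ ∷ x) , trans (cong (onTail (equations L)) uu⁻¹≡) (cong (0ℤ ∷_) x∈)
         , trans (cong (coords L ∘ tail) uu⁻¹≡) cx≡w
    ; coords-injective  = λ {x} x∈ cx≡𝟘 → ⟦⟧≡𝟘⇒≡𝟘 u (trans (head∷tail (⟦ u ⟧ x))
        (cong₂ _∷_ (cong head x∈) (coords-injective L (cong tail x∈) cx≡𝟘)))
    }

-- Successive minima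

data Separated {n} : Mat k n → Vec ℕ k → Set where
  []     : Separated [] []
  extend : ∀ {c} {C : Mat k n} {e es} → (∀ a z → Short e (a ⊙ c ⊕ z ᵛ* C) → a ≡ 0ℤ) → VAll.All (_≤ e) es →
    Separated C es → Separated (c ∷ C) (e ∷ es)

record Quotient (L : Lattice n t) (C : Mat k n) (s : ℕ) : Set where
  field
    π            : Vec ℤ n → Vec ℤ s
    π-linear     : Linear π
    π-surjective : ∀ w → ∃[ x ] x ∈ᴸ L × π x ≡ w
    basis∈ᴸ      : VAll.All (_∈ᴸ L) C
    π-basis      : VAll.All (λ c → π c ≡ 𝟘) C
    ker⇒span     : ∀ {x} → x ∈ᴸ L → π x ≡ 𝟘 → x ∈⟨ C ⟩

  span⇒∈ᴸ : ∀ {x} → x ∈⟨ C ⟩ → x ∈ᴸ L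
  span⇒∈ᴸ (z , refl) = ker-ᵛ* (equations-linear L) z basis∈ᴸ

  span⇒ker : ∀ {x} → x ∈⟨ C ⟩ → π x ≡ 𝟘
  span⇒ker (z , refl) = ker-ᵛ* π-linear z π-basis

open Quotient

quotient-[] : (L : Lattice n t) → Quotient L [] t
quotient-[] L = record
  { π            = coords L
  ; π-linear     = coords-linear L
  ; π-surjective = coords-surjective L
  ; basis∈ᴸ      = []
  ; π-basis      = []
  ; ker⇒span     = λ x∈ πx≡𝟘 → [] , coords-injective L x∈ πx≡𝟘
  }

module _ {L : Lattice n t} {C : Mat k n} (Q : Quotient L C (suc s)) (u : Unimodular (suc s))
  {c : Vec ℤ n} (c∈ : c ∈ᴸ L) (uπc≡e₁ : ⟦ u ⟧ (π Q c) ≡ e₁) where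

  private
    uπ : Vec ℤ n → Vec ℤ (suc s)
    uπ = ⟦ u ⟧ ∘ π Q

    uπ-linear : Linear uπ
    uπ-linear = ∘-linear (⟦⟧-linear u) (π-linear Q)

  difference∈span : ∀ {a x} → x ∈ᴸ L → uπ x ≡ a ∷ 𝟘 → (x ⊖ a ⊙ c) ∈⟨ C ⟩
  difference∈span {a} {x} x∈ uπx≡ = ker⇒span Q
    (ker-⊖ (equations-linear L) (trans x∈ (sym (ker-⊙ (equations-linear L) a c∈))))
    (⟦⟧≡𝟘⇒≡𝟘 u (ker-⊖ uπ-linear (begin
      uπ x            ≡⟨ uπx≡ ⟩
      a ∷ 𝟘           ≡⟨ c⊙e₁≡c∷𝟘 a ⟨
      a ⊙ e₁          ≡⟨ cong (a ⊙_) uπc≡e₁ ⟨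
      a ⊙ uπ c        ≡⟨ ⊙-homo uπ-linear a c ⟨
      uπ (a ⊙ c)      ∎)))
    where open ≡-Reasoning

  quotient-∷ : Quotient L (c ∷ C) s
  quotient-∷ = record
    { π            = tail ∘ uπ
    ; π-linear     = ∘-linear tail-linear uπ-linear
    ; π-surjective = λ w →
        let x , x∈ , πx≡ = π-surjective Q (⟦ u ⁻¹ ⟧ (0ℤ ∷ w))
        in x , x∈ , cong tail (trans (cong ⟦ u ⟧ πx≡) (⁻¹-inverseʳ u (0ℤ ∷ w)))
    ; basis∈ᴸ      = c∈ ∷ basis∈ᴸ Q
    ; π-basis      = cong tail uπc≡e₁
        ∷ VAll.map (λ πb≡𝟘 → cong tail (trans (cong ⟦ u ⟧ πb≡𝟘) (𝟘-homo (⟦⟧-linear u)))) (π-basis Q)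
    ; ker⇒span     = λ {x} x∈ tail≡𝟘 →
        let a       = head (uπ x)
            z , eq  = difference∈span x∈ (trans (head∷tail (uπ x)) (cong (a ∷_) tail≡𝟘))
        in a ∷ z , (begin
          x                            ≡⟨ y⊖x⊕x≡y (a ⊙ c) x ⟨
          (x ⊖ a ⊙ c) ⊕ a ⊙ c          ≡⟨ cong (_⊕ a ⊙ c) eq ⟩
          z ᵛ* C ⊕ a ⊙ c               ≡⟨ ⊕-comm (z ᵛ* C) (a ⊙ c) ⟩
          a ⊙ c ⊕ z ᵛ* C               ∎)
    }
    where open ≡-Reasoning

record Extension {L : Lattice n t} {C : Mat k n} (Q : Quotient L C (suc s)) (x : Vec ℤ n) : Set where
  field
    generator    : Vec ℤ n
    index        : ℤ
    πgenerator≢𝟘 : π Q generator ≢ 𝟘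
    index≢0      : index ≢ 0ℤ
    remainder∈   : (x ⊖ index ⊙ generator) ∈⟨ C ⟩
    quotient     : Quotient L (generator ∷ C) s
    x∈span       : x ∈⟨ generator ∷ C ⟩

extend-quotient : {L : Lattice n t} {C : Mat k n} (Q : Quotient L C (suc s)) → ∀ {x} → x ∈ᴸ L → π Q x ≢ 𝟘 →
  Extension Q x
extend-quotient Q {x} x∈ πx≢𝟘 =
  let u , g , uπx≡  = reduce (π Q x)
      c , c∈ , πc≡  = π-surjective Q (⟦ u ⁻¹ ⟧ e₁)
      uπc≡e₁        = trans (cong ⟦ u ⟧ πc≡) (⁻¹-inverseʳ u e₁)
  in record
    { generator    = c
    ; index        = g
    ; πgenerator≢𝟘 = λ πc≡𝟘 → e₁≢𝟘 (trans (sym uπc≡e₁) (trans (cong ⟦ u ⟧ πc≡𝟘) (𝟘-homo (⟦⟧-linear u))))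
    ; index≢0      = λ g≡0 → πx≢𝟘 (⟦⟧≡𝟘⇒≡𝟘 u (trans uπx≡ (cong (_∷ 𝟘) g≡0)))
    ; remainder∈   = difference∈span Q u c∈ uπc≡e₁ x∈ uπx≡
    ; quotient     = quotient-∷ Q u c∈ uπc≡e₁
    ; x∈span       = ker⇒span (quotient-∷ Q u c∈ uπc≡e₁) x∈ (cong tail uπx≡)
    }

record AdaptedBasis (xs : Mat k n) (es : Vec ℕ k) : Set where
  field
    basis       : Mat k n
    separated   : Separated basis es
    span⇒ℚ-span : ∀ {x} → x ∈⟨ basis ⟩ → x ∈ℚ⟨ xs ⟩
    ℚ-span⇒span : ∀ {x} → x ∈ℚ⟨ xs ⟩ → x ∈⟨ basis ⟩

-- To within powers of 2, the vectors in `minima` are the successive minima of L that are shorter than 2^e.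
record SuccessiveMinima (L : Lattice n t) (e k s : ℕ) : Set where
  field
    k+s≡t          : k + s ≡ t
    minima basis   : Mat k n
    levels         : Vec ℕ k
    levels≤        : VAll.All (_≤ e) levels
    minima-bounded : Pointwise (λ x f → Bounded (2 ^ suc f) x) minima levels
    separated      : Separated basis levels
    quotient       : Quotient L basis s
    minima∈span    : VAll.All (_∈⟨ basis ⟩) minima
    basis∈ℚ-span   : VAll.All (_∈ℚ⟨ minima ⟩) basis
    short⇒span     : ∀ {x} → x ∈ᴸ L → Short e x → x ∈⟨ basis ⟩

  k≤t : k ≤ t
  k≤t = subst (k ≤_) k+s≡t (ℕₚ.m≤m+n k s)

  minima∈ᴸ : VAll.All (_∈ᴸ L) minima
  minima∈ᴸ = VAll.map (span⇒∈ᴸ quotient) minima∈span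

  exhaustive : t ≤ k → ∀ {x} → x ∈ᴸ L → x ∈⟨ basis ⟩
  exhaustive t≤k x∈ = ker⇒span quotient x∈ (Vec₀-irrelevant (ℕₚ.n≤0⇒n≡0 (ℕₚ.+-cancelˡ-≤ k s 0 (begin
    k + s   ≡⟨ k+s≡t ⟩
    t       ≤⟨ t≤k ⟩
    k       ≡⟨ ℕₚ.+-identityʳ k ⟨
    k + 0   ∎))))
    where open ℕₚ.≤-Reasoning

  adapted : AdaptedBasis minima levels
  adapted = record
    { basis       = basis
    ; separated   = separated
    ; span⇒ℚ-span = λ { (z , refl) → ∈ℚ⟨⟩-ᵛ* z basis∈ℚ-span }
    ; ℚ-span⇒span = λ x∈ → ker⇒span quotient
        (ker-ℚ-span (equations-linear L) minima∈ᴸ x∈)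
        (ker-ℚ-span (π-linear quotient) (VAll.map (span⇒ker quotient) minima∈span) x∈)
    }

module _ {L : Lattice n t} where

  no-minima : SuccessiveMinima L 0 0 t
  no-minima = record
    { k+s≡t          = refl
    ; minima         = []
    ; basis          = []
    ; levels         = []
    ; levels≤        = []
    ; minima-bounded = []
    ; separated      = []
    ; quotient       = quotient-[] L
    ; minima∈span    = []
    ; basis∈ℚ-span   = []
    ; short⇒span     = λ _ x-short → [] , short-0 x-short
    }

  raise-level : ∀ {e} (S : SuccessiveMinima L e k s) (let open SuccessiveMinima S) →
    (∀ {x} → x ∈ᴸ L → Short (suc e) x → x ∈⟨ basis ⟩) → SuccessiveMinima L (suc e) k s
  raise-level S short = record
    { k+s≡t          = k+s≡t
    ; minima         = minima
    ; basis          = basis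
    ; levels         = levels
    ; levels≤        = VAll.map ℕₚ.m≤n⇒m≤1+n levels≤
    ; minima-bounded = minima-bounded
    ; separated      = separated
    ; quotient       = quotient
    ; minima∈span    = minima∈span
    ; basis∈ℚ-span   = basis∈ℚ-span
    ; short⇒span     = short
    }
    where open SuccessiveMinima S

  add-minimum : ∀ {e} (S : SuccessiveMinima L e k (suc s)) (let open SuccessiveMinima S) →
    ∀ {x} → x ∈ᴸ L → Short (suc e) x → π quotient x ≢ 𝟘 → SuccessiveMinima L e (suc k) s
  add-minimum {k = k} {s} {e} S {x} x∈ x-short πx≢𝟘 = record
    { k+s≡t          = trans (sym (ℕₚ.+-suc k s)) k+s≡t
    ; minima         = x ∷ minima
    ; basis          = c ∷ basis
    ; levels         = e ∷ levels
    ; levels≤        = ℕₚ.≤-refl ∷ levels≤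
    ; minima-bounded = short⇒bounded (suc e) x-short ∷ minima-bounded
    ; separated      = extend c-separated levels≤ separated
    ; quotient       = E.quotient
    ; minima∈span    = E.x∈span ∷ VAll.map ∈⟨⟩-∷ minima∈span
    ; basis∈ℚ-span   = c∈ℚ ∷ VAll.map ∈ℚ⟨⟩-∷ basis∈ℚ-span
    ; short⇒span     = λ y∈ y-short → ∈⟨⟩-∷ (short⇒span y∈ y-short)
    }
    where
    open SuccessiveMinima S
    module E = Extension (extend-quotient quotient x∈ πx≢𝟘)
    c = E.generator
    g = E.index
    open ≡-Reasoning
    c∈ℚ : c ∈ℚ⟨ x ∷ minima ⟩
    c∈ℚ = ∈ℚ⟨⟩-divide E.index≢0 (subst (_∈ℚ⟨ x ∷ minima ⟩) (x⊖[x⊖y]≡y x (g ⊙ c))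
      (∈ℚ⟨⟩-⊖ (head∈ℚ⟨⟩ x minima) (∈ℚ⟨⟩-∷ (AdaptedBasis.span⇒ℚ-span adapted E.remainder∈))))
    c-separated : ∀ a z → Short e (a ⊙ c ⊕ z ᵛ* basis) → a ≡ 0ℤ
    c-separated a z y-short = c⊙x≡𝟘⇒c≡0 E.πgenerator≢𝟘 (begin
      a ⊙ π quotient c                                  ≡⟨ ⊙-homo (π-linear quotient) a c ⟨
      π quotient (a ⊙ c)                                ≡⟨ ⊕-identityʳ (π quotient (a ⊙ c)) ⟨
      π quotient (a ⊙ c) ⊕ 𝟘                            ≡⟨ cong (π quotient (a ⊙ c) ⊕_) (span⇒ker quotient (z , refl)) ⟨
      π quotient (a ⊙ c) ⊕ π quotient (z ᵛ* basis)      ≡⟨ ⊕-homo (π-linear quotient) (a ⊙ c) (z ᵛ* basis) ⟨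
      π quotient (a ⊙ c ⊕ z ᵛ* basis)                   ≡⟨ span⇒ker quotient (short⇒span y∈ y-short) ⟩
      𝟘                                                 ∎)
      where
      y∈ : (a ⊙ c ⊕ z ᵛ* basis) ∈ᴸ L
      y∈ = span⇒∈ᴸ E.quotient (a ∷ z , refl)

  find-minimum : ∀ {e} (S : SuccessiveMinima L e k s) (let open SuccessiveMinima S) →
    (∃[ x ] x ∈ᴸ L × Short (suc e) x × π quotient x ≢ 𝟘) ⊎
    (∀ {x} → x ∈ᴸ L → Short (suc e) x → x ∈⟨ basis ⟩)
  find-minimum {e = e} S with Any.any? candidate? (box n (2 ^ suc e))
    where
    open SuccessiveMinima S
    candidate? : ∀ x → Dec (x ∈ᴸ L × Short (suc e) x × π quotient x ≢ 𝟘)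
    candidate? x = (equations L x ≟ᵛ 𝟘) ×-dec VAll.all? (λ a → ∣ a ∣ ℕₚ.<? 2 ^ suc e) x ×-dec ¬? (π quotient x ≟ᵛ 𝟘)
  ... | yes found = let x , _ , candidate = find found in inj₁ (x , candidate)
  ... | no none   = inj₂ λ {x} x∈ x-short → ker⇒span quotient x∈ (decidable-stable (π quotient x ≟ᵛ 𝟘)
    λ πx≢𝟘 → none (lose (∈-box⁺ (short⇒bounded (suc e) x-short)) (x∈ , x-short , πx≢𝟘)))
    where open SuccessiveMinima S

  next-level : ∀ {e} → SuccessiveMinima L e k s → ∃[ k′ ] ∃[ s′ ] SuccessiveMinima L (suc e) k′ s′
  next-level {s = zero}  S = _ , _ , raise-level S λ {x} x∈ _ → ker⇒span quotient x∈ (Vec₀-irrelevant refl)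
    where open SuccessiveMinima S
  next-level {s = suc s} S with find-minimum S
  ... | inj₁ (_ , x∈ , x-short , πx≢𝟘) = next-level (add-minimum S x∈ x-short πx≢𝟘)
  ... | inj₂ exhausted                 = _ , _ , raise-level S exhausted

  successive-minima : ∀ e → ∃[ k ] ∃[ s ] SuccessiveMinima L e k s
  successive-minima zero    = 0 , _ , no-minima
  successive-minima (suc e) = let _ , _ , S = successive-minima e in next-level S

-- Counting points by their residues

scaleBy : Vec ℕ k → Vec ℤ k → Vec ℤ k
scaleBy = zipWith (λ q a → + q ℤ.* a)

scaleBy-⊖ : ∀ (qs : Vec ℕ k) x y → scaleBy qs x ⊖ scaleBy qs y ≡ scaleBy qs (x ⊖ y)
scaleBy-⊖ []       []      []      = refl
scaleBy-⊖ (q ∷ qs) (a ∷ x) (b ∷ y) = cong₂ _∷_ (eq (+ q) a b) (scaleBy-⊖ qs x y)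
  where
  eq : ∀ q a b → q ℤ.* a ℤ.- q ℤ.* b ≡ q ℤ.* (a ℤ.- b)
  eq = solve-∀

residuesMod : ℕ → List ℤ
residuesMod q = List.map +_ (List.upTo q)

residues : Vec ℕ k → List (Vec ℤ k)
residues = choices ∘ Vec.map residuesMod

length-residues : (qs : Vec ℕ k) → length (residues qs) ≡ ∏ qs
length-residues qs = trans (length-choices (Vec.map residuesMod qs)) (cong ∏ (begin
  Vec.map length (Vec.map residuesMod qs)  ≡⟨ Vecₚ.map-∘ length residuesMod qs ⟨
  Vec.map (length ∘ residuesMod) qs        ≡⟨ Vecₚ.map-cong length-residuesMod qs ⟩
  Vec.map id qs                            ≡⟨ Vecₚ.map-id qs ⟩
  qs                                       ∎))
  where
  open ≡-Reasoning
  length-residuesMod : ∀ q → length (residuesMod q) ≡ q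
  length-residuesMod q = trans (Listₚ.length-map +_ (List.upTo q)) (Listₚ.length-upTo q)

∃-residue : {qs : Vec ℕ k} → VAll.All (0 <_) qs → ∀ z → ∃[ ρ ] ρ ∈ residues qs × ∃[ w ] z ≡ scaleBy qs w ⊕ ρ
∃-residue qs>0 z = let ρ , w , ρ∈ , z≡ = divide qs>0 z in ρ , ∈-choices ρ∈ , w , z≡
  where
  divide : {qs : Vec ℕ k} → VAll.All (0 <_) qs → ∀ z →
    ∃[ ρ ] ∃[ w ] Pointwise _∈_ ρ (Vec.map residuesMod qs) × z ≡ scaleBy qs w ⊕ ρ
  divide {qs = []}        []         []      = [] , [] , [] , refl
  divide {qs = suc q ∷ _} (_ ∷ qs>0) (a ∷ z) =
    let ρ , w , ρ∈ , z≡ = divide qs>0 z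
    in + (a ℤ/.%ℕ suc q) ∷ ρ , a ℤ/./ℕ suc q ∷ w , ∈ₚ.∈-map⁺ +_ (∈ₚ.∈-upTo⁺ (ℤ/.n%ℕd<d a (suc q))) ∷ ρ∈
     , cong₂ _∷_ (trans (ℤ/.a≡a%ℕn+[a/ℕn]*n a (suc q)) (eq (+ (a ℤ/.%ℕ suc q)) (a ℤ/./ℕ suc q) (+ suc q))) z≡
    where
    eq : ∀ r d q → r ℤ.+ d ℤ.* q ≡ q ℤ.* d ℤ.+ r
    eq = solve-∀

atmost-residues : {P : X → Set} {qs : Vec ℕ k} → VAll.All (0 <_) qs →
  (Coords : X → Vec ℤ k → Set) → (∀ {x} → P x → ∃ (Coords x)) →
  (∀ {x y u v} → P x → P y → Coords x u → Coords y v → ∃[ w ] u ⊖ v ≡ scaleBy qs w → x ≡ y) →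
  Atmost P (∏ qs)
atmost-residues {P = P} {qs} qs>0 Coords coords congruent⇒≡ = atmost-≤
  (ℕₚ.≤-reflexive (trans (ℕₚ.*-identityʳ (length (residues qs))) (length-residues qs)))
  (atmost-cover HasResidue (residues qs) ∃-residue-of fibre)
  where
  HasResidue : _ → Vec ℤ _ → Set
  HasResidue x ρ = ∃[ u ] ∃[ w ] Coords x u × u ≡ scaleBy qs w ⊕ ρ
  ∃-residue-of : ∀ {x} → P x → Any (HasResidue x) (residues qs)
  ∃-residue-of p = let u , xu = coords p ; ρ , ρ∈ , w , u≡ = ∃-residue qs>0 u in lose ρ∈ (u , w , xu , u≡)
  fibre : ∀ ρ → Atmost (λ x → P x × HasResidue x ρ) 1
  fibre ρ = atmost-1 λ { x y (p , _ , w , xu , refl) (p′ , _ , w′ , yv , refl) →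
    congruent⇒≡ p p′ xu yv (w ⊖ w′ ,
      trans ([x⊕z]⊖[y⊕z]≡x⊖y (scaleBy qs w) (scaleBy qs w′) ρ) (scaleBy-⊖ qs w w′)) }

∏-replicate : ∀ k q → ∏ (replicate k q) ≡ q ^ k
∏-replicate zero    q = refl
∏-replicate (suc k) q = cong (q *_) (∏-replicate k q)

-- Two points that are congruent modulo 2H + 1 in the coordinates of L differ by a multiple of 2H + 1, but by at
-- most 2H in each entry.
atmost-lattice-coset : {P : Vec ℤ n → Set} (L : Lattice n t) (H : ℕ) →
  (∀ {x} → P x → Bounded H x) → (∀ {x y} → P x → P y → (x ⊖ y) ∈ᴸ L) → Atmost P (suc (2 * H) ^ t)
atmost-lattice-coset {t = t} L H bounded difference∈ = subst (Atmost _) (∏-replicate t q)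
  (atmost-residues (VAllₚ.lookup⁻ λ i → subst (0 <_) (sym (Vecₚ.lookup-replicate i q)) (s≤s z≤n))
    (λ x u → coords L x ≡ u) (λ _ → _ , refl)
    λ { {x} {y} p p′ refl refl (w , cx⊖cy≡) →
      let v , v∈ , cv≡w = coords-surjective L w
          x⊖y≡qv = x⊖y≡𝟘⇒x≡y (x ⊖ y) (+ q ⊙ v) (coords-injective L
            (ker-⊖ (equations-linear L) (trans (difference∈ p p′) (sym (ker-⊙ (equations-linear L) (+ q) v∈))))
            (ker-⊖ (coords-linear L) (begin
              coords L (x ⊖ y)               ≡⟨ ⊖-homo (coords-linear L) x y ⟩
              coords L x ⊖ coords L y        ≡⟨ cx⊖cy≡ ⟩
              scaleBy (replicate t q) w      ≡⟨ Vecₚ.zipWith-replicate₁ (λ q a → + q ℤ.* a) q w ⟩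
              + q ⊙ w                        ≡⟨ cong (+ q ⊙_) cv≡w ⟨
              + q ⊙ coords L v               ≡⟨ ⊙-homo (coords-linear L) (+ q) v ⟨
              coords L (+ q ⊙ v)             ∎)))
          v≡𝟘 = short-multiple {c = + q} (s≤s (ℕₚ.≤-reflexive (cong (λ t → H + t) (sym (ℕₚ.+-identityʳ H)))))
            (subst (Bounded (H + H)) x⊖y≡qv (bounded-⊖ (bounded p) (bounded p′)))
      in x⊖y≡𝟘⇒x≡y x y (trans x⊖y≡qv (trans (cong (+ q ⊙_) v≡𝟘) (⊙-zeroʳ (+ q)))) })
  where
  open ≡-Reasoning
  q = suc (2 * H)

indices : ℕ → Vec ℕ k → Vec ℕ k
indices h = Vec.map (λ e → 2 ^ (h ∸ e))

indices>0 : ∀ h (es : Vec ℕ k) → VAll.All (0 <_) (indices h es)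
indices>0 h es = VAllₚ.map⁺ (VAllₚ.lookup⁻ λ i → ℕₚ.m^n>0 2 (h ∸ Vec.lookup es i))

module _ {h e : ℕ} (e≤h : e ≤ h) where

  short-divide : (x : Vec ℤ n) → Short h (+ (2 ^ (h ∸ e)) ⊙ x) → Short e x
  short-divide x = VAll.map (λ {a} → entry< a) ∘ VAllₚ.map⁻
    where
    open ℕₚ.≤-Reasoning
    entry< : ∀ a → ∣ + (2 ^ (h ∸ e)) ℤ.* a ∣ < 2 ^ h → ∣ a ∣ < 2 ^ e
    entry< a qa<2^h = ℕₚ.*-cancelˡ-< (2 ^ (h ∸ e)) ∣ a ∣ (2 ^ e) (begin-strict
      2 ^ (h ∸ e) * ∣ a ∣            ≡⟨ ℤₚ.∣i*j∣≡∣i∣*∣j∣ (+ (2 ^ (h ∸ e))) a ⟨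
      ∣ + (2 ^ (h ∸ e)) ℤ.* a ∣      <⟨ qa<2^h ⟩
      2 ^ h                          ≡⟨ cong (2 ^_) (ℕₚ.m∸n+n≡m e≤h) ⟨
      2 ^ (h ∸ e + e)                ≡⟨ ℕₚ.^-distribˡ-+-* 2 (h ∸ e) e ⟩
      2 ^ (h ∸ e) * 2 ^ e            ∎)

  scaleBy-indices-divisible : ∀ {es : Vec ℕ k} → VAll.All (_≤ e) es → ∀ w →
    ∃[ v ] scaleBy (indices h es) w ≡ + (2 ^ (h ∸ e)) ⊙ v
  scaleBy-indices-divisible                 []           []      = [] , refl
  scaleBy-indices-divisible {es = f ∷ _} (f≤e ∷ es≤e) (a ∷ w) =
    let v , eq = scaleBy-indices-divisible es≤e w
    in + (2 ^ (e ∸ f)) ℤ.* a ∷ v , cong₂ _∷_ (begin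
      + (2 ^ (h ∸ f)) ℤ.* a                          ≡⟨ cong (λ t → + (2 ^ t) ℤ.* a) h∸f≡ ⟩
      + (2 ^ (h ∸ e + (e ∸ f))) ℤ.* a                ≡⟨ cong (λ t → + t ℤ.* a) (ℕₚ.^-distribˡ-+-* 2 (h ∸ e) (e ∸ f)) ⟩
      + (2 ^ (h ∸ e) * 2 ^ (e ∸ f)) ℤ.* a            ≡⟨ cong (ℤ._* a) (ℤₚ.pos-* (2 ^ (h ∸ e)) (2 ^ (e ∸ f))) ⟩
      + (2 ^ (h ∸ e)) ℤ.* + (2 ^ (e ∸ f)) ℤ.* a      ≡⟨ ℤₚ.*-assoc (+ (2 ^ (h ∸ e))) (+ (2 ^ (e ∸ f))) a ⟩
      + (2 ^ (h ∸ e)) ℤ.* (+ (2 ^ (e ∸ f)) ℤ.* a)    ∎) eq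
    where
    open ≡-Reasoning
    h∸f≡ : h ∸ f ≡ h ∸ e + (e ∸ f)
    h∸f≡ = trans (cong (_∸ f) (sym (ℕₚ.m∸n+n≡m e≤h))) (ℕₚ.+-∸-assoc (h ∸ e) f≤e)

separated⇒𝟘 : ∀ {h} {C : Mat k n} {es} → Separated C es → VAll.All (_≤ h) es → ∀ w →
  Short h (scaleBy (indices h es) w ᵛ* C) → scaleBy (indices h es) w ᵛ* C ≡ 𝟘
separated⇒𝟘 []  _ [] _ = refl
separated⇒𝟘 {h = h} (extend {c = c} {C} {e} {es} c-separated es≤e C-separated) (e≤h ∷ es≤h) (a ∷ w) short =
  trans drop-c (separated⇒𝟘 C-separated es≤h w (subst (Short h) drop-c short))
  where
  open ≡-Reasoning
  q = + (2 ^ (h ∸ e))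
  y = scaleBy (indices h es) w ᵛ* C
  divided = scaleBy-indices-divisible e≤h es≤e w
  v = proj₁ divided
  factor : (q ℤ.* a) ⊙ c ⊕ y ≡ q ⊙ (a ⊙ c ⊕ v ᵛ* C)
  factor = begin
    (q ℤ.* a) ⊙ c ⊕ y              ≡⟨ cong₂ _⊕_ (⊙-assoc q a c) (cong (_ᵛ* C) (proj₂ divided)) ⟩
    q ⊙ a ⊙ c ⊕ (q ⊙ v) ᵛ* C       ≡⟨ cong (q ⊙ a ⊙ c ⊕_) (⊙-homo (ᵛ*-linear C) q v) ⟩
    q ⊙ a ⊙ c ⊕ q ⊙ v ᵛ* C         ≡⟨ ⊙-distribˡ-⊕ q (a ⊙ c) (v ᵛ* C) ⟨
    q ⊙ (a ⊙ c ⊕ v ᵛ* C)           ∎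
  a≡0 : a ≡ 0ℤ
  a≡0 = c-separated a v (short-divide e≤h _ (subst (Short h) factor short))
  drop-c : (q ℤ.* a) ⊙ c ⊕ y ≡ y
  drop-c = begin
    (q ℤ.* a) ⊙ c ⊕ y      ≡⟨ cong (λ t → (q ℤ.* t) ⊙ c ⊕ y) a≡0 ⟩
    (q ℤ.* 0ℤ) ⊙ c ⊕ y     ≡⟨ cong (λ t → t ⊙ c ⊕ y) (ℤₚ.*-zeroʳ q) ⟩
    0ℤ ⊙ c ⊕ y             ≡⟨ cong (_⊕ y) (⊙-zeroˡ c) ⟩
    𝟘 ⊕ y                  ≡⟨ ⊕-identityˡ y ⟩
    y                      ∎

atmost-separated-coset : ∀ {h} {C : Mat k n} {es} {P : Vec ℤ n → Set} → Separated C es → VAll.All (_≤ h) es →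
  (∀ {x y} → P x → P y → Short h (x ⊖ y) × (x ⊖ y) ∈⟨ C ⟩) → Atmost P (∏ (indices h es))
atmost-separated-coset {h = h} {C} {es} separated es≤h difference = atmost-inhabited λ x₀ p₀ →
  atmost-residues (indices>0 h es) (λ x u → x ⊖ x₀ ≡ u ᵛ* C) (λ p → proj₂ (difference p p₀))
    λ { {x} {y} {u} {v} p p′ x⊖x₀≡ y⊖x₀≡ (w , u⊖v≡) →
      let x⊖y≡ : x ⊖ y ≡ scaleBy (indices h es) w ᵛ* C
          x⊖y≡ = begin
            x ⊖ y                                ≡⟨ [x⊕z]⊖[y⊕z]≡x⊖y x y (Vec.map -_ x₀) ⟨
            (x ⊖ x₀) ⊖ (y ⊖ x₀)                  ≡⟨ cong₂ _⊖_ x⊖x₀≡ y⊖x₀≡ ⟩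
            u ᵛ* C ⊖ v ᵛ* C                      ≡⟨ ⊖-homo (ᵛ*-linear C) u v ⟨
            (u ⊖ v) ᵛ* C                         ≡⟨ cong (_ᵛ* C) u⊖v≡ ⟩
            scaleBy (indices h es) w ᵛ* C        ∎
          short = subst (Short h) x⊖y≡ (proj₁ (difference p p′))
      in x⊖y≡𝟘⇒x≡y x y (trans x⊖y≡ (separated⇒𝟘 separated es≤h w short)) }
  where open ≡-Reasoning

-- Rank and nullity

record RankDecomposition (A : Mat m n) : Set where
  field
    rank nullity   : ℕ
    rank+nullity≡n : rank + nullity ≡ n
    row-lattice    : Lattice n rank
    rows∈          : VAll.All (_∈ᴸ row-lattice) A
    kernel-lattice : Lattice n nullity
    kernel∈        : ∀ {x} → A *ᵛ x ≡ 𝟘 → x ∈ᴸ kernel-lattice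

·-head-tail : (x y : Vec ℤ (suc n)) → x · y ≡ head x ℤ.* head y ℤ.+ tail x · tail y
·-head-tail (_ ∷ _) (_ ∷ _) = refl

·-transform : (u : Unimodular (suc n)) → ∀ x y →
  x · y ≡ head (⟦ u ⟧ x) ℤ.* head (⟦ u ⁻ᵀ ⟧ y) ℤ.+ tail (⟦ u ⟧ x) · tail (⟦ u ⁻ᵀ ⟧ y)
·-transform u x y = trans (sym (⟦⟧-⁻ᵀ-· u x y)) (·-head-tail (⟦ u ⟧ x) (⟦ u ⁻ᵀ ⟧ y))

·-pivot : (u : Unimodular (suc n)) → ∀ {a g} → ⟦ u ⟧ a ≡ g ∷ 𝟘 → ∀ x → a · x ≡ g ℤ.* head (⟦ u ⁻ᵀ ⟧ x)
·-pivot u {a} {g} ua≡ x = begin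
  a · x                                                    ≡⟨ ·-transform u a x ⟩
  head (⟦ u ⟧ a) ℤ.* head y ℤ.+ tail (⟦ u ⟧ a) · tail y    ≡⟨ cong (λ v → head v ℤ.* head y ℤ.+ tail v · tail y) ua≡ ⟩
  g ℤ.* head y ℤ.+ 𝟘 · tail y                              ≡⟨ cong (λ t → g ℤ.* head y ℤ.+ t) (·-zeroˡ (tail y)) ⟩
  g ℤ.* head y ℤ.+ 0ℤ                                      ≡⟨ ℤₚ.+-identityʳ (g ℤ.* head y) ⟩
  g ℤ.* head y                                             ∎
  where
  open ≡-Reasoning
  y = ⟦ u ⁻ᵀ ⟧ x

·-tails : (u : Unimodular (suc n)) → ∀ {x} → head (⟦ u ⁻ᵀ ⟧ x) ≡ 0ℤ → ∀ b →
  tail (⟦ u ⟧ b) · tail (⟦ u ⁻ᵀ ⟧ x) ≡ b · x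
·-tails u {x} head≡0 b = begin
  tail ub · tail y                              ≡⟨ ℤₚ.+-identityˡ (tail ub · tail y) ⟨
  0ℤ ℤ.+ tail ub · tail y                       ≡⟨ cong (ℤ._+ tail ub · tail y) (ℤₚ.*-zeroʳ (head ub)) ⟨
  head ub ℤ.* 0ℤ ℤ.+ tail ub · tail y           ≡⟨ cong (λ t → head ub ℤ.* t ℤ.+ tail ub · tail y) head≡0 ⟨
  head ub ℤ.* head y ℤ.+ tail ub · tail y       ≡⟨ ·-transform u b x ⟨
  b · x                                         ∎
  where
  open ≡-Reasoning
  ub = ⟦ u ⟧ b
  y  = ⟦ u ⁻ᵀ ⟧ x

prepend-zero-row : {A : Mat m n} → ∀ {a} → a ≡ 𝟘 → RankDecomposition A → RankDecomposition (a ∷ A)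
prepend-zero-row refl D = record
  { rank           = rank
  ; nullity        = nullity
  ; rank+nullity≡n = rank+nullity≡n
  ; row-lattice    = row-lattice
  ; rows∈          = 𝟘-homo (equations-linear row-lattice) ∷ rows∈
  ; kernel-lattice = kernel-lattice
  ; kernel∈        = kernel∈ ∘ cong tail
  }
  where open RankDecomposition D

prepend-pivot-row : {A : Mat m (suc n)} (u : Unimodular (suc n)) → ∀ {a g} → ⟦ u ⟧ a ≡ g ∷ 𝟘 → g ≢ 0ℤ →
  RankDecomposition (Vec.map (tail ∘ ⟦ u ⟧) A) → RankDecomposition (a ∷ A)
prepend-pivot-row {A = A} u {a} {g} ua≡ g≢0 D = record
  { rank           = suc rank
  ; nullity        = nullity
  ; rank+nullity≡n = cong suc rank+nullity≡n
  ; row-lattice    = cylinder u row-lattice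
  ; rows∈          = trans (cong (equations row-lattice ∘ tail) ua≡) (𝟘-homo (equations-linear row-lattice))
      ∷ VAllₚ.map⁻ rows∈
  ; kernel-lattice = slice (u ⁻ᵀ) kernel-lattice
  ; kernel∈        = λ [aA]x≡𝟘 →
      let head≡0 = pivot≡0 (cong head [aA]x≡𝟘) in cong₂ _∷_ head≡0 (kernel∈ (tails⊥ head≡0 (cong tail [aA]x≡𝟘)))
  }
  where
  open RankDecomposition D
  pivot≡0 : ∀ {x} → a · x ≡ 0ℤ → head (⟦ u ⁻ᵀ ⟧ x) ≡ 0ℤ
  pivot≡0 {x} a·x≡0 with ℤₚ.i*j≡0⇒i≡0∨j≡0 g (trans (sym (·-pivot u ua≡ x)) a·x≡0)
  ... | inj₁ g≡0    = ⊥-elim (g≢0 g≡0)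
  ... | inj₂ head≡0 = head≡0
  tails⊥ : ∀ {x} → head (⟦ u ⁻ᵀ ⟧ x) ≡ 0ℤ → A *ᵛ x ≡ 𝟘 → Vec.map (tail ∘ ⟦ u ⟧) A *ᵛ tail (⟦ u ⁻ᵀ ⟧ x) ≡ 𝟘
  tails⊥ {x} head≡0 Ax≡𝟘 = begin
    Vec.map (tail ∘ ⟦ u ⟧) A *ᵛ tail y            ≡⟨ Vecₚ.map-∘ (_· tail y) (tail ∘ ⟦ u ⟧) A ⟨
    Vec.map (λ b → tail (⟦ u ⟧ b) · tail y) A     ≡⟨ Vecₚ.map-cong (·-tails u head≡0) A ⟩
    A *ᵛ x                                        ≡⟨ Ax≡𝟘 ⟩
    𝟘                                             ∎
    where
    open ≡-Reasoning
    y = ⟦ u ⁻ᵀ ⟧ x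

rank-decomposition : (A : Mat m n) → RankDecomposition A
rank-decomposition {n = n} [] = record
  { rank           = 0
  ; nullity        = n
  ; rank+nullity≡n = refl
  ; row-lattice    = zero-lattice
  ; rows∈          = []
  ; kernel-lattice = full-lattice
  ; kernel∈        = λ _ → refl
  }
rank-decomposition {n = zero}  ([] ∷ A) = prepend-zero-row refl (rank-decomposition A)
rank-decomposition {n = suc n} (a ∷ A) with reduce a
... | u , g , ua≡ with g ℤ.≟ 0ℤ
...   | yes refl = prepend-zero-row (⟦⟧≡𝟘⇒≡𝟘 u ua≡) (rank-decomposition A)
...   | no g≢0   = prepend-pivot-row u ua≡ g≢0 (rank-decomposition (Vec.map (tail ∘ ⟦ u ⟧) A))

module _ (A : Mat m n) where
  open RankDecomposition (rank-decomposition A)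

  atmost-solutions : ∀ H (b : Vec ℤ m) → Atmost (λ x → Bounded H x × A *ᵛ x ≡ b) (suc (2 * H) ^ nullity)
  atmost-solutions H b = atmost-lattice-coset kernel-lattice H proj₁
    λ (_ , Ax≡b) (_ , Ay≡b) → kernel∈ (ker-⊖ (*ᵛ-linear A) (trans Ax≡b (sym Ay≡b)))

  nullity≡0⇒injective : nullity ≡ 0 → ∀ {x y} → A *ᵛ x ≡ A *ᵛ y → x ≡ y
  nullity≡0⇒injective nullity≡0 {x} {y} Ax≡Ay = x⊖y≡𝟘⇒x≡y x y
    (coords-injective kernel-lattice (kernel∈ (ker-⊖ (*ᵛ-linear A) Ax≡Ay)) (Vec₀-irrelevant nullity≡0))

  rank≡0⇒rows≡𝟘 : rank ≡ 0 → VAll.All (_≡ 𝟘) A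
  rank≡0⇒rows≡𝟘 rank≡0 = VAll.map (λ a∈ → coords-injective row-lattice a∈ (Vec₀-irrelevant rank≡0)) rows∈

-- Orthogonality and primitive vectors

_⊥_ : Mat m n → Vec ℤ n → Set
B ⊥ x = VAll.All (λ b → b · x ≡ 0ℤ) B

⊥⇒*ᵛ≡𝟘 : (B : Mat m n) → ∀ {x} → B ⊥ x → B *ᵛ x ≡ 𝟘
⊥⇒*ᵛ≡𝟘 []      []            = refl
⊥⇒*ᵛ≡𝟘 (b ∷ B) (b⊥x ∷ B⊥x) = cong₂ _∷_ b⊥x (⊥⇒*ᵛ≡𝟘 B B⊥x)

*ᵛ≡𝟘⇒⊥ : (B : Mat m n) → ∀ {x} → B *ᵛ x ≡ 𝟘 → B ⊥ x
*ᵛ≡𝟘⇒⊥ []      _    = []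
*ᵛ≡𝟘⇒⊥ (b ∷ B) Bx≡𝟘 = cong head Bx≡𝟘 ∷ *ᵛ≡𝟘⇒⊥ B (cong tail Bx≡𝟘)

x·z≡y·z⇒[x⊖y]·z≡0 : (x y z : Vec ℤ n) → x · z ≡ y · z → (x ⊖ y) · z ≡ 0ℤ
x·z≡y·z⇒[x⊖y]·z≡0 x y z x·z≡y·z = cong head (ker-⊖ (·-linear z) {x} {y} (cong (_∷ []) x·z≡y·z))

ℚ-span-⊥ : {B : Mat m n} → ∀ {y} → B ⊥ y → ∀ x → x ∈ℚ⟨ B ⟩ → x · y ≡ 0ℤ
ℚ-span-⊥ {y = y} B⊥y x x∈ = cong head (ker-ℚ-span (·-linear y) (VAll.map (cong (_∷ [])) B⊥y) x∈)

record Primitive (y : Vec ℤ (suc n)) : Set where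
  field
    orthogonal : Lattice (suc n) n
    ⊥⇒∈        : ∀ x → x · y ≡ 0ℤ → x ∈ᴸ orthogonal
    ∈⇒⊥        : ∀ x → x ∈ᴸ orthogonal → x · y ≡ 0ℤ
    dual       : Vec ℤ (suc n)
    dual·y≡1   : dual · y ≡ 1ℤ

e₁·x≡head : (x : Vec ℤ (suc n)) → e₁ · x ≡ head x
e₁·x≡head (a ∷ x) = trans (cong₂ ℤ._+_ (ℤₚ.*-identityˡ a) (·-zeroˡ x)) (ℤₚ.+-identityʳ a)

primitive-⟦⟧ : (u : Unimodular (suc n)) → Primitive (⟦ u ⁻¹ ⟧ e₁)
primitive-⟦⟧ u = record
  { orthogonal = slice (u ⁻ᵀ) full-lattice
  ; ⊥⇒∈        = λ x x·y≡0 → cong (_∷ []) (trans (sym (x·y≡ x)) x·y≡0)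
  ; ∈⇒⊥        = λ x x∈ → trans (x·y≡ x) (cong head x∈)
  ; dual       = ⟦ u ⁻ᵀ ⁻¹ ⟧ e₁
  ; dual·y≡1   = trans (x·y≡ (⟦ u ⁻ᵀ ⁻¹ ⟧ e₁)) (cong head (⁻¹-inverseʳ (u ⁻ᵀ) e₁))
  }
  where
  open ≡-Reasoning
  x·y≡ : ∀ x → x · ⟦ u ⁻¹ ⟧ e₁ ≡ head (⟦ u ⁻ᵀ ⟧ x)
  x·y≡ x = begin
    x · ⟦ u ⁻¹ ⟧ e₁                          ≡⟨ ·-comm x (⟦ u ⁻¹ ⟧ e₁) ⟩
    ⟦ u ⁻¹ ⟧ e₁ · x                          ≡⟨ ⟦⟧-⁻ᵀ-· u (⟦ u ⁻¹ ⟧ e₁) x ⟨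
    ⟦ u ⟧ (⟦ u ⁻¹ ⟧ e₁) · ⟦ u ⁻ᵀ ⟧ x         ≡⟨ cong (_· ⟦ u ⁻ᵀ ⟧ x) (⁻¹-inverseʳ u e₁) ⟩
    e₁ · ⟦ u ⁻ᵀ ⟧ x                          ≡⟨ e₁·x≡head (⟦ u ⁻ᵀ ⟧ x) ⟩
    head (⟦ u ⁻ᵀ ⟧ x)                        ∎

∃-primitive : (y : Vec ℤ (suc n)) → y ≢ 𝟘 → ∃[ y′ ] Primitive y′ ×
  (∀ x → x · y ≡ 0ℤ → x · y′ ≡ 0ℤ) × (∀ x → x · y′ ≡ 0ℤ → x · y ≡ 0ℤ)
∃-primitive y y≢𝟘 with reduce y
... | u , g , uy≡ = y′ , primitive-⟦⟧ u , x·y≡0⇒x·y′≡0 , λ x x·y′≡0 → begin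
    x · y               ≡⟨ x·y≡ x ⟩
    g ℤ.* x · y′        ≡⟨ cong (g ℤ.*_) x·y′≡0 ⟩
    g ℤ.* 0ℤ            ≡⟨ ℤₚ.*-zeroʳ g ⟩
    0ℤ                  ∎
  where
  open ≡-Reasoning
  y′ = ⟦ u ⁻¹ ⟧ e₁
  y≡gy′ : y ≡ g ⊙ y′
  y≡gy′ = begin
    y                         ≡⟨ ⁻¹-inverseˡ u y ⟨
    ⟦ u ⁻¹ ⟧ (⟦ u ⟧ y)        ≡⟨ cong ⟦ u ⁻¹ ⟧ (trans uy≡ (sym (c⊙e₁≡c∷𝟘 g))) ⟩
    ⟦ u ⁻¹ ⟧ (g ⊙ e₁)         ≡⟨ ⊙-homo (⟦⟧-linear (u ⁻¹)) g e₁ ⟩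
    g ⊙ y′                    ∎
  x·y≡ : ∀ x → x · y ≡ g ℤ.* x · y′
  x·y≡ x = trans (cong (x ·_) y≡gy′) (·-⊙ g x y′)
  x·y≡0⇒x·y′≡0 : ∀ x → x · y ≡ 0ℤ → x · y′ ≡ 0ℤ
  x·y≡0⇒x·y′≡0 x x·y≡0 with ℤₚ.i*j≡0⇒i≡0∨j≡0 g (trans (sym (x·y≡ x)) x·y≡0)
  ... | inj₁ g≡0    = ⊥-elim (y≢𝟘 (trans y≡gy′ (trans (cong (_⊙ y′) g≡0) (⊙-zeroˡ y′))))
  ... | inj₂ x·y′≡0 = x·y′≡0

-- Counting by successive minima

^-distribʳ-* : ∀ a b n → (a * b) ^ n ≡ a ^ n * b ^ n
^-distribʳ-* a b zero    = refl
^-distribʳ-* a b (suc n) =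
  trans (cong (a * b *_) (^-distribʳ-* a b n)) (ℕₚ.[m*n]*[o*p]≡[m*o]*[n*p] a b (a ^ n) (b ^ n))

^-swap : ∀ a m n → (a ^ m) ^ n ≡ (a ^ n) ^ m
^-swap a m n = trans (ℕₚ.^-*-assoc a m n) (trans (cong (a ^_) (ℕₚ.*-comm m n)) (sym (ℕₚ.^-*-assoc a n m)))

minimaCandidates : ∀ n → Vec ℕ k → List (Mat k n)
minimaCandidates n = choices ∘ Vec.map (λ e → box n (2 ^ suc e))

∈-minimaCandidates : {xs : Mat k n} {es : Vec ℕ k} → Pointwise (λ x e → Bounded (2 ^ suc e) x) xs es →
  xs ∈ minimaCandidates n es
∈-minimaCandidates []       = here refl
∈-minimaCandidates (b ∷ bs) = ∈ₚ.∈-cartesianProductWith⁺ _∷_ (∈-box⁺ b) (∈-minimaCandidates bs)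

boxSize : ℕ → ℕ → ℕ
boxSize n h = (2 ^ (3 + h)) ^ n

boxSize≢0 : ∀ n h → NonZero (boxSize n h)
boxSize≢0 n h = ℕₚ.m^n≢0 (2 ^ (3 + h)) n {{ℕₚ.m^n≢0 2 (3 + h)}}

box×index≤ : ∀ n {h e} → e ≤ h → length (box n (2 ^ suc e)) * (2 ^ (h ∸ e)) ^ n ≤ boxSize n h
box×index≤ n {h} {e} e≤h = begin
  length (box n p) * (2 ^ (h ∸ e)) ^ n     ≡⟨ cong (_* (2 ^ (h ∸ e)) ^ n) (length-box n p) ⟩
  suc (2 * p) ^ n * (2 ^ (h ∸ e)) ^ n      ≡⟨ ^-distribʳ-* (suc (2 * p)) (2 ^ (h ∸ e)) n ⟨
  (suc (2 * p) * 2 ^ (h ∸ e)) ^ n          ≤⟨ ℕₚ.^-monoˡ-≤ n (ℕₚ.*-monoˡ-≤ (2 ^ (h ∸ e)) 1+2p≤4p) ⟩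
  (2 ^ (3 + e) * 2 ^ (h ∸ e)) ^ n          ≡⟨ cong (_^ n) (ℕₚ.^-distribˡ-+-* 2 (3 + e) (h ∸ e)) ⟨
  (2 ^ (3 + e + (h ∸ e))) ^ n              ≡⟨ cong (λ t → (2 ^ (3 + t)) ^ n) (ℕₚ.m+[n∸m]≡n e≤h) ⟩
  boxSize n h                              ∎
  where
  open ℕₚ.≤-Reasoning
  p = 2 ^ suc e
  1+2p≤4p : suc (2 * p) ≤ 2 ^ (3 + e)
  1+2p≤4p = ℕₚ.≤-trans (ℕₚ.+-monoˡ-≤ (2 * p) (ℕₚ.m^n>0 2 (3 + e ∸ 1))) (ℕₚ.≤-reflexive (eq p))
    where
    eq : ∀ p → 2 * p + 2 * p ≡ 2 * (2 * p)
    eq = solve-∀ℕ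

candidates×indices≤ : ∀ n {h} {es : Vec ℕ k} → VAll.All (_≤ h) es →
  length (minimaCandidates n es) * ∏ (indices h es) ^ n ≤ boxSize n h ^ k
candidates×indices≤ n [] = ℕₚ.≤-reflexive (trans (ℕₚ.*-identityˡ (1 ^ n)) (ℕₚ.^-zeroˡ n))
candidates×indices≤ {suc k} n {h} {e ∷ es} (e≤h ∷ es≤h) = begin
  length (minimaCandidates n (e ∷ es)) * (ι * J) ^ n    ≡⟨ cong₂ _*_ length≡ (^-distribʳ-* ι J n) ⟩
  (V * K) * (ι ^ n * J ^ n)                             ≡⟨ ℕₚ.[m*n]*[o*p]≡[m*o]*[n*p] V K (ι ^ n) (J ^ n) ⟩
  (V * ι ^ n) * (K * J ^ n)                             ≤⟨ ℕₚ.*-mono-≤ (box×index≤ n e≤h) (candidates×indices≤ n es≤h) ⟩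
  boxSize n h * boxSize n h ^ k                         ∎
  where
  open ℕₚ.≤-Reasoning
  ι = 2 ^ (h ∸ e)
  J = ∏ (indices h es)
  V = length (box n (2 ^ suc e))
  K = length (minimaCandidates n es)
  length≡ : length (minimaCandidates n (e ∷ es)) ≡ V * K
  length≡ = length-cartesianProductWith _∷_ (box n (2 ^ suc e)) (minimaCandidates n es)

logFactor : ℕ → ℕ → ℕ
logFactor n h = suc n * suc h ^ n

module _ {X : Set} (n h r : ℕ) (R : X → ∀ {k} → Mat k n → Vec ℕ k → Set) where

  HasMinima : X → Vec ℕ k → Set
  HasMinima x es = ∃[ xs ] Pointwise (λ y e → Bounded (2 ^ suc e) y) xs es × R x xs es

  HasLevels : X → ℕ → Set
  HasLevels x k = Σ[ es ∈ Vec ℕ k ] VAll.All (_≤ h) es × HasMinima x es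

  module _ {P : X → Set} (F : ℕ) (fibre : ∀ {k} (xs : Mat k n) es → VAll.All (_≤ h) es →
    Atmost (λ x → P x × R x xs es) (F * ∏ (indices h es) ^ n)) where

    atmost-minima : {es : Vec ℕ k} → VAll.All (_≤ h) es →
      Atmost (λ x → P x × HasMinima x es) (F * boxSize n h ^ k)
    atmost-minima {k} {es} es≤h = atmost-≤ (begin
        K * (F * J ^ n)          ≡⟨ x∙yz≈y∙xz K F (J ^ n) ⟩
        F * (K * J ^ n)          ≤⟨ ℕₚ.*-monoʳ-≤ F (candidates×indices≤ n es≤h) ⟩
        F * boxSize n h ^ k      ∎)
      (atmost-cover (λ x xs → R x xs es) (minimaCandidates n es)
        (λ (_ , _ , bounded , r) → lose (∈-minimaCandidates bounded) r)
        (λ xs → atmost-⊆ (λ ((p , _) , r) → p , r) (fibre xs es es≤h)))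
      where
      open ℕₚ.≤-Reasoning
      K = length (minimaCandidates n es)
      J = ∏ (indices h es)

    atmost-levels : k ≤ r → Atmost (λ x → P x × HasLevels x k) (suc h ^ r * (F * boxSize n h ^ r))
    atmost-levels k≤r = atmost-≤
      (ℕₚ.*-mono-≤ (ℕₚ.^-monoʳ-≤ (suc h) k≤r) (ℕₚ.*-monoʳ-≤ F (ℕₚ.^-monoʳ-≤ (boxSize n h) {{boxSize≢0 n h}} k≤r)))
      (atmost-cover-all-≤ HasMinima proj₂
        λ es≤h → atmost-⊆ (λ ((p , _) , minima) → p , minima) (atmost-minima es≤h))

    atmost-by-minima : r ≤ n → (∀ {x} → P x → ∃[ k ] k ≤ r × HasLevels x k) →
      Atmost P (logFactor n h * (F * boxSize n h ^ r))
    atmost-by-minima r≤n levels = atmost-≤ (begin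
        suc r * (suc h ^ r * (F * boxSize n h ^ r))      ≡⟨ ℕₚ.*-assoc (suc r) (suc h ^ r) _ ⟨
        suc r * suc h ^ r * (F * boxSize n h ^ r)        ≤⟨ ℕₚ.*-monoˡ-≤ _ logFactor≥ ⟩
        logFactor n h * (F * boxSize n h ^ r)            ∎)
      (atmost-cover-≤ HasLevels levels atmost-levels)
      where
      open ℕₚ.≤-Reasoning
      logFactor≥ : suc r * suc h ^ r ≤ logFactor n h
      logFactor≥ = ℕₚ.*-mono-≤ (s≤s r≤n) (ℕₚ.^-monoʳ-≤ (suc h) r≤n)

-- Matrices of bounded rank

BoundedMat : ℕ → Mat m n → Set
BoundedMat H = VAll.All (Bounded H)

short-difference : ∀ h {H} → H + H < 2 ^ h → {x y : Vec ℤ n} → Bounded H x → Bounded H y → Short h (x ⊖ y)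
short-difference h 2H<2^h bx by = bounded⇒short h 2H<2^h (bounded-⊖ bx by)

bounded-short : ∀ h {H} → H + H < 2 ^ h → {x : Vec ℤ n} → Bounded H x → Short h x
bounded-short h {H} 2H<2^h = bounded⇒short h (ℕₚ.≤-<-trans (ℕₚ.m≤m+n H H) 2H<2^h)

module _ {h H : ℕ} (2H<2^h : H + H < 2 ^ h) where

  atmost-span : {C : Mat k n} {es : Vec ℕ k} → Separated C es → VAll.All (_≤ h) es →
    Atmost (λ x → Bounded H x × x ∈⟨ C ⟩) (∏ (indices h es))
  atmost-span separated es≤h = atmost-separated-coset separated es≤h
    λ (bx , x∈) (by , y∈) → short-difference h 2H<2^h bx by , ∈⟨⟩-⊖ x∈ y∈

  atmost-ℚ-span : {xs : Mat k n} {es : Vec ℕ k} → AdaptedBasis xs es → VAll.All (_≤ h) es →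
    Atmost (λ (A : Mat m n) → BoundedMat H A × VAll.All (_∈ℚ⟨ xs ⟩) A) (∏ (indices h es) ^ m)
  atmost-ℚ-span B es≤h = atmost-⊆
    (λ (bA , A∈) → VAll.map (λ (bx , x∈) → bx , ℚ-span⇒span x∈) (VAll.zip (bA , A∈)))
    (atmost-all _≟ᵛ_ (atmost-span separated es≤h))
    where open AdaptedBasis B

  rows∈ℚ-span : {L : Lattice n t} (S : SuccessiveMinima L h k s) → {A : Mat m n} →
    BoundedMat H A → VAll.All (_∈ᴸ L) A → VAll.All (_∈ℚ⟨ SuccessiveMinima.minima S ⟩) A
  rows∈ℚ-span S bA A∈ = VAll.map
    (λ (bx , x∈) → AdaptedBasis.span⇒ℚ-span adapted (short⇒span x∈ (bounded-short h 2H<2^h bx)))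
    (VAll.zip (bA , A∈))
    where open SuccessiveMinima S

  atmost-rows-in-lattice : r ≤ n → Atmost
    (λ (A : Matrix n) → BoundedMat H A × Σ[ L ∈ Lattice n r ] VAll.All (_∈ᴸ L) A) (logFactor n h * boxSize n h ^ r)
  atmost-rows-in-lattice {r} {n} r≤n = atmost-≤ (ℕₚ.≤-reflexive (cong (logFactor n h *_) (ℕₚ.*-identityˡ _)))
    (atmost-by-minima n h r (λ A xs es → AdaptedBasis xs es × VAll.All (_∈ℚ⟨ xs ⟩) A) 1
      (λ xs es es≤h → atmost-≤ (ℕₚ.≤-reflexive (sym (ℕₚ.*-identityˡ _)))
        (atmost-inhabited λ A (_ , B , _) → atmost-⊆ (λ ((bA , _) , _ , A∈) → bA , A∈) (atmost-ℚ-span B es≤h)))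
      r≤n
      λ (bA , L , A∈) →
        let k , _ , S = successive-minima {L = L} h
            open SuccessiveMinima S
        in k , k≤t , levels , levels≤ , minima , minima-bounded , adapted , rows∈ℚ-span S bA A∈)

-- Matrices dividing a nonzero integer

infix 4 _∣ᴹ_

record _∣ᴹ_ (A : Matrix n) (d : ℤ) : Set where
  constructor divides
  field
    complement        : Vec ℤ n → Vec ℤ n
    complement-linear : Linear complement
    *ᵛ-complement     : ∀ x → A *ᵛ complement x ≡ d ⊙ x

-- The map (a , x) ↦ a v + g x has a kernel vector (c , z), and c ≠ 0 because g is injective.
right⇒left-inverse : ∀ {d} {f g : Vec ℤ n → Vec ℤ n} → d ≢ 0ℤ → Linear f → Linear g →
  (∀ x → f (g x) ≡ d ⊙ x) → ∀ x → g (f x) ≡ d ⊙ x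
right⇒left-inverse {n} {d} {f} {g} d≢0 F G fg≡d v with kernel-nontrivial relation-linear ℕₚ.≤-refl
  where
  relation-linear : Linear {suc n} (λ y → head y ⊙ v ⊕ g (tail y))
  relation-linear = record
    { ⊕-homo = λ { (a ∷ x) (b ∷ y) → trans (cong₂ _⊕_ (⊙-distribʳ-+ a b v) (⊕-homo G x y)) (⊕-interchange _ _ _ _) }
    ; ⊙-homo = λ { c (a ∷ x) → trans (cong₂ _⊕_ (⊙-assoc c a v) (⊙-homo G c x)) (sym (⊙-distribˡ-⊕ c _ _)) }
    }
... | c ∷ z , y≢𝟘 , cv+gz≡𝟘 = x⊖y≡𝟘⇒x≡y (g (f v)) (d ⊙ v) (c⊙x≡𝟘⇒x≡𝟘 c≢0 (begin
  c ⊙ (g (f v) ⊖ d ⊙ v)          ≡⟨ ⊖-homo (⊙-linear c) (g (f v)) (d ⊙ v) ⟩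
  c ⊙ g (f v) ⊖ c ⊙ d ⊙ v        ≡⟨ x≡y⇒x⊖y≡𝟘 cgfv≡cdv ⟩
  𝟘                              ∎))
  where
  open ≡-Reasoning
  c≢0 : c ≢ 0ℤ
  c≢0 refl = y≢𝟘 (cong (0ℤ ∷_) (c⊙x≡𝟘⇒x≡𝟘 d≢0 (begin
    d ⊙ z          ≡⟨ fg≡d z ⟨
    f (g z)        ≡⟨ cong f (trans (sym (⊕-identityˡ (g z))) (trans (cong (_⊕ g z) (sym (⊙-zeroˡ v))) cv+gz≡𝟘)) ⟩
    f 𝟘            ≡⟨ 𝟘-homo F ⟩
    𝟘              ∎)))
  -z : Vec ℤ n
  -z = (- 1ℤ) ⊙ z
  cv≡g[-z] : c ⊙ v ≡ g -z
  cv≡g[-z] = begin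
    c ⊙ v                ≡⟨ x⊕y≡𝟘⇒x≡-y (c ⊙ v) (g z) cv+gz≡𝟘 ⟩
    Vec.map -_ (g z)     ≡⟨ -1⊙x≡-x (g z) ⟨
    (- 1ℤ) ⊙ g z         ≡⟨ ⊙-homo G (- 1ℤ) z ⟨
    g -z                 ∎
  cgfv≡cdv : c ⊙ g (f v) ≡ c ⊙ d ⊙ v
  cgfv≡cdv = begin
    c ⊙ g (f v)          ≡⟨ ⊙-homo (∘-linear G F) c v ⟨
    g (f (c ⊙ v))        ≡⟨ cong (g ∘ f) cv≡g[-z] ⟩
    g (f (g -z))         ≡⟨ cong g (fg≡d -z) ⟩
    g (d ⊙ -z)           ≡⟨ ⊙-homo G d -z ⟩
    d ⊙ g -z             ≡⟨ cong (d ⊙_) cv≡g[-z] ⟨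
    d ⊙ c ⊙ v            ≡⟨ ⊙-comm d c v ⟩
    c ⊙ d ⊙ v            ∎

∣ᴹ-injective : ∀ {d} (A : Matrix n) → d ≢ 0ℤ → A ∣ᴹ d → ∀ x y → A *ᵛ x ≡ A *ᵛ y → x ≡ y
∣ᴹ-injective A d≢0 (divides G G-linear AG≡d) x y Ax≡Ay = x⊖y≡𝟘⇒x≡y x y (c⊙x≡𝟘⇒x≡𝟘 d≢0
  (trans (sym (right⇒left-inverse d≢0 (*ᵛ-linear A) G-linear AG≡d (x ⊖ y)))
  (trans (cong G (ker-⊖ (*ᵛ-linear A) Ax≡Ay)) (𝟘-homo G-linear))))

rows-span⇒≤ : (a : Vec ℤ (suc n)) {A : Mat m (suc n)} {B : Mat k (suc n)} →
  (∀ x → (a ∷ A) *ᵛ x ≡ 𝟘 → x ≡ 𝟘) → VAll.All (_∈ℚ⟨ B ⟩) A → n ≤ k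
rows-span⇒≤ a {A} {B} injective A∈ = ℕₚ.≮⇒≥ λ k<n →
  let x , x≢𝟘 , [aB]x≡𝟘 = kernel-nontrivial (*ᵛ-linear (a ∷ B)) (s≤s k<n)
      B⊥x = *ᵛ≡𝟘⇒⊥ B (cong tail [aB]x≡𝟘)
  in x≢𝟘 (injective x (⊥⇒*ᵛ≡𝟘 (a ∷ A) (cong head [aB]x≡𝟘 ∷ VAll.map (λ {b} → ℚ-span-⊥ B⊥x b) A∈)))

module _ {h H : ℕ} (2H<2^h : H + H < 2 ^ h) {d : ℤ} (d≢0 : d ≢ 0ℤ) {n : ℕ} where

  private
    HasHyperplane : Mat k (suc n) → Set
    HasHyperplane C = ∃[ y ] Primitive y × (∀ x → x · y ≡ 0ℤ → x ∈⟨ C ⟩)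

    Profile : Matrix (suc n) → ∀ {k} → Mat k (suc n) → Vec ℕ k → Set
    Profile A xs es = Σ[ B ∈ AdaptedBasis xs es ] HasHyperplane (AdaptedBasis.basis B) ×
      ∃[ y ] head A · y ≡ d × xs ⊥ y × VAll.All (_∈ℚ⟨ xs ⟩) (tail A)

  -- The rows of A other than the first span the hyperplane orthogonal to the first column of d A⁻¹.
  divisor-profile : ∀ {A} → BoundedMat H A × A ∣ᴹ d → ∃[ k ] k ≤ n × HasLevels (suc n) h n Profile A k
  divisor-profile {a ∷ A} (_ ∷ bA , A∣d@(divides G G-linear AG≡d)) =
    let y′ , y′-primitive , ⊥y⇒⊥y′ , ⊥y′⇒⊥y = ∃-primitive y y≢𝟘
        open Primitive y′-primitive
        k , _ , S = successive-minima {L = orthogonal} h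
        open SuccessiveMinima S
        A∈ = rows∈ℚ-span 2H<2^h S bA (VAll.map (λ {b} b·y≡0 → ⊥⇒∈ b (⊥y⇒⊥y′ b b·y≡0)) (*ᵛ≡𝟘⇒⊥ A Ay≡𝟘))
    in k , k≤t , levels , levels≤ , minima , minima-bounded
     , adapted , (y′ , y′-primitive , λ x x·y′≡0 → exhaustive (rows-span⇒≤ a injective A∈) (⊥⇒∈ x x·y′≡0))
     , y , a·y≡d , VAll.map (λ {b} b∈ → ⊥y′⇒⊥y b (∈⇒⊥ b b∈)) minima∈ᴸ , A∈
    where
    y = G e₁
    a·y≡d : a · y ≡ d
    a·y≡d = trans (cong head (AG≡d e₁)) (ℤₚ.*-identityʳ d)
    Ay≡𝟘 : A *ᵛ y ≡ 𝟘
    Ay≡𝟘 = trans (cong tail (AG≡d e₁)) (⊙-zeroʳ d)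
    y≢𝟘 : y ≢ 𝟘
    y≢𝟘 y≡𝟘 = d≢0 (trans (sym a·y≡d) (trans (cong (a ·_) y≡𝟘) (·-zeroʳ a)))
    injective : ∀ x → (a ∷ A) *ᵛ x ≡ 𝟘 → x ≡ 𝟘
    injective x [aA]x≡𝟘 =
      ∣ᴹ-injective (a ∷ A) d≢0 A∣d x 𝟘 (trans [aA]x≡𝟘 (sym (𝟘-homo (*ᵛ-linear (a ∷ A)))))

  -- Modulo the hyperplane, x is (x · y′) times the dual vector of y′.
  ·-divides : {C : Mat k (suc n)} ((y′ , y′-primitive , ⊥⇒span) : HasHyperplane C) →
    ∀ x y → x · y ≡ d → (∀ z → z ∈⟨ C ⟩ → z · y ≡ 0ℤ) → d ≡ x · y′ ℤ.* Primitive.dual y′-primitive · y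
  ·-divides (y′ , y′-primitive , ⊥⇒span) x y x·y≡d span⊥y = begin
    d                              ≡⟨ x·y≡d ⟨
    x · y                          ≡⟨ cong (_· y) (y⊖x⊕x≡y (a ⊙ dual) x) ⟨
    (z ⊕ a ⊙ dual) · y             ≡⟨ ·-distribʳ-⊕ z (a ⊙ dual) y ⟩
    z · y ℤ.+ (a ⊙ dual) · y       ≡⟨ cong₂ ℤ._+_ (span⊥y z (⊥⇒span z z·y′≡0)) (⊙-· a dual y) ⟩
    0ℤ ℤ.+ a ℤ.* dual · y          ≡⟨ ℤₚ.+-identityˡ (a ℤ.* dual · y) ⟩
    a ℤ.* dual · y                 ∎
    where
    open ≡-Reasoning
    open Primitive y′-primitive
    a = x · y′
    z = x ⊖ a ⊙ dual
    z·y′≡0 : z · y′ ≡ 0ℤ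
    z·y′≡0 = x·z≡y·z⇒[x⊖y]·z≡0 x (a ⊙ dual) y′ (begin
      a                    ≡⟨ ℤₚ.*-identityʳ a ⟨
      a ℤ.* 1ℤ             ≡⟨ cong (a ℤ.*_) dual·y≡1 ⟨
      a ℤ.* dual · y′      ≡⟨ ⊙-· a dual y′ ⟨
      (a ⊙ dual) · y′      ∎)

  module _ {divisors : List ℤ} (∈-divisors : ∀ a b → d ≡ a ℤ.* b → a ∈ divisors) where

    atmost-first-rows : {C : Mat k (suc n)} {es : Vec ℕ k} → Separated C es → VAll.All (_≤ h) es →
      ((y′ , _ , _) : HasHyperplane C) →
      Atmost (λ x → Bounded H x × x · y′ ∈ divisors) (length divisors * ∏ (indices h es))
    atmost-first-rows separated es≤h (y′ , _ , ⊥⇒span) =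
      atmost-cover (λ x a → x · y′ ≡ a) divisors proj₂ λ a →
        atmost-separated-coset separated es≤h λ {x} {z} ((bx , _) , x·y′≡a) ((bz , _) , z·y′≡a) →
          short-difference h 2H<2^h bx bz , ⊥⇒span _ (x·z≡y·z⇒[x⊖y]·z≡0 x z y′ (trans x·y′≡a (sym z·y′≡a)))

    atmost-profile : {xs : Mat k (suc n)} {es : Vec ℕ k} → VAll.All (_≤ h) es →
      (B : AdaptedBasis xs es) → HasHyperplane (AdaptedBasis.basis B) →
      Atmost (λ A → (BoundedMat H A × A ∣ᴹ d) × Profile A xs es) (length divisors * ∏ (indices h es) ^ suc n)
    atmost-profile {es = es} es≤h B hyperplane =
      atmost-≤ (ℕₚ.≤-reflexive (ℕₚ.*-assoc (length divisors) (∏ (indices h es)) (∏ (indices h es) ^ n)))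
        (atmost-∷ _≟ᵛ_
          (λ { {a} ((ba ∷ _ , _) , _ , _ , y , a·y≡d , xs⊥y , _) →
            ba , ∈-divisors _ _ (·-divides hyperplane a y a·y≡d λ z z∈ → ℚ-span-⊥ xs⊥y z (span⇒ℚ-span z∈)) })
          (atmost-first-rows separated es≤h hyperplane)
          λ _ → atmost-⊆ (λ { ((_ ∷ bA , _) , _ , _ , _ , _ , _ , A∈) → bA , A∈ }) (atmost-ℚ-span 2H<2^h B es≤h))
      where open AdaptedBasis B

    atmost-divisors : Atmost (λ A → BoundedMat H A × A ∣ᴹ d)
      (logFactor (suc n) h * (length divisors * boxSize (suc n) h ^ n))
    atmost-divisors = atmost-by-minima (suc n) h n Profile (length divisors)
      (λ xs es es≤h → atmost-inhabited λ _ (_ , B , hyperplane , _) → atmost-profile es≤h B hyperplane)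
      (ℕₚ.n≤1+n n) divisor-profile

-- Matrix products

tabulate≡ : {A : Set} {f : Fin n → A} {x : Vec A n} → (∀ i → f i ≡ lookup x i) → tabulate f ≡ x
tabulate≡ {x = x} f≡ = trans (Vecₚ.tabulate-cong f≡) (Vecₚ.tabulate∘lookup x)

unit : Fin n → Vec ℤ n
unit zero    = e₁
unit (suc i) = 0ℤ ∷ unit i

unit-· : (i : Fin n) (x : Vec ℤ n) → unit i · x ≡ lookup x i
unit-· zero    x       = trans (e₁·x≡head x) (head≡lookup x)
  where
  head≡lookup : (x : Vec ℤ (suc n)) → head x ≡ lookup x zero
  head≡lookup (a ∷ x) = refl
unit-· (suc i) (a ∷ x) = trans (ℤₚ.+-identityˡ (unit i · x)) (unit-· i x)

·-unit : (x : Vec ℤ n) (i : Fin n) → x · unit i ≡ lookup x i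
·-unit x i = trans (·-comm x (unit i)) (unit-· i x)

lookup-unit-≡ : (i : Fin n) → lookup (unit i) i ≡ 1ℤ
lookup-unit-≡ zero    = refl
lookup-unit-≡ (suc i) = lookup-unit-≡ i

lookup-unit-≢ : {i j : Fin n} → i ≢ j → lookup (unit i) j ≡ 0ℤ
lookup-unit-≢ {i = zero}  {zero}  i≢j = ⊥-elim (i≢j refl)
lookup-unit-≢ {i = zero}  {suc j} i≢j = Vecₚ.lookup-replicate j 0ℤ
lookup-unit-≢ {i = suc i} {zero}  i≢j = refl
lookup-unit-≢ {i = suc i} {suc j} i≢j = lookup-unit-≢ (i≢j ∘ cong suc)

lookup-ext : {A : Set} {x y : Vec A n} → (∀ i → lookup x i ≡ lookup y i) → x ≡ y
lookup-ext {x = x} lookup≡ = trans (sym (Vecₚ.tabulate∘lookup x)) (tabulate≡ lookup≡)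

entry-identity : (i j : Fin n) → entry (identity n) i j ≡ lookup (unit i) j
entry-identity {n} i j with i Fin.≟ j | (entry (identity n) i j ≡ _) ∋
  trans (cong (λ row → lookup row j) (Vecₚ.lookup∘tabulate _ i)) (Vecₚ.lookup∘tabulate _ j)
... | yes refl | entry≡1 = trans entry≡1 (sym (lookup-unit-≡ i))
... | no i≢j   | entry≡0 = trans entry≡0 (sym (lookup-unit-≢ i≢j))

identity≡tabulate-unit : ∀ n → identity n ≡ tabulate unit
identity≡tabulate-unit n = lookup-ext λ i → trans (lookup-ext (entry-identity i)) (sym (Vecₚ.lookup∘tabulate unit i))

identity-*ᵛ : (x : Vec ℤ n) → identity n *ᵛ x ≡ x
identity-*ᵛ {n} x = begin
  identity n *ᵛ x                 ≡⟨ cong (_*ᵛ x) (identity≡tabulate-unit n) ⟩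
  tabulate unit *ᵛ x              ≡⟨ Vecₚ.tabulate-∘ (_· x) unit ⟨
  tabulate (λ i → unit i · x)     ≡⟨ tabulate≡ (λ i → unit-· i x) ⟩
  x                               ∎
  where open ≡-Reasoning

lookup-ᵛ* : (x : Vec ℤ m) (B : Mat m n) → ∀ j →
  lookup (x ᵛ* B) j ≡ sumFin m (λ i → lookup x i ℤ.* lookup (lookup B i) j)
lookup-ᵛ* []      []      j = Vecₚ.lookup-replicate j 0ℤ
lookup-ᵛ* (a ∷ x) (b ∷ B) j = trans (Vecₚ.lookup-zipWith ℤ._+_ j (a ⊙ b) (x ᵛ* B))
  (cong₂ ℤ._+_ (Vecₚ.lookup-map j (a ℤ.*_) b) (lookup-ᵛ* x B j))

⊗≡map : (A B : Matrix n) → A ⊗ B ≡ Vec.map (_ᵛ* B) A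
⊗≡map A B = begin
  A ⊗ B                                    ≡⟨ Vecₚ.tabulate-cong row≡ ⟩
  tabulate (λ i → lookup A i ᵛ* B)         ≡⟨ Vecₚ.tabulate-∘ (_ᵛ* B) (lookup A) ⟩
  Vec.map (_ᵛ* B) (tabulate (lookup A))    ≡⟨ cong (Vec.map (_ᵛ* B)) (Vecₚ.tabulate∘lookup A) ⟩
  Vec.map (_ᵛ* B) A                        ∎
  where
  open ≡-Reasoning
  row≡ : ∀ i → tabulate (λ j → sumFin _ (λ k → entry A i k ℤ.* entry B k j)) ≡ lookup A i ᵛ* B
  row≡ i = tabulate≡ λ j → sym (lookup-ᵛ* (lookup A i) B j)

*ᵛ-⊗ : (A B : Matrix n) (x : Vec ℤ n) → (A ⊗ B) *ᵛ x ≡ A *ᵛ B *ᵛ x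
*ᵛ-⊗ A B x = begin
  (A ⊗ B) *ᵛ x                        ≡⟨ cong (_*ᵛ x) (⊗≡map A B) ⟩
  Vec.map (_ᵛ* B) A *ᵛ x              ≡⟨ Vecₚ.map-∘ (_· x) (_ᵛ* B) A ⟨
  Vec.map (λ a → a ᵛ* B · x) A        ≡⟨ Vecₚ.map-cong (λ a → ᵛ*-· a B x) A ⟩
  A *ᵛ B *ᵛ x                         ∎
  where open ≡-Reasoning

*ᵛ-ext : {A B : Mat m n} → (∀ j → A *ᵛ unit j ≡ B *ᵛ unit j) → A ≡ B
*ᵛ-ext {A = []}    {[]}    _  = refl
*ᵛ-ext {A = a ∷ A} {b ∷ B} eq = cong₂ _∷_
  (lookup-ext λ j → trans (sym (·-unit a j)) (trans (cong head (eq j)) (·-unit b j)))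
  (*ᵛ-ext (cong tail ∘ eq))

⊗-identityʳ : (A : Matrix n) → A ⊗ identity n ≡ A
⊗-identityʳ {n} A = *ᵛ-ext λ j → trans (*ᵛ-⊗ A (identity n) (unit j)) (cong (A *ᵛ_) (identity-*ᵛ (unit j)))

⊗-assoc : (A B C : Matrix n) → (A ⊗ B) ⊗ C ≡ A ⊗ (B ⊗ C)
⊗-assoc A B C = *ᵛ-ext λ j → begin
  ((A ⊗ B) ⊗ C) *ᵛ unit j          ≡⟨ *ᵛ-⊗ (A ⊗ B) C (unit j) ⟩
  (A ⊗ B) *ᵛ C *ᵛ unit j           ≡⟨ *ᵛ-⊗ A B (C *ᵛ unit j) ⟩
  A *ᵛ B *ᵛ C *ᵛ unit j            ≡⟨ cong (A *ᵛ_) (*ᵛ-⊗ B C (unit j)) ⟨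
  A *ᵛ (B ⊗ C) *ᵛ unit j           ≡⟨ *ᵛ-⊗ A (B ⊗ C) (unit j) ⟨
  (A ⊗ (B ⊗ C)) *ᵛ unit j          ∎
  where open ≡-Reasoning

⊗-cancelˡ : (A : Matrix n) {B C : Matrix n} → (∀ x y → A *ᵛ x ≡ A *ᵛ y → x ≡ y) → A ⊗ B ≡ A ⊗ C → B ≡ C
⊗-cancelˡ A {B} {C} injective AB≡AC = *ᵛ-ext λ j → injective (B *ᵛ unit j) (C *ᵛ unit j) (begin
  A *ᵛ B *ᵛ unit j          ≡⟨ *ᵛ-⊗ A B (unit j) ⟨
  (A ⊗ B) *ᵛ unit j         ≡⟨ cong (_*ᵛ unit j) AB≡AC ⟩
  (A ⊗ C) *ᵛ unit j         ≡⟨ *ᵛ-⊗ A C (unit j) ⟩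
  A *ᵛ C *ᵛ unit j          ∎)
  where open ≡-Reasoning

zero-rows⇒≡zeroMat : {A : Matrix n} → VAll.All (_≡ 𝟘) A → A ≡ zeroMat n
zero-rows⇒≡zeroMat rows≡𝟘 = sym (tabulate≡ λ i →
  trans (tabulate≡ λ j → sym (Vecₚ.lookup-replicate j 0ℤ)) (sym (VAllₚ.lookup⁺ rows≡𝟘 i)))

zeroMat-rows : ∀ n → VAll.All (_≡ 𝟘) (zeroMat n)
zeroMat-rows n = VAllₚ.tabulate⁺ λ i → tabulate≡ λ j → sym (Vecₚ.lookup-replicate j 0ℤ)

zeroMat-*ᵛ : (x : Vec ℤ n) → zeroMat n *ᵛ x ≡ 𝟘
zeroMat-*ᵛ {n} x = ⊥⇒*ᵛ≡𝟘 (zeroMat n) (VAll.map (λ { refl → ·-zeroˡ x }) (zeroMat-rows n))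

*ᵛ≡𝟘⇒≡zeroMat : {A : Matrix n} → (∀ x → A *ᵛ x ≡ 𝟘) → A ≡ zeroMat n
*ᵛ≡𝟘⇒≡zeroMat A*ᵛ≡𝟘 = *ᵛ-ext λ j → trans (A*ᵛ≡𝟘 (unit j)) (sym (zeroMat-*ᵛ (unit j)))

zeroMat-⊗ : (B : Matrix n) → zeroMat n ⊗ B ≡ zeroMat n
zeroMat-⊗ {n} B = *ᵛ≡𝟘⇒≡zeroMat λ x → trans (*ᵛ-⊗ (zeroMat n) B x) (zeroMat-*ᵛ (B *ᵛ x))

⊗-zeroMat : (A : Matrix n) → A ⊗ zeroMat n ≡ zeroMat n
⊗-zeroMat {n} A = *ᵛ≡𝟘⇒≡zeroMat λ x →
  trans (*ᵛ-⊗ A (zeroMat n) x) (trans (cong (A *ᵛ_) (zeroMat-*ᵛ x)) (𝟘-homo (*ᵛ-linear A)))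

⊗≢zeroMat⇒ˡ : {A B : Matrix n} → A ⊗ B ≢ zeroMat n → A ≢ zeroMat n
⊗≢zeroMat⇒ˡ {B = B} AB≢0 refl = AB≢0 (zeroMat-⊗ B)

⊗≢zeroMat⇒ʳ : {A B : Matrix n} → A ⊗ B ≢ zeroMat n → B ≢ zeroMat n
⊗≢zeroMat⇒ʳ {A = A} AB≢0 refl = AB≢0 (⊗-zeroMat A)

-- Factorisations of nonsingular matrices

∣ᴹ-factorˡ : ∀ {d} (A B : Matrix n) → A ⊗ B ∣ᴹ d → A ∣ᴹ d
∣ᴹ-factorˡ A B (divides G G-linear ABG≡d) = divides ((B *ᵛ_) ∘ G) (∘-linear (*ᵛ-linear B) G-linear)
  λ x → trans (sym (*ᵛ-⊗ A B (G x))) (ABG≡d x)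

∣ᴹ-factorʳ : ∀ {d} (A B : Matrix n) → d ≢ 0ℤ → A ⊗ B ∣ᴹ d → B ∣ᴹ d
∣ᴹ-factorʳ A B d≢0 AB∣d@(divides G G-linear _) = divides (G ∘ (A *ᵛ_)) (∘-linear G-linear (*ᵛ-linear A))
  (right⇒left-inverse d≢0 (*ᵛ-linear A) complement-linear *ᵛ-complement)
  where open _∣ᴹ_ (∣ᴹ-factorˡ A B AB∣d)

Factorisation : ∀ m → ℕ → Matrix n → Vec (Matrix n) m → Set
Factorisation m H C As = VAll.All (BoundedMat H) As × prodMats As ≡ C

atmost-1-factorisation : ∀ {H} (C : Matrix n) → Atmost (Factorisation 1 H C) 1
atmost-1-factorisation C = atmost-1 λ { (A ∷ []) (B ∷ []) (_ , A≡C) (_ , B≡C) →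
  cong (_∷ []) (trans (sym (⊗-identityʳ A)) (trans (trans A≡C (sym B≡C)) (⊗-identityʳ B))) }

atmost-nonsingular-factorisations : ∀ {d H} → d ≢ 0ℤ → Atmost (λ (A : Matrix n) → BoundedMat H A × A ∣ᴹ d) M →
  ∀ m {C} → C ∣ᴹ d → Atmost (Factorisation (suc m) H C) (M ^ m)
atmost-nonsingular-factorisations d≢0 divisors zero    {C} C∣d = atmost-1-factorisation C
atmost-nonsingular-factorisations d≢0 divisors (suc m) {C} C∣d =
  atmost-∷ _≟M_ (λ { {A} {As} (bA ∷ _ , refl) → bA , ∣ᴹ-factorˡ A (prodMats As) C∣d }) divisors λ A →
    atmost-inhabited λ { As₀ (_ , refl) → atmost-⊆
      (λ { (_ ∷ bAs , eq) → bAs , ⊗-cancelˡ A (∣ᴹ-injective A d≢0 (∣ᴹ-factorˡ A (prodMats As₀) C∣d)) eq })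
      (atmost-nonsingular-factorisations d≢0 divisors m (∣ᴹ-factorʳ A (prodMats As₀) d≢0 C∣d)) }

-- Factorisations of singular matrices

++-linear : {f : Vec ℤ l → Vec ℤ m} {g : Vec ℤ l → Vec ℤ n} → Linear f → Linear g → Linear (λ x → f x ++ g x)
++-linear {f = f} {g} F G = record
  { ⊕-homo = λ x y → trans (cong₂ _++_ (⊕-homo F x y) (⊕-homo G x y))
      (sym (Vecₚ.zipWith-++ ℤ._+_ (f x) (g x) (f y) (g y)))
  ; ⊙-homo = λ c x → trans (cong₂ _++_ (⊙-homo F c x) (⊙-homo G c x))
      (sym (Vecₚ.map-++ (c ℤ.*_) (f x) (g x)))
  }

++≡𝟘⁻ : (x : Vec ℤ m) {y : Vec ℤ n} → x ++ y ≡ 𝟘 → x ≡ 𝟘 × y ≡ 𝟘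
++≡𝟘⁻ []      y≡𝟘 = refl , y≡𝟘
++≡𝟘⁻ (a ∷ x) eq  = let x≡𝟘 , y≡𝟘 = ++≡𝟘⁻ x (cong tail eq) in cong₂ _∷_ (cong head eq) x≡𝟘 , y≡𝟘

rank nullity : Mat m n → ℕ
rank    A = RankDecomposition.rank (rank-decomposition A)
nullity A = RankDecomposition.nullity (rank-decomposition A)

rank+nullity≡n : (A : Mat m n) → rank A + nullity A ≡ n
rank+nullity≡n A = RankDecomposition.rank+nullity≡n (rank-decomposition A)

rank≤n : (A : Mat m n) → rank A ≤ n
rank≤n A = subst (rank A ≤_) (rank+nullity≡n A) (ℕₚ.m≤m+n (rank A) (nullity A))

nullity≡n∸rank : (A : Mat m n) → nullity A ≡ n ∸ rank A
nullity≡n∸rank A = trans (sym (ℕₚ.m+n∸m≡n (rank A) (nullity A))) (cong (_∸ rank A) (rank+nullity≡n A))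

nullity≤n∸1 : (A : Matrix n) → A ≢ zeroMat n → nullity A ≤ n ∸ 1
nullity≤n∸1 {n} A A≢0 = subst (_≤ n ∸ 1) (sym (nullity≡n∸rank A)) (ℕₚ.∸-monoʳ-≤ n
  (ℕₚ.n≢0⇒n>0 λ rank≡0 → A≢0 (zero-rows⇒≡zeroMat (rank≡0⇒rows≡𝟘 A rank≡0))))

rank<n : (A : Mat m n) → nullity A ≢ 0 → rank A < n
rank<n {n = n} A nullity≢0 = ℕₚ.≤∧≢⇒< (rank≤n A) λ rank≡n →
  nullity≢0 (trans (nullity≡n∸rank A) (trans (cong (n ∸_) rank≡n) (ℕₚ.n∸n≡0 n)))

bounded-column : ∀ {H} {B : Mat m n} → BoundedMat H B → ∀ j → Bounded H (B *ᵛ unit j)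
bounded-column {H = H} bB j = VAllₚ.map⁺ (VAll.map
  (λ {b} bb → subst (λ t → ∣ t ∣ ≤ H) (sym (·-unit b j)) (VAllₚ.lookup⁺ bb j)) bB)

atmost-right-factors : (A C : Matrix n) → ∀ H →
  Atmost (λ B → BoundedMat H B × A ⊗ B ≡ C) ((suc (2 * H) ^ nullity A) ^ n)
atmost-right-factors {n} A C H = atmost-injection columns
  (λ { {B} (bB , refl) j → subst (λ y → Bounded H y × A *ᵛ y ≡ C *ᵛ unit j) (sym (lookup-columns B j))
    (bounded-column bB j , sym (*ᵛ-⊗ A B (unit j))) })
  (λ {B} {B′} _ _ columns≡ → *ᵛ-ext λ j → trans (sym (lookup-columns B j))
    (trans (cong (λ T → lookup T j) columns≡) (lookup-columns B′ j)))
  (atmost-lookup _≟ᵛ_ λ j → atmost-solutions A H (C *ᵛ unit j))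
  where
  columns : Matrix n → Vec (Vec ℤ n) n
  columns B = tabulate λ j → B *ᵛ unit j
  lookup-columns : ∀ B j → lookup (columns B) j ≡ B *ᵛ unit j
  lookup-columns B = Vecₚ.lookup∘tabulate (λ j → B *ᵛ unit j)

totalRank totalNullity : Vec (Matrix n) m → ℕ
totalRank    = Vec.sum ∘ Vec.map rank
totalNullity = Vec.sum ∘ Vec.map nullity

totalRank+totalNullity≡m*n : (As : Vec (Matrix n) m) → totalRank As + totalNullity As ≡ m * n
totalRank+totalNullity≡m*n []       = refl
totalRank+totalNullity≡m*n (A ∷ As) = trans (eq (rank A) (totalRank As) (nullity A) (totalNullity As))
  (cong₂ _+_ (rank+nullity≡n A) (totalRank+totalNullity≡m*n As))
  where
  eq : ∀ a b c d → a + b + (c + d) ≡ a + c + (b + d)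
  eq = solve-∀ℕ

-- The kernel coordinates of A₁, …, Aₘ, evaluated at A₂ ⋯ Aₘ x, …, x, determine x in the kernel of A₁ ⋯ Aₘ.
kernel-coords : (As : Vec (Matrix n) m) → ∃[ f ] Linear {n} {totalNullity As} f ×
  (∀ x → prodMats As *ᵛ x ≡ 𝟘 → f x ≡ 𝟘 → x ≡ 𝟘)
kernel-coords []       = const [] , []-linear , λ x x≡𝟘 _ → trans (sym (identity-*ᵛ x)) x≡𝟘
kernel-coords (A ∷ As) =
  let f , f-linear , injective = kernel-coords As
      g = coords kernel-lattice ∘ (prodMats As *ᵛ_)
      g-linear = ∘-linear (coords-linear kernel-lattice) (*ᵛ-linear (prodMats As))
  in (λ x → g x ++ f x) , ++-linear g-linear f-linear , λ x AAsx≡𝟘 gx++fx≡𝟘 →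
      let gx≡𝟘 , fx≡𝟘 = ++≡𝟘⁻ (g x) gx++fx≡𝟘
          Asx∈ker = kernel∈ (trans (sym (*ᵛ-⊗ A (prodMats As) x)) AAsx≡𝟘)
      in injective x (coords-injective kernel-lattice Asx∈ker gx≡𝟘) fx≡𝟘
  where open RankDecomposition (rank-decomposition A)

sylvester : (As : Vec (Matrix n) m) → prodMats As ≡ zeroMat n → n ≤ totalNullity As
sylvester As product≡0 = ℕₚ.≮⇒≥ λ nullity<n →
  let f , f-linear , injective = kernel-coords As
      x , x≢𝟘 , fx≡𝟘 = kernel-nontrivial f-linear nullity<n
  in x≢𝟘 (injective x (trans (cong (_*ᵛ x) product≡0) (zeroMat-*ᵛ x)) fx≡𝟘)

totalRank≤m*n : (As : Vec (Matrix n) (suc m)) → prodMats As ≡ zeroMat n → totalRank As ≤ m * n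
totalRank≤m*n {n} {m} As product≡0 = ℕₚ.+-cancelˡ-≤ n (totalRank As) (m * n) (begin
  n + totalRank As                    ≡⟨ ℕₚ.+-comm n (totalRank As) ⟩
  totalRank As + n                    ≤⟨ ℕₚ.+-monoʳ-≤ (totalRank As) (sylvester As product≡0) ⟩
  totalRank As + totalNullity As      ≡⟨ totalRank+totalNullity≡m*n As ⟩
  suc m * n                           ∎)
  where open ℕₚ.≤-Reasoning

-- n · nonzeroExponent n m = (m + 1) n² - 2 n, which leaves a factor Hⁿ to absorb the logarithms.
nonzeroExponent : ℕ → ℕ → ℕ
nonzeroExponent n m = n * m + (n ∸ 2)

n+nonzeroExponent≡ : ∀ n m → n + nonzeroExponent n m ≡ nonzeroExponent n (suc m)
n+nonzeroExponent≡ n m = trans (sym (ℕₚ.+-assoc n (n * m) (n ∸ 2))) (cong (_+ (n ∸ 2)) (sym (ℕₚ.*-suc n m)))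

2[n∸1]+n*m≤nonzeroExponent : ∀ n m → n ∸ 1 + (n * m + (n ∸ 1)) ≤ nonzeroExponent n (suc m)
2[n∸1]+n*m≤nonzeroExponent zero          m = z≤n
2[n∸1]+n*m≤nonzeroExponent (suc zero)    m = ℕₚ.+-monoˡ-≤ 0 (ℕₚ.*-monoʳ-≤ 1 (ℕₚ.n≤1+n m))
2[n∸1]+n*m≤nonzeroExponent (suc (suc n)) m = ℕₚ.≤-reflexive (eq n m)
  where
  eq : ∀ n m → suc n + ((2 + n) * m + suc n) ≡ (2 + n) * suc m + n
  eq = solve-∀ℕ

module Counts (n h H : ℕ) (2H<2^h : H + H < 2 ^ h) where

  private
    L β : ℕ
    L = logFactor n h
    β = boxSize n h

  instance
    β≢0 : NonZero β
    β≢0 = boxSize≢0 n h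

  box≤boxSize : ∀ s → (suc (2 * H) ^ s) ^ n ≤ β ^ s
  box≤boxSize s = begin
    (suc (2 * H) ^ s) ^ n            ≡⟨ ^-swap (suc (2 * H)) s n ⟩
    (suc (2 * H) ^ n) ^ s            ≤⟨ ℕₚ.^-monoˡ-≤ s (ℕₚ.^-monoˡ-≤ n 2H+1≤) ⟩
    β ^ s                            ∎
    where
    open ℕₚ.≤-Reasoning
    2H+1≤ : suc (2 * H) ≤ 2 ^ (3 + h)
    2H+1≤ = begin
      suc (2 * H)       ≡⟨ cong (λ t → suc (H + t)) (ℕₚ.+-identityʳ H) ⟩
      suc (H + H)       ≤⟨ 2H<2^h ⟩
      2 ^ h             ≤⟨ ℕₚ.^-monoʳ-≤ 2 (ℕₚ.m≤n+m h 3) ⟩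
      2 ^ (3 + h)       ∎

  atmost-matrices : Atmost (BoundedMat {n} {n} H) (β ^ n)
  atmost-matrices = atmost-≤ (box≤boxSize n) (atmost-all _≟ᵛ_ (atmost-box H))

  atmost-rank : r ≤ n → Atmost (λ (A : Matrix n) → BoundedMat H A × rank A ≡ r) (L * β ^ r)
  atmost-rank r≤n = atmost-⊆
    (λ { {A} (bA , refl) → let open RankDecomposition (rank-decomposition A) in bA , row-lattice , rows∈ })
    (atmost-rows-in-lattice 2H<2^h r≤n)

  atmost-last-factor : (A C : Matrix n) → ∀ {s} → nullity A ≤ s →
    Atmost (λ (Bs : Vec (Matrix n) 1) → VAll.All (BoundedMat H) Bs × A ⊗ prodMats Bs ≡ C) (β ^ s)
  atmost-last-factor A C {s} nullity≤s = atmost-injection head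
    (λ { {B ∷ []} (bB ∷ [] , ABI≡C) → bB , trans (cong (A ⊗_) (sym (⊗-identityʳ B))) ABI≡C })
    (λ { {_ ∷ []} {_ ∷ []} _ _ refl → refl })
    (atmost-≤ (ℕₚ.≤-trans (box≤boxSize (nullity A)) (ℕₚ.^-monoʳ-≤ β nullity≤s)) (atmost-right-factors A C H))

  atmost-two-factors : ∀ C → Atmost (Factorisation {n} 2 H C) (suc n * (L * β ^ n))
  atmost-two-factors C = atmost-cover-≤ (λ As r → rank (head As) ≡ r)
    (λ {As} _ → rank (head As) , rank≤n (head As) , refl)
    λ {r} r≤n → atmost-≤ (ℕₚ.≤-reflexive (bound r≤n))
      (atmost-∷ _≟M_ (λ { ((bA ∷ _ , _) , r≡) → bA , r≡ }) (atmost-rank r≤n) λ A →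
        atmost-inhabited λ { _ (_ , r≡) → atmost-⊆ (λ { ((_ ∷ bBs , AB≡C) , _) → bBs , AB≡C })
          (atmost-last-factor A C (ℕₚ.≤-reflexive (trans (nullity≡n∸rank A) (cong (n ∸_) r≡)))) })
    where
    open ≡-Reasoning
    bound : r ≤ n → L * β ^ r * β ^ (n ∸ r) ≡ L * β ^ n
    bound {r} r≤n = begin
      L * β ^ r * β ^ (n ∸ r)      ≡⟨ ℕₚ.*-assoc L (β ^ r) (β ^ (n ∸ r)) ⟩
      L * (β ^ r * β ^ (n ∸ r))    ≡⟨ cong (L *_) (ℕₚ.^-distribˡ-+-* β r (n ∸ r)) ⟨
      L * β ^ (r + (n ∸ r))        ≡⟨ cong (λ t → L * β ^ t) (ℕₚ.m+[n∸m]≡n r≤n) ⟩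
      L * β ^ n                    ∎

  atmost-ranks : {ρ : Vec ℕ m} → VAll.All (_≤ n) ρ →
    Atmost (λ (As : Vec (Matrix n) m) → VAll.All (BoundedMat H) As × Vec.map rank As ≡ ρ) (L ^ m * β ^ Vec.sum ρ)
  atmost-ranks []                      = atmost-1 λ { [] [] _ _ → refl }
  atmost-ranks {suc m} {r ∷ ρ} (r≤n ∷ ρ≤n) = atmost-≤ (ℕₚ.≤-reflexive (begin
      L * β ^ r * (L ^ m * β ^ Vec.sum ρ)        ≡⟨ ℕₚ.[m*n]*[o*p]≡[m*o]*[n*p] L (β ^ r) (L ^ m) (β ^ Vec.sum ρ) ⟩
      L * L ^ m * (β ^ r * β ^ Vec.sum ρ)        ≡⟨ cong (L * L ^ m *_) (ℕₚ.^-distribˡ-+-* β r (Vec.sum ρ)) ⟨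
      L * L ^ m * β ^ (r + Vec.sum ρ)            ∎))
    (atmost-∷ _≟M_ (λ { (bA ∷ _ , ranks≡) → bA , cong head ranks≡ }) (atmost-rank r≤n) λ _ →
      atmost-⊆ (λ { (_ ∷ bAs , ranks≡) → bAs , cong tail ranks≡ }) (atmost-ranks ρ≤n))
    where open ≡-Reasoning

  atmost-zero-products : ∀ m →
    Atmost (Factorisation {n} (suc m) H (zeroMat n)) (suc n ^ suc m * (L ^ suc m * β ^ (m * n)))
  atmost-zero-products m = atmost-cover-all-≤ (λ As ρ → Vec.map rank As ≡ ρ)
    (λ {As} _ → Vec.map rank As , VAllₚ.map⁺ (VAll.universal rank≤n As) , refl)
    λ ρ≤n → atmost-inhabited λ { As₀ ((_ , product≡0) , refl) →
      atmost-≤ (ℕₚ.*-monoʳ-≤ (L ^ suc m) (ℕₚ.^-monoʳ-≤ β (totalRank≤m*n As₀ product≡0)))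
        (atmost-⊆ (λ ((bAs , _) , ranks≡) → bAs , ranks≡) (atmost-ranks ρ≤n)) }

  atmost-right-completions : ∀ m (A : Matrix n) {C} → C ≢ zeroMat n →
    Atmost (λ As → VAll.All (BoundedMat H) As × A ⊗ prodMats {m = suc m} As ≡ C) ((β ^ n) ^ m * β ^ (n ∸ 1))
  atmost-right-completions zero    A {C} C≢0 = atmost-inhabited λ { As₀ (_ , refl) →
    atmost-≤ (ℕₚ.≤-reflexive (sym (ℕₚ.*-identityˡ (β ^ (n ∸ 1)))))
      (atmost-last-factor A C (nullity≤n∸1 A (⊗≢zeroMat⇒ˡ {B = prodMats As₀} C≢0))) }
  atmost-right-completions (suc m) A     C≢0 =
    atmost-≤ (ℕₚ.≤-reflexive (sym (ℕₚ.*-assoc (β ^ n) ((β ^ n) ^ m) (β ^ (n ∸ 1)))))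
      (atmost-∷ _≟M_ (λ { (bB ∷ _ , _) → bB }) atmost-matrices λ B →
        atmost-⊆ (λ { {Bs} (_ ∷ bBs , ABBs≡C) → bBs , trans (⊗-assoc A B (prodMats Bs)) ABBs≡C })
          (atmost-right-completions m (A ⊗ B) C≢0))

  atmost-singular : Atmost (λ (A : Matrix n) → BoundedMat H A × nullity A ≢ 0) (suc n * (L * β ^ (n ∸ 1)))
  atmost-singular = atmost-cover-≤ (λ A r → rank A ≡ r) (λ {A} _ → rank A , rank≤n A , refl)
    λ r≤n → atmost-inhabited λ { A₀ ((_ , nullity≢0) , refl) →
      atmost-≤ (ℕₚ.*-monoʳ-≤ L (ℕₚ.^-monoʳ-≤ β (ℕₚ.<⇒≤pred (rank<n A₀ nullity≢0))))
        (atmost-⊆ (λ ((bA , _) , r≡) → bA , r≡) (atmost-rank r≤n)) }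

  atmost-regular-first : ∀ m {C} → C ≢ zeroMat n →
    (∀ {C′} → C′ ≢ zeroMat n → Atmost (Factorisation (suc m) H C′) M) →
    Atmost (λ As → Factorisation (suc (suc m)) H C As × nullity (head As) ≡ 0) (β ^ n * M)
  atmost-regular-first m C≢0 bound = atmost-∷ _≟M_ (λ { ((bA ∷ _ , _) , _) → bA }) atmost-matrices λ A →
    atmost-inhabited λ { As₀ ((_ , refl) , nullity≡0) → atmost-⊆
      (λ { ((_ ∷ bAs , AAs≡C) , _) → bAs , ⊗-cancelˡ A (λ _ _ → nullity≡0⇒injective A nullity≡0) AAs≡C })
      (bound {prodMats As₀} (⊗≢zeroMat⇒ʳ {A = A} C≢0)) }

  atmost-singular-first : ∀ m {C} → C ≢ zeroMat n →
    Atmost (λ As → Factorisation (suc (suc m)) H C As × nullity (head As) ≢ 0)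
      (suc n * (L * β ^ (n ∸ 1)) * ((β ^ n) ^ m * β ^ (n ∸ 1)))
  atmost-singular-first m C≢0 =
    atmost-∷ _≟M_ (λ { ((bA ∷ _ , _) , nullity≢0) → bA , nullity≢0 }) atmost-singular λ A →
      atmost-⊆ (λ { ((_ ∷ bAs , AAs≡C) , _) → bAs , AAs≡C }) (atmost-right-completions m A C≢0)

  atmost-nonzero-products : ∀ m {C} → C ≢ zeroMat n →
    Atmost (Factorisation (suc m) H C) (suc m * (suc n * L) * β ^ nonzeroExponent n m)
  atmost-nonzero-products zero {C} C≢0 = atmost-≤ (begin
      1                            ≤⟨ ℕₚ.m^n>0 (suc h) n ⟩
      suc h ^ n                    ≤⟨ ℕₚ.m≤n*m (suc h ^ n) (suc n) ⟩
      L                            ≤⟨ ℕₚ.m≤n*m L (suc n) ⟩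
      suc n * L                    ≡⟨ ℕₚ.*-identityˡ (suc n * L) ⟨
      1 * (suc n * L)              ≤⟨ ℕₚ.m≤m*n _ (β ^ e) {{ℕₚ.m^n≢0 β e}} ⟩
      1 * (suc n * L) * β ^ e      ∎)
    (atmost-1-factorisation C)
    where
    open ℕₚ.≤-Reasoning
    e = nonzeroExponent n 0
  atmost-nonzero-products (suc m) C≢0 = atmost-≤ (begin
      β ^ n * (V * β ^ nonzeroExponent n m) + suc n * (L * b) * ((β ^ n) ^ m * b)
        ≤⟨ ℕₚ.+-mono-≤ (ℕₚ.≤-reflexive regular≡) singular≤ ⟩
      V * β ^ e + suc n * L * β ^ e      ≡⟨ ℕₚ.+-comm (V * β ^ e) (suc n * L * β ^ e) ⟩
      suc n * L * β ^ e + V * β ^ e      ≡⟨ ℕₚ.*-distribʳ-+ (β ^ e) (suc n * L) V ⟨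
      (suc n * L + V) * β ^ e            ∎)
    (atmost-by-cases (λ As → nullity (head As) ℕₚ.≟ 0)
      (atmost-regular-first m C≢0 (atmost-nonzero-products m))
      (atmost-singular-first m C≢0))
    where
    open ℕₚ.≤-Reasoning
    e = nonzeroExponent n (suc m)
    V = suc m * (suc n * L)
    b = β ^ (n ∸ 1)

    regular≡ : β ^ n * (V * β ^ nonzeroExponent n m) ≡ V * β ^ e
    regular≡ = begin-equality
      β ^ n * (V * β ^ nonzeroExponent n m)      ≡⟨ x∙yz≈y∙xz (β ^ n) V (β ^ nonzeroExponent n m) ⟩
      V * (β ^ n * β ^ nonzeroExponent n m)      ≡⟨ cong (V *_) (ℕₚ.^-distribˡ-+-* β n (nonzeroExponent n m)) ⟨
      V * β ^ (n + nonzeroExponent n m)          ≡⟨ cong (λ t → V * β ^ t) (n+nonzeroExponent≡ n m) ⟩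
      V * β ^ e                                  ∎

    b*β^nm*b≡ : b * (β ^ (n * m) * b) ≡ β ^ (n ∸ 1 + (n * m + (n ∸ 1)))
    b*β^nm*b≡ = trans (cong (b *_) (sym (ℕₚ.^-distribˡ-+-* β (n * m) (n ∸ 1))))
      (sym (ℕₚ.^-distribˡ-+-* β (n ∸ 1) (n * m + (n ∸ 1))))

    singular≤ : suc n * (L * b) * ((β ^ n) ^ m * b) ≤ suc n * L * β ^ e
    singular≤ = begin
      suc n * (L * b) * ((β ^ n) ^ m * b)    ≡⟨ cong (λ t → suc n * (L * b) * (t * b)) (ℕₚ.^-*-assoc β n m) ⟩
      suc n * (L * b) * (β ^ (n * m) * b)    ≡⟨ cong (_* (β ^ (n * m) * b)) (ℕₚ.*-assoc (suc n) L b) ⟨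
      suc n * L * b * (β ^ (n * m) * b)      ≡⟨ ℕₚ.*-assoc (suc n * L) b (β ^ (n * m) * b) ⟩
      suc n * L * (b * (β ^ (n * m) * b))    ≡⟨ cong (suc n * L *_) b*β^nm*b≡ ⟩
      suc n * L * β ^ (n ∸ 1 + (n * m + (n ∸ 1)))
        ≤⟨ ℕₚ.*-monoʳ-≤ (suc n * L) (ℕₚ.^-monoʳ-≤ β (2[n∸1]+n*m≤nonzeroExponent n m)) ⟩
      suc n * L * β ^ e                      ∎

-- Determinants

alt : ∀ {k} → Fin k → ℤ
alt zero    = 1ℤ
alt (suc j) = - alt j

alt-unique : (s : ∀ k → Fin k → ℤ) → (∀ k → s (suc k) zero ≡ 1ℤ) → (∀ k j → s (suc k) (suc j) ≡ - s k j) →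
  ∀ k j → s k j ≡ alt j
alt-unique s s-zero s-suc (suc k) zero    = s-zero k
alt-unique s s-zero s-suc (suc k) (suc j) = trans (s-suc k j) (cong -_ (alt-unique s s-zero s-suc k j))

sumFin≡sum : ∀ n (f : Fin n → ℤ) → sumFin n f ≡ sum f
sumFin≡sum zero    f = refl
sumFin≡sum (suc n) f = cong (λ t → f zero ℤ.+ t) (sumFin≡sum n (f ∘ suc))

-- The sign function of detF is local to its definition, so it cannot be named here; unification recovers it.
-- `tail-terms` reads off the summands of detF, and in `tail-terms≡` abstracting the dimension and the function
-- ∣_∣ leaves (twice negated) the local sign as a solvable meta-variable, which becomes `detF-sign`.
tail-terms : ∀ n A → Σ[ f ∈ (Fin n → ℤ) ]
  detF (suc n) A ≡ 1ℤ ℤ.* (A zero zero ℤ.* detF n (λ i k → A (suc i) (suc k))) ℤ.+ sumFin n f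
tail-terms n A = _ , refl

sign-product-cong : (s : ∀ k → Fin k → ℤ) → (∀ k → s (suc k) zero ≡ 1ℤ) → (∀ k j → s (suc k) (suc j) ≡ - s k j) →
  ∀ k j (f : ℤ → ℕ) y {t} → t ≡ alt j →
  (ℤ.sign (s k j) Sign.* ℤ.sign y) ℤ.◃ f (s k j) * f y ≡ (ℤ.sign t Sign.* ℤ.sign y) ℤ.◃ f t * f y
sign-product-cong s s-zero s-suc k j f y t≡alt rewrite t≡alt | alt-unique s s-zero s-suc k j = refl

mutual
  detF-sign : ∀ w → (Fin (suc w) → Fin (suc w) → ℤ) → ∀ k → Fin k → ℤ
  detF-sign = _

  tail-terms≡ : ∀ n A k → proj₁ (tail-terms n A) k ≡
    - alt k ℤ.* (A zero (suc k) ℤ.* detF n (λ i l → A (suc i) (punchIn (suc k) l)))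
  tail-terms≡ (suc n) A zero    = refl
  tail-terms≡ (suc n) A (suc k)
    with A zero (suc (suc k)) | detF (suc n) (λ i l → A (suc i) (punchIn (suc (suc k)) l))
  ... | a | d with suc n | ∣_∣
  ... | w | f = sign-product-cong (detF-sign w A) (λ _ → refl) (λ _ _ → refl) _ k f _ (ℤₚ.neg-involutive (alt k))

minor : Fin (suc m) → (Fin n → Fin (suc m) → ℤ) → Fin n → Fin m → ℤ
minor j R i k = R i (punchIn j k)

laplace-term : (Fin (suc n) → ℤ) → (Fin n → Fin (suc n) → ℤ) → Fin (suc n) → ℤ
laplace-term {n} a R j = alt j ℤ.* (a j ℤ.* detF n (minor j R))

laplace : (Fin (suc n) → ℤ) → (Fin n → Fin (suc n) → ℤ) → ℤ
laplace a R = sum (laplace-term a R)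

det-laplace : ∀ n A → detF (suc n) A ≡ laplace (A zero) (A ∘ suc)
det-laplace n A = trans (proj₂ (tail-terms n A)) (cong (λ t → laplace-term (A zero) (A ∘ suc) zero ℤ.+ t)
  (trans (sumFin≡sum n (proj₁ (tail-terms n A))) (sum-cong-≗ (tail-terms≡ n A))))

detF-cong : ∀ n {A B : Fin n → Fin n → ℤ} → (∀ i j → A i j ≡ B i j) → detF n A ≡ detF n B
laplace-cong : (a : Fin (suc n) → ℤ) {R S : Fin n → Fin (suc n) → ℤ} → (∀ i j → R i j ≡ S i j) →
  laplace a R ≡ laplace a S

laplace-cong {n} a R≡S = sum-cong-≗ λ j →
  cong (λ t → alt j ℤ.* (a j ℤ.* t)) (detF-cong n λ i k → R≡S i (punchIn j k))

detF-cong zero            A≡B = refl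
detF-cong (suc n) {A} {B} A≡B = begin
  detF (suc n) A                  ≡⟨ det-laplace n A ⟩
  laplace (A zero) (A ∘ suc)      ≡⟨ laplace-cong (A zero) (A≡B ∘ suc) ⟩
  laplace (A zero) (B ∘ suc)      ≡⟨ sum-cong-≗ first-row ⟩
  laplace (B zero) (B ∘ suc)      ≡⟨ det-laplace n B ⟨
  detF (suc n) B                  ∎
  where
  open ≡-Reasoning
  first-row : ∀ j → laplace-term (A zero) (B ∘ suc) j ≡ laplace-term (B zero) (B ∘ suc) j
  first-row j = cong (λ t → alt j ℤ.* (t ℤ.* detF n (minor j (B ∘ suc)))) (A≡B zero j)

infixr 5 _▹_

_▹_ : (Fin m → ℤ) → (Fin n → Fin m → ℤ) → Fin (suc n) → Fin m → ℤ
(a ▹ R) zero    = a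
(a ▹ R) (suc i) = R i

-- (j′ , k′) names the same ordered pair of distinct columns as (j , k), in the opposite order.
Swapped : Fin (suc m) → Fin m → Fin (suc m) → Fin m → Set
Swapped j k j′ k′ = punchIn j k ≡ j′ × punchIn j′ k′ ≡ j

swapped-alt : (j : Fin (suc m)) → ∀ k j′ k′ → Swapped j k j′ k′ → alt j ℤ.* alt k ℤ.+ alt j′ ℤ.* alt k′ ≡ 0ℤ
swapped-alt zero    k       _ zero     (refl , _)    = eq (alt k)
  where
  eq : ∀ a → 1ℤ ℤ.* a ℤ.+ (- a) ℤ.* 1ℤ ≡ 0ℤ
  eq = solve-∀
swapped-alt (suc j) zero    _ k′       (refl , refl) = eq (alt k′)
  where
  eq : ∀ a → (- a) ℤ.* 1ℤ ℤ.+ 1ℤ ℤ.* a ≡ 0ℤ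
  eq = solve-∀
swapped-alt (suc j) (suc k) _ (suc k′) (refl , q)    =
  trans (eq (alt j) (alt k) (alt (punchIn j k)) (alt k′)) (swapped-alt j k _ k′ (refl , Finₚ.suc-injective q))
  where
  eq : ∀ a b c d → (- a) ℤ.* (- b) ℤ.+ (- c) ℤ.* (- d) ≡ a ℤ.* b ℤ.+ c ℤ.* d
  eq = solve-∀

swapped-punchIn : (j : Fin (suc (suc m))) → ∀ k j′ k′ → Swapped j k j′ k′ →
  ∀ l → punchIn j (punchIn k l) ≡ punchIn j′ (punchIn k′ l)
swapped-punchIn zero    k       _ zero     (refl , _)    l       = refl
swapped-punchIn (suc j) zero    _ k′       (refl , refl) l       = refl
swapped-punchIn (suc j) (suc k) _ (suc k′) (refl , q)    zero    = refl
swapped-punchIn (suc j) (suc k) _ (suc k′) (refl , q)    (suc l) =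
  cong suc (swapped-punchIn j k _ k′ (refl , Finₚ.suc-injective q) l)

sum-0 : {f : Fin n → ℤ} → (∀ i → f i ≡ 0ℤ) → sum f ≡ 0ℤ
sum-0 {n} f≡0 = trans (sum-cong-≗ f≡0) (sum-replicate-zero n)

sum-cancel : (f g : Fin n → ℤ) → (∀ i → f i ℤ.+ g i ≡ 0ℤ) → sum f ℤ.+ sum g ≡ 0ℤ
sum-cancel f g f+g≡0 = trans (sym (∑-distrib-+ f g)) (sum-0 f+g≡0)

sum-swapped : ∀ m (f g : Fin (suc m) → Fin m → ℤ) →
  (∀ j k j′ k′ → Swapped j k j′ k′ → f j k ℤ.+ g j′ k′ ≡ 0ℤ) →
  sum (sum ∘ f) ℤ.+ sum (sum ∘ g) ≡ 0ℤ
sum-swapped zero    f g cancel = refl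
sum-swapped (suc m) f g cancel = begin
  sum (sum ∘ f) ℤ.+ sum (sum ∘ g)
    ≡⟨ cong₂ (λ s t → row f ℤ.+ s ℤ.+ (row g ℤ.+ t))
         (∑-distrib-+ (λ j → f (suc j) zero) (sum ∘ rest f)) (∑-distrib-+ (λ j → g (suc j) zero) (sum ∘ rest g)) ⟩
  row f ℤ.+ (column f ℤ.+ sum (sum ∘ rest f)) ℤ.+ (row g ℤ.+ (column g ℤ.+ sum (sum ∘ rest g)))
    ≡⟨ eq (row f) (column f) (sum (sum ∘ rest f)) (row g) (column g) (sum (sum ∘ rest g)) ⟩
  (row f ℤ.+ column g) ℤ.+ (column f ℤ.+ row g) ℤ.+ (sum (sum ∘ rest f) ℤ.+ sum (sum ∘ rest g))
    ≡⟨ cong₂ ℤ._+_ (cong₂ ℤ._+_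
        (sum-cancel (f zero) (λ j → g (suc j) zero) (λ k → cancel zero k (suc k) zero (refl , refl)))
        (sum-cancel (λ j → f (suc j) zero) (g zero) (λ k → cancel (suc k) zero zero k (refl , refl))))
        (sum-swapped m (rest f) (rest g) λ j k j′ k′ (p , q) →
          cancel (suc j) (suc k) (suc j′) (suc k′) (cong suc p , cong suc q)) ⟩
  0ℤ ∎
  where
  open ≡-Reasoning
  row column : (Fin (suc (suc m)) → Fin (suc m) → ℤ) → ℤ
  row    f = sum (f zero)
  column f = sum (λ j → f (suc j) zero)
  rest : (Fin (suc (suc m)) → Fin (suc m) → ℤ) → Fin (suc m) → Fin m → ℤ
  rest f j k = f (suc j) (suc k)
  eq : ∀ a b c d e f → a ℤ.+ (b ℤ.+ c) ℤ.+ (d ℤ.+ (e ℤ.+ f)) ≡ (a ℤ.+ e) ℤ.+ (b ℤ.+ d) ℤ.+ (c ℤ.+ f)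
  eq = solve-∀

laplace-swap : (a b : Fin (suc (suc n)) → ℤ) (S : Fin n → Fin (suc (suc n)) → ℤ) →
  laplace a (b ▹ S) ℤ.+ laplace b (a ▹ S) ≡ 0ℤ
laplace-swap {n} a b S =
  trans (cong₂ ℤ._+_ (double a b) (double b a)) (sum-swapped (suc n) (term a b) (term b a) cancel)
  where
  open ≡-Reasoning
  term : (a b : Fin (suc (suc n)) → ℤ) → Fin (suc (suc n)) → Fin (suc n) → ℤ
  term a b j k = alt j ℤ.* alt k ℤ.* (a j ℤ.* b (punchIn j k) ℤ.* detF n (minor k (minor j S)))
  double : ∀ a b → laplace a (b ▹ S) ≡ sum (sum ∘ term a b)
  double a b = sum-cong-≗ λ j → let b′ = b ∘ punchIn j ; S′ = minor j S in begin
    alt j ℤ.* (a j ℤ.* detF (suc n) (minor j (b ▹ S)))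
      ≡⟨ cong (λ t → alt j ℤ.* (a j ℤ.* t)) (det-laplace n (minor j (b ▹ S))) ⟩
    alt j ℤ.* (a j ℤ.* laplace b′ S′)
      ≡⟨ ℤₚ.*-assoc (alt j) (a j) (laplace b′ S′) ⟨
    alt j ℤ.* a j ℤ.* laplace b′ S′
      ≡⟨ *-distribˡ-sum (alt j ℤ.* a j) (laplace-term b′ S′) ⟩
    sum (λ k → alt j ℤ.* a j ℤ.* laplace-term b′ S′ k)
      ≡⟨ sum-cong-≗ (λ k → eq (alt j) (a j) (alt k) (b′ k) (detF n (minor k S′))) ⟩
    sum (term a b j) ∎
    where
    eq : ∀ p q r s t → p ℤ.* q ℤ.* (r ℤ.* (s ℤ.* t)) ≡ p ℤ.* r ℤ.* (q ℤ.* s ℤ.* t)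
    eq = solve-∀
  cancel : ∀ j k j′ k′ → Swapped j k j′ k′ → term a b j k ℤ.+ term b a j′ k′ ≡ 0ℤ
  cancel j k j′ k′ swapped@(refl , q) = begin
    term a b j k ℤ.+ alt j′ ℤ.* alt k′ ℤ.* (b j′ ℤ.* a (punchIn j′ k′) ℤ.* detF n (minor k′ (minor j′ S)))
      ≡⟨ cong (λ t → term a b j k ℤ.+ alt j′ ℤ.* alt k′ ℤ.* t) (cong₂ (λ u v → b j′ ℤ.* a u ℤ.* v) q
           (detF-cong n λ i l → cong (S i) (sym (swapped-punchIn j k j′ k′ swapped l)))) ⟩
    term a b j k ℤ.+ alt j′ ℤ.* alt k′ ℤ.* (b j′ ℤ.* a j ℤ.* detF n (minor k (minor j S)))
      ≡⟨ eq (alt j ℤ.* alt k) (alt j′ ℤ.* alt k′) (a j) (b j′) (detF n (minor k (minor j S))) ⟩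
    (alt j ℤ.* alt k ℤ.+ alt j′ ℤ.* alt k′) ℤ.* (a j ℤ.* b j′ ℤ.* detF n (minor k (minor j S)))
      ≡⟨ cong (ℤ._* (a j ℤ.* b j′ ℤ.* detF n (minor k (minor j S)))) (swapped-alt j k j′ k′ swapped) ⟩
    0ℤ ∎
    where
    eq : ∀ s t p q r → s ℤ.* (p ℤ.* q ℤ.* r) ℤ.+ t ℤ.* (q ℤ.* p ℤ.* r) ≡ (s ℤ.+ t) ℤ.* (p ℤ.* q ℤ.* r)
    eq = solve-∀

▹-η : (R : Fin (suc n) → Fin m → ℤ) → ∀ i j → R i j ≡ (R zero ▹ R ∘ suc) i j
▹-η R zero    j = refl
▹-η R (suc i) j = refl

laplace-transpose : ∀ a (R : Fin (suc n) → Fin (suc (suc n)) → ℤ) → laplace a R ≡ - laplace (R zero) (a ▹ R ∘ suc)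
laplace-transpose a R = trans (laplace-cong a (▹-η R))
  (AbelianGroupₚ.inverseˡ-unique ℤₚ.+-0-abelianGroup _ _ (laplace-swap a (R zero) (R ∘ suc)))

laplace-repeated : ∀ n (R : Fin n → Fin (suc n) → ℤ) i → laplace (R i) R ≡ 0ℤ
laplace-repeated (suc n) R zero    = x≡-x⇒x≡0 (laplace (R zero) R) (trans (laplace-transpose (R zero) R)
  (cong -_ (sym (laplace-cong (R zero) (▹-η R)))))
  where
  x≡-x⇒x≡0 : ∀ x → x ≡ - x → x ≡ 0ℤ
  x≡-x⇒x≡0 (+ zero) _ = refl
laplace-repeated (suc n) R (suc i) = trans (laplace-transpose (R (suc i)) R) (cong -_ (sum-0 λ j → begin
  laplace-term (R zero) (R (suc i) ▹ R ∘ suc) j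
    ≡⟨ cong (λ t → alt j ℤ.* (R zero j ℤ.* t)) (det-laplace n (minor j (R (suc i) ▹ R ∘ suc))) ⟩
  alt j ℤ.* (R zero j ℤ.* laplace (R (suc i) ∘ punchIn j) (minor j (R ∘ suc)))
    ≡⟨ cong (λ t → alt j ℤ.* (R zero j ℤ.* t)) (laplace-repeated n (minor j (R ∘ suc)) i) ⟩
  alt j ℤ.* (R zero j ℤ.* 0ℤ)
    ≡⟨ cong (alt j ℤ.*_) (ℤₚ.*-zeroʳ (R zero j)) ⟩
  alt j ℤ.* 0ℤ
    ≡⟨ ℤₚ.*-zeroʳ (alt j) ⟩
  0ℤ ∎))
  where open ≡-Reasoning

laplace-rotate : ∀ n A (k : Fin (suc n)) → alt k ℤ.* laplace (A k) (A ∘ punchIn k) ≡ detF (suc n) A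
laplace-rotate n       A zero    = trans (ℤₚ.*-identityˡ _) (sym (det-laplace n A))
laplace-rotate (suc n) A (suc k) = begin
  - alt k ℤ.* laplace (A (suc k)) (A ∘ punchIn (suc k))
    ≡⟨ cong (- alt k ℤ.*_) (laplace-transpose (A (suc k)) (A ∘ punchIn (suc k))) ⟩
  - alt k ℤ.* - laplace (A zero) R
    ≡⟨ neg*neg (alt k) (laplace (A zero) R) ⟩
  alt k ℤ.* laplace (A zero) R
    ≡⟨ *-distribˡ-sum (alt k) (laplace-term (A zero) R) ⟩
  sum (λ j → alt k ℤ.* laplace-term (A zero) R j)
    ≡⟨ sum-cong-≗ (λ j → trans (eq (alt k) (alt j) (A zero j) (detF (suc n) (minor j R)))
         (cong (λ t → alt j ℤ.* (A zero j ℤ.* t)) (rotated-minor j))) ⟩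
  laplace (A zero) (A ∘ suc)
    ≡⟨ det-laplace (suc n) A ⟨
  detF (suc (suc n)) A ∎
  where
  open ≡-Reasoning
  R : Fin (suc n) → Fin (suc (suc n)) → ℤ
  R = A (suc k) ▹ A ∘ suc ∘ punchIn k
  neg*neg : ∀ a b → (- a) ℤ.* (- b) ≡ a ℤ.* b
  neg*neg = solve-∀
  eq : ∀ a b c d → a ℤ.* (b ℤ.* (c ℤ.* d)) ≡ b ℤ.* (c ℤ.* (a ℤ.* d))
  eq = solve-∀
  rotated-minor : ∀ j → alt k ℤ.* detF (suc n) (minor j R) ≡ detF (suc n) (minor j (A ∘ suc))
  rotated-minor j = trans (cong (alt k ℤ.*_) (det-laplace n (minor j R))) (laplace-rotate n (minor j (A ∘ suc)) k)

cofactor : Matrix (suc n) → Fin (suc n) → Fin (suc n) → ℤ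
cofactor {n} C i j = alt i ℤ.* (alt j ℤ.* detF n (minor j (entry C ∘ punchIn i)))

adjugateᵀ : Matrix n → Matrix n
adjugateᵀ {zero}  C = []
adjugateᵀ {suc n} C = tabulate (tabulate ∘ cofactor C)

·≡sum : (x y : Vec ℤ n) → x · y ≡ sum (λ j → lookup x j ℤ.* lookup y j)
·≡sum []      []      = refl
·≡sum (a ∷ x) (b ∷ y) = cong (λ t → a ℤ.* b ℤ.+ t) (·≡sum x y)

cofactor-· : (C : Matrix (suc n)) → ∀ i k →
  tabulate (cofactor C i) · lookup C k ≡ alt i ℤ.* laplace (entry C k) (entry C ∘ punchIn i)
cofactor-· {n} C i k = begin
  tabulate (cofactor C i) · lookup C k
    ≡⟨ ·≡sum (tabulate (cofactor C i)) (lookup C k) ⟩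
  sum (λ j → lookup (tabulate (cofactor C i)) j ℤ.* entry C k j)
    ≡⟨ sum-cong-≗ (λ j → trans (cong (ℤ._* entry C k j) (Vecₚ.lookup∘tabulate (cofactor C i) j))
         (eq (alt i) (alt j) (detF n (minor j (entry C ∘ punchIn i))) (entry C k j))) ⟩
  sum (λ j → alt i ℤ.* laplace-term (entry C k) (entry C ∘ punchIn i) j)
    ≡⟨ *-distribˡ-sum (alt i) (laplace-term (entry C k) (entry C ∘ punchIn i)) ⟨
  alt i ℤ.* laplace (entry C k) (entry C ∘ punchIn i) ∎
  where
  open ≡-Reasoning
  eq : ∀ a b c d → a ℤ.* (b ℤ.* c) ℤ.* d ≡ a ℤ.* (b ℤ.* (d ℤ.* c))
  eq = solve-∀

adjugateᵀ-· : (C : Matrix n) → ∀ i k → lookup (adjugateᵀ C) i · lookup C k ≡ det C ℤ.* lookup (unit k) i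
adjugateᵀ-· {suc n} C i k = begin
  lookup (adjugateᵀ C) i · lookup C k
    ≡⟨ cong (_· lookup C k) (Vecₚ.lookup∘tabulate (tabulate ∘ cofactor C) i) ⟩
  tabulate (cofactor C i) · lookup C k
    ≡⟨ cofactor-· C i k ⟩
  alt i ℤ.* laplace (entry C k) (entry C ∘ punchIn i)
    ≡⟨ by-cases (i Fin.≟ k) ⟩
  det C ℤ.* lookup (unit k) i ∎
  where
  open ≡-Reasoning
  R : Fin n → Fin (suc n) → ℤ
  R = entry C ∘ punchIn i
  rotated : Fin (suc n) → ℤ
  rotated k = alt i ℤ.* laplace (entry C k) R
  by-cases : Dec (i ≡ k) → alt i ℤ.* laplace (entry C k) R ≡ det C ℤ.* lookup (unit k) i
  by-cases (yes refl) = begin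
    alt i ℤ.* laplace (entry C i) R                 ≡⟨ laplace-rotate n (entry C) i ⟩
    det C                                           ≡⟨ ℤₚ.*-identityʳ (det C) ⟨
    det C ℤ.* 1ℤ                                    ≡⟨ cong (det C ℤ.*_) (lookup-unit-≡ i) ⟨
    det C ℤ.* lookup (unit i) i                     ∎
  by-cases (no i≢k) = begin
    alt i ℤ.* laplace (entry C k) R                 ≡⟨ cong rotated (Finₚ.punchIn-punchOut i≢k) ⟨
    alt i ℤ.* laplace (R (punchOut i≢k)) R          ≡⟨ cong (alt i ℤ.*_) (laplace-repeated n R (punchOut i≢k)) ⟩
    alt i ℤ.* 0ℤ                                    ≡⟨ ℤₚ.*-zeroʳ (alt i) ⟩
    0ℤ                                              ≡⟨ ℤₚ.*-zeroʳ (det C) ⟨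
    det C ℤ.* 0ℤ                                    ≡⟨ cong (det C ℤ.*_) (lookup-unit-≢ (i≢k ∘ sym)) ⟨
    det C ℤ.* lookup (unit k) i                     ∎

*ᵛ-adjugate : (C : Matrix n) (x : Vec ℤ n) → C *ᵛ (x ᵛ* adjugateᵀ C) ≡ det C ⊙ x
*ᵛ-adjugate C x = lookup-ext λ i → begin
  lookup (C *ᵛ (x ᵛ* adjugateᵀ C)) i         ≡⟨ Vecₚ.lookup-map i (_· (x ᵛ* adjugateᵀ C)) C ⟩
  lookup C i · (x ᵛ* adjugateᵀ C)            ≡⟨ ·-comm (lookup C i) (x ᵛ* adjugateᵀ C) ⟩
  x ᵛ* adjugateᵀ C · lookup C i              ≡⟨ ᵛ*-· x (adjugateᵀ C) (lookup C i) ⟩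
  x · adjugateᵀ C *ᵛ lookup C i              ≡⟨ cong (x ·_) (lookup-ext (adjugate-column i)) ⟩
  x · (det C ⊙ unit i)                       ≡⟨ ·-⊙ (det C) x (unit i) ⟩
  det C ℤ.* x · unit i                       ≡⟨ cong (det C ℤ.*_) (·-unit x i) ⟩
  det C ℤ.* lookup x i                       ≡⟨ Vecₚ.lookup-map i (det C ℤ.*_) x ⟨
  lookup (det C ⊙ x) i                       ∎
  where
  open ≡-Reasoning
  adjugate-column : ∀ i k → lookup (adjugateᵀ C *ᵛ lookup C i) k ≡ lookup (det C ⊙ unit i) k
  adjugate-column i k = begin
    lookup (adjugateᵀ C *ᵛ lookup C i) k     ≡⟨ Vecₚ.lookup-map k (_· lookup C i) (adjugateᵀ C) ⟩
    lookup (adjugateᵀ C) k · lookup C i      ≡⟨ adjugateᵀ-· C k i ⟩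
    det C ℤ.* lookup (unit i) k              ≡⟨ Vecₚ.lookup-map k (det C ℤ.*_) (unit i) ⟨
    lookup (det C ⊙ unit i) k                ∎

∣ᴹ-det : (C : Matrix n) → C ∣ᴹ det C
∣ᴹ-det C = divides (_ᵛ* adjugateᵀ C) (ᵛ*-linear (adjugateᵀ C)) (*ᵛ-adjugate C)

∣alt∣≡1 : (j : Fin k) → ∣ alt j ∣ ≡ 1
∣alt∣≡1 zero    = refl
∣alt∣≡1 (suc j) = trans (ℤₚ.∣-i∣≡∣i∣ (alt j)) (∣alt∣≡1 j)

∣sum∣≤ : (f : Fin n → ℤ) → (∀ i → ∣ f i ∣ ≤ M) → ∣ sum f ∣ ≤ n * M
∣sum∣≤ {zero}  f f≤ = z≤n
∣sum∣≤ {suc n} f f≤ = ℕₚ.≤-trans (ℤₚ.∣i+j∣≤∣i∣+∣j∣ (f zero) (sum (f ∘ suc)))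
  (ℕₚ.+-mono-≤ (f≤ zero) (∣sum∣≤ (f ∘ suc) (f≤ ∘ suc)))

∣det∣≤ : ∀ n (A : Fin n → Fin n → ℤ) → (∀ i j → ∣ A i j ∣ ≤ M) → ∣ detF n A ∣ ≤ n ! * M ^ n
∣det∣≤     zero    A A≤ = ℕₚ.≤-refl
∣det∣≤ {M} (suc n) A A≤ = begin
  ∣ detF (suc n) A ∣                ≡⟨ cong ∣_∣ (det-laplace n A) ⟩
  ∣ laplace (A zero) (A ∘ suc) ∣    ≤⟨ ∣sum∣≤ (laplace-term (A zero) (A ∘ suc)) term≤ ⟩
  suc n * (M * (n ! * M ^ n))       ≡⟨ eq (suc n) M (n !) (M ^ n) ⟩
  suc n ! * M ^ suc n               ∎
  where
  open ℕₚ.≤-Reasoning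
  eq : ∀ s m f p → s * (m * (f * p)) ≡ s * f * (m * p)
  eq = solve-∀ℕ
  term≤ : ∀ j → ∣ laplace-term (A zero) (A ∘ suc) j ∣ ≤ M * (n ! * M ^ n)
  term≤ j = begin
    ∣ alt j ℤ.* (A zero j ℤ.* d) ∣      ≡⟨ ℤₚ.∣i*j∣≡∣i∣*∣j∣ (alt j) (A zero j ℤ.* d) ⟩
    ∣ alt j ∣ * ∣ A zero j ℤ.* d ∣      ≡⟨ cong₂ _*_ (∣alt∣≡1 j) (ℤₚ.∣i*j∣≡∣i∣*∣j∣ (A zero j) d) ⟩
    1 * (∣ A zero j ∣ * ∣ d ∣)          ≡⟨ ℕₚ.*-identityˡ (∣ A zero j ∣ * ∣ d ∣) ⟩
    ∣ A zero j ∣ * ∣ d ∣                ≤⟨ ℕₚ.*-mono-≤ (A≤ zero j) (∣det∣≤ n (minor j (A ∘ suc)) minor≤) ⟩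
    M * (n ! * M ^ n)                   ∎
    where
    d = detF n (minor j (A ∘ suc))
    minor≤ : ∀ i k → ∣ minor j (A ∘ suc) i k ∣ ≤ M
    minor≤ i k = A≤ (suc i) (punchIn j k)

-- The divisor bound

1+n≤2^n : ∀ n → suc n ≤ 2 ^ n
1+n≤2^n zero    = ℕₚ.≤-refl
1+n≤2^n (suc n) = ℕₚ.+-mono-≤ (ℕₚ.m^n>0 2 n) (ℕₚ.≤-trans (1+n≤2^n n) (ℕₚ.m≤m+n (2 ^ n) 0))

-- With b = ⌊a / q⌋ we have a + 1 ≤ q (b + 1) ≤ q 2^b.
[1+a]^q≤q^q*2^a : ∀ q .{{_ : NonZero q}} a → suc a ^ q ≤ q ^ q * 2 ^ a
[1+a]^q≤q^q*2^a q a = begin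
  suc a ^ q                     ≤⟨ ℕₚ.^-monoˡ-≤ q 1+a≤ ⟩
  (q * 2 ^ (a / q)) ^ q         ≡⟨ ^-distribʳ-* q (2 ^ (a / q)) q ⟩
  q ^ q * (2 ^ (a / q)) ^ q     ≡⟨ cong (q ^ q *_) (ℕₚ.^-*-assoc 2 (a / q) q) ⟩
  q ^ q * 2 ^ (a / q * q)       ≤⟨ ℕₚ.*-monoʳ-≤ (q ^ q) (ℕₚ.^-monoʳ-≤ 2 (m/n*n≤m a q)) ⟩
  q ^ q * 2 ^ a                 ∎
  where
  open ℕₚ.≤-Reasoning
  1+a≤ : suc a ≤ q * 2 ^ (a / q)
  1+a≤ = begin
    suc a                       ≡⟨ cong suc (m≡m%n+[m/n]*n a q) ⟩
    suc (a % q) + a / q * q     ≤⟨ ℕₚ.+-monoˡ-≤ (a / q * q) (m%n<n a q) ⟩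
    suc (a / q) * q             ≡⟨ ℕₚ.*-comm (suc (a / q)) q ⟩
    q * suc (a / q)             ≤⟨ ℕₚ.*-monoʳ-≤ q (1+n≤2^n (a / q)) ⟩
    q * 2 ^ (a / q)             ∎

t∣p*m⇒t∣m∨t≡p*s : ∀ {p t m} → Prime p → t ∣ℕ p * m → t ∣ℕ m ⊎ ∃[ s ] t ≡ p * s × s ∣ℕ m
t∣p*m⇒t∣m∨t≡p*s {p} {t} {m} prime-p (divides u pm≡ut)
  with euclidsLemma u t prime-p (divides m (trans (sym pm≡ut) (ℕₚ.*-comm p m)))
... | inj₁ (divides v refl) =
  inj₁ (divides v (ℕₚ.*-cancelˡ-≡ m (v * t) p {{prime⇒nonZero prime-p}} (trans pm≡ut (eq v p t))))
  where
  eq : ∀ v p t → v * p * t ≡ p * (v * t)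
  eq = solve-∀ℕ
... | inj₂ (divides v refl) =
  inj₂ (v , ℕₚ.*-comm v p , divides u (ℕₚ.*-cancelˡ-≡ m (u * v) p {{prime⇒nonZero prime-p}} (trans pm≡ut (eq u v p))))
  where
  eq : ∀ u v p → u * (v * p) ≡ p * (u * v)
  eq = solve-∀ℕ

t∣p^a*m⇒t≡p^i*s : ∀ {p t m} → Prime p → ∀ a → t ∣ℕ p ^ a * m → ∃[ i ] ∃[ s ] i ≤ a × s ∣ℕ m × t ≡ p ^ i * s
t∣p^a*m⇒t≡p^i*s {t = t} {m} prime-p zero    t∣m =
  0 , t , z≤n , subst (t ∣ℕ_) (ℕₚ.*-identityˡ m) t∣m , sym (ℕₚ.*-identityˡ t)
t∣p^a*m⇒t≡p^i*s {p} {t} {m} prime-p (suc a) t∣ppᵃm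
  with t∣p*m⇒t∣m∨t≡p*s prime-p (subst (t ∣ℕ_) (ℕₚ.*-assoc p (p ^ a) m) t∣ppᵃm)
... | inj₁ t∣pᵃm =
  let i , s , i≤a , s∣m , t≡ = t∣p^a*m⇒t≡p^i*s prime-p a t∣pᵃm
  in i , s , ℕₚ.m≤n⇒m≤1+n i≤a , s∣m , t≡
... | inj₂ (u , refl , u∣pᵃm) =
  let i , s , i≤a , s∣m , u≡ = t∣p^a*m⇒t≡p^i*s prime-p a u∣pᵃm
  in suc i , s , s≤s i≤a , s∣m , trans (cong (p *_) u≡) (sym (ℕₚ.*-assoc p (p ^ i) s))

ContainsDivisors : ℕ → List ℕ → Set
ContainsDivisors m ds = ∀ {t} → t ∣ℕ m → t ∈ ds

divisors-p^a*m : ∀ {p} → Prime p → ∀ a m {ds} → ContainsDivisors m ds →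
  ∃[ ds′ ] ContainsDivisors (p ^ a * m) ds′ × length ds′ ≡ suc a * length ds
divisors-p^a*m {p} prime-p a m {ds} ∈ds = List.cartesianProductWith p^i*s (List.upTo (suc a)) ds
  , (λ t∣ → let i , s , i≤a , s∣m , t≡ = t∣p^a*m⇒t≡p^i*s prime-p a t∣ in
      subst (_∈ _) (sym t≡) (∈ₚ.∈-cartesianProductWith⁺ p^i*s (∈ₚ.∈-upTo⁺ (s≤s i≤a)) (∈ds s∣m)))
  , trans (length-cartesianProductWith p^i*s (List.upTo (suc a)) ds) (cong (_* length ds) (Listₚ.length-upTo (suc a)))
  where
  p^i*s : ℕ → ℕ → ℕ
  p^i*s i s = p ^ i * s

prime⇒2≤p : ∀ {p} → Prime p → 2 ≤ p
prime⇒2≤p {p} prime-p = nonTrivial⇒n>1 p {{prime⇒nonTrivial prime-p}}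

extract-prime-power : ∀ {p} → Prime p → ∀ m → 0 < m → ∃[ a ] ∃[ e ] m ≡ p ^ a * e × ¬ p ∣ℕ e
extract-prime-power {p} prime-p m m>0 = extract m m>0 (<-wellFounded m)
  where
  extract : ∀ m → 0 < m → Acc _<_ m → ∃[ a ] ∃[ e ] m ≡ p ^ a * e × ¬ p ∣ℕ e
  extract m m>0 (acc rec) with p ∣ℕ? m
  ... | no p∤m                       = 0 , m , sym (ℕₚ.*-identityˡ m) , p∤m
  ... | yes (divides zero refl)      = ⊥-elim (ℕₚ.<-irrefl refl m>0)
  ... | yes (divides u@(suc _) refl) =
    let a , e , u≡ , p∤e = extract u (s≤s z≤n) (rec (ℕₚ.m<m*n u p (prime⇒2≤p prime-p)))
    in suc a , e , trans (ℕₚ.*-comm u p) (trans (cong (p *_) u≡) (sym (ℕₚ.*-assoc p (p ^ a) e))) , p∤e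

no-prime-divisors⇒≡1 : ∀ m → 0 < m → (∀ {p} → Prime p → ¬ p ∣ℕ m) → m ≡ 1
no-prime-divisors⇒≡1 m m>0 p∤m with factorise m {{>-nonZero m>0}}
... | record { factors = []     ; isFactorisation = m≡1 }                                      = m≡1
... | record { factors = p ∷ ps ; isFactorisation = m≡ ; factorsPrime = prime-p ∷ _ } =
  ⊥-elim (p∤m prime-p (subst (p ∣ℕ_) (sym m≡) (∈⇒∣product {ns = p ∷ ps} (here refl))))

divisors : ℕ → List ℕ
divisors m = List.filter (_∣ℕ? m) (List.upTo (suc m))

-- Each prime p < 2^q costs a factor q^q, and the larger primes cost nothing.
module _ (q : ℕ) .{{_ : NonZero q}} where

  private
    weight : ℕ → ℕ
    weight B = (q ^ q) ^ (B ⊓ 2 ^ q)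

    weight-mono-suc : ∀ B → weight B ≤ weight (suc B)
    weight-mono-suc B = ℕₚ.^-monoʳ-≤ (q ^ q) {{ℕₚ.m^n≢0 q q}} (ℕₚ.⊓-monoˡ-≤ (2 ^ q) (ℕₚ.n≤1+n B))

    weight≤ : ∀ B → weight B ≤ (q ^ q) ^ 2 ^ q
    weight≤ B = ℕₚ.^-monoʳ-≤ (q ^ q) {{ℕₚ.m^n≢0 q q}} (ℕₚ.m⊓n≤n B (2 ^ q))

    prime-power-cost : ∀ {p} → 2 ≤ p → ∀ a → suc a ^ q * weight p ≤ weight (suc p) * p ^ a
    prime-power-cost {p} 2≤p a with p ℕₚ.<? 2 ^ q
    ... | yes p<2^q = begin
      suc a ^ q * weight p                  ≤⟨ ℕₚ.*-monoˡ-≤ (weight p) ([1+a]^q≤q^q*2^a q a) ⟩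
      q ^ q * 2 ^ a * weight p              ≤⟨ ℕₚ.*-monoˡ-≤ (weight p) (ℕₚ.*-monoʳ-≤ (q ^ q) (ℕₚ.^-monoˡ-≤ a 2≤p)) ⟩
      q ^ q * p ^ a * weight p              ≡⟨ eq (q ^ q) (p ^ a) (weight p) ⟩
      q ^ q * weight p * p ^ a              ≡⟨ cong (_* p ^ a) weight-suc ⟨
      weight (suc p) * p ^ a                ∎
      where
      open ℕₚ.≤-Reasoning
      eq : ∀ c x w → c * x * w ≡ c * w * x
      eq = solve-∀ℕ
      weight-suc : weight (suc p) ≡ q ^ q * weight p
      weight-suc = trans (cong ((q ^ q) ^_) (ℕₚ.m≤n⇒m⊓n≡m p<2^q))
        (cong (λ t → (q ^ q) ^ suc t) (sym (ℕₚ.m≤n⇒m⊓n≡m (ℕₚ.<⇒≤ p<2^q))))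
    ... | no p≮2^q = begin
      suc a ^ q * weight p                  ≤⟨ ℕₚ.*-mono-≤ (ℕₚ.^-monoˡ-≤ q (1+n≤2^n a)) (weight-mono-suc p) ⟩
      (2 ^ a) ^ q * weight (suc p)          ≡⟨ cong (_* weight (suc p)) (^-swap 2 a q) ⟩
      (2 ^ q) ^ a * weight (suc p)          ≤⟨ ℕₚ.*-monoˡ-≤ (weight (suc p)) (ℕₚ.^-monoˡ-≤ a (ℕₚ.≮⇒≥ p≮2^q)) ⟩
      p ^ a * weight (suc p)                ≡⟨ ℕₚ.*-comm (p ^ a) (weight (suc p)) ⟩
      weight (suc p) * p ^ a                ∎
      where open ℕₚ.≤-Reasoning

  smooth-divisors : ∀ B m → 0 < m → (∀ {p} → Prime p → p ∣ℕ m → p < B) →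
    ∃[ ds ] ContainsDivisors m ds × length ds ^ q ≤ weight B * m
  smooth-divisors zero    m m>0 smooth with no-prime-divisors⇒≡1 m m>0 (λ prime-p p∣m → ℕₚ.n≮0 (smooth prime-p p∣m))
  ... | refl = 1 ∷ [] , (λ t∣1 → here (∣1⇒≡1 t∣1)) , ℕₚ.≤-reflexive (ℕₚ.^-zeroˡ q)
  smooth-divisors (suc B) m m>0 smooth with prime? B
  ... | no ¬prime =
    let ds , ∈ds , length≤ = smooth-divisors B m m>0
          λ prime-p p∣m → ℕₚ.≤∧≢⇒< (s≤s⁻¹ (smooth prime-p p∣m)) λ { refl → ¬prime prime-p }
    in ds , ∈ds , ℕₚ.≤-trans length≤ (ℕₚ.*-monoˡ-≤ m (weight-mono-suc B))
  ... | yes prime-p with extract-prime-power prime-p m m>0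
  ...   | a , zero      , refl , _   = ⊥-elim (ℕₚ.<-irrefl (sym (ℕₚ.*-zeroʳ (B ^ a))) m>0)
  ...   | a , e@(suc _) , refl , B∤e =
    let ds , ∈ds , length≤ = smooth-divisors B e (s≤s z≤n) λ prime-p′ p∣e →
          ℕₚ.≤∧≢⇒< (s≤s⁻¹ (smooth prime-p′ (∣-trans p∣e (n∣m*n (B ^ a))))) λ { refl → B∤e p∣e }
        ds′ , ∈ds′ , length≡ = divisors-p^a*m prime-p a e ∈ds
    in ds′ , ∈ds′ , (begin
      length ds′ ^ q                        ≡⟨ cong (_^ q) length≡ ⟩
      (suc a * length ds) ^ q               ≡⟨ ^-distribʳ-* (suc a) (length ds) q ⟩
      suc a ^ q * length ds ^ q             ≤⟨ ℕₚ.*-monoʳ-≤ (suc a ^ q) length≤ ⟩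
      suc a ^ q * (weight B * e)            ≡⟨ ℕₚ.*-assoc (suc a ^ q) (weight B) e ⟨
      suc a ^ q * weight B * e              ≤⟨ ℕₚ.*-monoˡ-≤ e (prime-power-cost (prime⇒2≤p prime-p) a) ⟩
      weight (suc B) * B ^ a * e            ≡⟨ ℕₚ.*-assoc (weight (suc B)) (B ^ a) e ⟩
      weight (suc B) * (B ^ a * e)          ∎)
    where open ℕₚ.≤-Reasoning

  divisor-bound : ∀ m → 0 < m → length (divisors m) ^ q ≤ (q ^ q) ^ 2 ^ q * m
  divisor-bound m m>0 =
    let ds , ∈ds , length≤ = smooth-divisors (suc m) m m>0 λ _ p∣m → s≤s (∣⇒≤ {{>-nonZero m>0}} p∣m)
        divisors≤ds        = atmost-list ds ∈ds (divisors m) (Uniqueₚ.filter⁺ (_∣ℕ? m) (Uniqueₚ.upTo⁺ (suc m)))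
                               (Allₚ.all-filter (_∣ℕ? m) (List.upTo (suc m)))
    in begin
      length (divisors m) ^ q                    ≤⟨ ℕₚ.^-monoˡ-≤ q divisors≤ds ⟩
      length ds ^ q                              ≤⟨ length≤ ⟩
      weight (suc m) * m                         ≤⟨ ℕₚ.*-monoˡ-≤ m (weight≤ (suc m)) ⟩
      (q ^ q) ^ 2 ^ q * m                        ∎
    where open ℕₚ.≤-Reasoning

maxDivisors : ℕ → ℕ
maxDivisors zero    = 0
maxDivisors (suc m) = maxDivisors m ⊔ length (divisors (suc m))

divisors≤maxDivisors : ∀ {m x} → 0 < m → m ≤ x → length (divisors m) ≤ maxDivisors x
divisors≤maxDivisors {suc m} {suc x} m>0 (s≤s m≤x) with ℕₚ.m≤n⇒m<n∨m≡n m≤x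
... | inj₁ m<x  = ℕₚ.≤-trans (divisors≤maxDivisors m>0 m<x) (ℕₚ.m≤m⊔n (maxDivisors x) _)
... | inj₂ refl = ℕₚ.m≤n⊔m (maxDivisors x) _

maxDivisors-bound : ∀ q .{{_ : NonZero q}} x → maxDivisors x ^ q ≤ (q ^ q) ^ 2 ^ q * x
maxDivisors-bound q@(suc _) zero    = z≤n
maxDivisors-bound q         (suc x) with ℕₚ.⊔-sel (maxDivisors x) (length (divisors (suc x)))
... | inj₁ eq = subst (λ t → t ^ q ≤ (q ^ q) ^ 2 ^ q * suc x) (sym eq)
  (ℕₚ.≤-trans (maxDivisors-bound q x) (ℕₚ.*-monoʳ-≤ ((q ^ q) ^ 2 ^ q) (ℕₚ.n≤1+n x)))
... | inj₂ eq = subst (λ t → t ^ q ≤ (q ^ q) ^ 2 ^ q * suc x) (sym eq) (divisor-bound q (suc x) (s≤s z≤n))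

signedDivisors : ℤ → List ℤ
signedDivisors d = List.map +_ (divisors ∣ d ∣) List.++ List.map (-_ ∘ +_) (divisors ∣ d ∣)

length-signedDivisors : ∀ d → length (signedDivisors d) ≡ 2 * length (divisors ∣ d ∣)
length-signedDivisors d = begin
  length (signedDivisors d)
    ≡⟨ Listₚ.length-++ (List.map +_ ts) ⟩
  length (List.map +_ ts) + length (List.map (-_ ∘ +_) ts)
    ≡⟨ cong₂ _+_ (Listₚ.length-map +_ ts) (Listₚ.length-map (-_ ∘ +_) ts) ⟩
  length ts + length ts
    ≡⟨ cong (λ t → length ts + t) (ℕₚ.+-identityʳ (length ts)) ⟨
  2 * length ts ∎
  where
  open ≡-Reasoning
  ts = divisors ∣ d ∣

∣d∣>0 : ∀ {d} → d ≢ 0ℤ → 0 < ∣ d ∣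
∣d∣>0 d≢0 = ℕₚ.n≢0⇒n>0 λ ∣d∣≡0 → d≢0 (ℤₚ.∣i∣≡0⇒i≡0 ∣d∣≡0)

∈-signedDivisors : ∀ {d} → d ≢ 0ℤ → ∀ a b → d ≡ a ℤ.* b → a ∈ signedDivisors d
∈-signedDivisors {d} d≢0 a b d≡ab = signed a
  (∈ₚ.∈-filter⁺ (_∣ℕ? ∣ d ∣) (∈ₚ.∈-upTo⁺ (s≤s (∣⇒≤ {{>-nonZero (∣d∣>0 d≢0)}} ∣a∣-divides))) ∣a∣-divides)
  where
  ∣a∣-divides : ∣ a ∣ ∣ℕ ∣ d ∣
  ∣a∣-divides = divides ∣ b ∣ (trans (cong ∣_∣ d≡ab) (trans (ℤₚ.∣i*j∣≡∣i∣*∣j∣ a b) (ℕₚ.*-comm ∣ a ∣ ∣ b ∣)))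
  signed : ∀ a → ∣ a ∣ ∈ divisors ∣ d ∣ → a ∈ signedDivisors d
  signed (+ _)      t∈ = ∈ₚ.∈-++⁺ˡ (∈ₚ.∈-map⁺ +_ t∈)
  signed ℤ.-[1+ _ ] t∈ = ∈ₚ.∈-++⁺ʳ (List.map +_ (divisors ∣ d ∣)) (∈ₚ.∈-map⁺ (-_ ∘ +_) t∈)

-- Asymptotic orders of magnitude

infix 4 _≼_

-- f(H) ≤ H^(e + ε) eventually, for ε = 1/q and with the denominator cleared.
record _≼_ (f : ℕ → ℕ) (e : ℕ) : Set where
  field ≼-bound : ∀ q → ∃[ H₀ ] ∀ H → H ≥ H₀ → f H ^ q ≤ H ^ suc (e * q)

open _≼_

^-cancelˡ-≤ : ∀ k .{{_ : NonZero k}} {x y} → x ^ k ≤ y ^ k → x ≤ y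
^-cancelˡ-≤ k xᵏ≤yᵏ = ℕₚ.≮⇒≥ λ y<x → ℕₚ.<⇒≱ (ℕₚ.^-monoˡ-< k y<x) xᵏ≤yᵏ

≼-const : ∀ c → const c ≼ 0
≼-const c .≼-bound q = c ^ q , λ H H≥ → ℕₚ.≤-trans H≥ (ℕₚ.≤-reflexive (sym (ℕₚ.^-identityʳ H)))

≼-id : id ≼ 1
≼-id .≼-bound q = 1 , λ H H≥1 → ℕₚ.^-monoʳ-≤ H {{>-nonZero H≥1}} (ℕₚ.≤-trans (ℕₚ.m≤m+n q 0) (ℕₚ.n≤1+n (q + 0)))

≼-mono : ∀ {f g e} → (∀ H → H ≥ 1 → f H ≤ g H) → g ≼ e → f ≼ e
≼-mono f≤g g≼e .≼-bound q = let H₀ , bound = ≼-bound g≼e q in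
  H₀ ⊔ 1 , λ H H≥ → ℕₚ.≤-trans (ℕₚ.^-monoˡ-≤ q (f≤g H (ℕₚ.m⊔n≤o⇒n≤o H₀ 1 H≥))) (bound H (ℕₚ.m⊔n≤o⇒m≤o H₀ 1 H≥))

≼-^ : ∀ {f e} → f ≼ e → ∀ k → (λ H → f H ^ k) ≼ e * k
≼-^ {f} {e} f≼e k .≼-bound q = let H₀ , bound = ≼-bound f≼e (k * q) in H₀ , λ H H≥ → begin
  (f H ^ k) ^ q              ≡⟨ ℕₚ.^-*-assoc (f H) k q ⟩
  f H ^ (k * q)              ≤⟨ bound H H≥ ⟩
  H ^ suc (e * (k * q))      ≡⟨ cong (λ t → H ^ suc t) (ℕₚ.*-assoc e k q) ⟨
  H ^ suc (e * k * q)        ∎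
  where open ℕₚ.≤-Reasoning

-- Taking the hypotheses with exponent 2q leaves room to absorb the product of the two factors H.
≼-* : ∀ {f g a b} → f ≼ a → g ≼ b → (λ H → f H * g H) ≼ a + b
≼-* {f} {g} {a} {b} f≼a g≼b .≼-bound q =
  let H₁ , f≤ = ≼-bound f≼a (q * 2)
      H₂ , g≤ = ≼-bound g≼b (q * 2)
  in H₁ ⊔ H₂ , λ H H≥ → ^-cancelˡ-≤ 2 (begin
    ((f H * g H) ^ q) ^ 2
      ≡⟨ ℕₚ.^-*-assoc (f H * g H) q 2 ⟩
    (f H * g H) ^ (q * 2)
      ≡⟨ ^-distribʳ-* (f H) (g H) (q * 2) ⟩
    f H ^ (q * 2) * g H ^ (q * 2)
      ≤⟨ ℕₚ.*-mono-≤ (f≤ H (ℕₚ.m⊔n≤o⇒m≤o H₁ H₂ H≥)) (g≤ H (ℕₚ.m⊔n≤o⇒n≤o H₁ H₂ H≥)) ⟩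
    H ^ suc (a * (q * 2)) * H ^ suc (b * (q * 2))
      ≡⟨ ℕₚ.^-distribˡ-+-* H (suc (a * (q * 2))) (suc (b * (q * 2))) ⟨
    H ^ (suc (a * (q * 2)) + suc (b * (q * 2)))
      ≡⟨ cong (H ^_) (eq a b q) ⟩
    H ^ (suc ((a + b) * q) * 2)
      ≡⟨ ℕₚ.^-*-assoc H (suc ((a + b) * q)) 2 ⟨
    (H ^ suc ((a + b) * q)) ^ 2 ∎)
  where
  open ℕₚ.≤-Reasoning
  eq : ∀ a b q → suc (a * (q * 2)) + suc (b * (q * 2)) ≡ suc ((a + b) * q) * 2
  eq = solve-∀ℕ

powers≤cH^k⇒≼0 : ∀ {f} k → (∀ q .{{_ : NonZero q}} → ∃[ c ] ∀ H → H ≥ 1 → f H ^ q ≤ c * H ^ k) → f ≼ 0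
powers≤cH^k⇒≼0     k bound .≼-bound zero    = 1 , λ H H≥1 → ℕₚ.m^n>0 H {{>-nonZero H≥1}} 1
powers≤cH^k⇒≼0 {f} k bound .≼-bound (suc q) =
  let c , f≤ = bound (suc q * suc k) in c ⊔ 1 , λ H H≥ → ^-cancelˡ-≤ (suc k) (begin
    (f H ^ suc q) ^ suc k      ≡⟨ ℕₚ.^-*-assoc (f H) (suc q) (suc k) ⟩
    f H ^ (suc q * suc k)      ≤⟨ f≤ H (ℕₚ.m⊔n≤o⇒n≤o c 1 H≥) ⟩
    c * H ^ k                  ≤⟨ ℕₚ.*-monoˡ-≤ (H ^ k) (ℕₚ.m⊔n≤o⇒m≤o c 1 H≥) ⟩
    H ^ suc k                  ≡⟨ cong (_^ suc k) (ℕₚ.^-identityʳ H) ⟨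
    (H ^ 1) ^ suc k            ∎)
  where open ℕₚ.≤-Reasoning

maxDivisors≼0 : ∀ b k → (λ H → maxDivisors (b * H ^ k)) ≼ 0
maxDivisors≼0 b k = powers≤cH^k⇒≼0 k λ q → (q ^ q) ^ 2 ^ q * b , λ H _ →
  ℕₚ.≤-trans (maxDivisors-bound q (b * H ^ k)) (ℕₚ.≤-reflexive (sym (ℕₚ.*-assoc ((q ^ q) ^ 2 ^ q) b (H ^ k))))

≼⇒^≤ : ∀ {f e} → f ≼ e → ∀ p q → ∃[ H₀ ] ∀ H → H ≥ H₀ → ∀ {N} → N ≤ f H → N ^ suc q ≤ H ^ (e * suc q + suc p)
≼⇒^≤ {f} {e} f≼e p q = let H₀ , bound = ≼-bound f≼e (suc q) in H₀ ⊔ 1 , λ H H≥ {N} N≤ →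
  let instance _ = >-nonZero (ℕₚ.m⊔n≤o⇒n≤o H₀ 1 H≥) in begin
    N ^ suc q                    ≤⟨ ℕₚ.^-monoˡ-≤ (suc q) N≤ ⟩
    f H ^ suc q                  ≤⟨ bound H (ℕₚ.m⊔n≤o⇒m≤o H₀ 1 H≥) ⟩
    H ^ suc (e * suc q)          ≤⟨ ℕₚ.^-monoʳ-≤ H (ℕₚ.m<m+n (e * suc q) (s≤s z≤n)) ⟩
    H ^ (e * suc q + suc p)      ∎
  where open ℕₚ.≤-Reasoning

∃-power-of-2 : ∀ H → ∃[ h ] H < 2 ^ h × 2 ^ h ≤ suc (2 * H)
∃-power-of-2 zero    = 0 , s≤s z≤n , s≤s z≤n
∃-power-of-2 (suc H) with ∃-power-of-2 H
... | h , H<2^h , 2^h≤ with suc H ℕₚ.<? 2 ^ h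
...   | yes 1+H<2^h = h , 1+H<2^h , ℕₚ.≤-trans 2^h≤ (s≤s (ℕₚ.*-monoʳ-≤ 2 (ℕₚ.n≤1+n H)))
...   | no 1+H≮2^h  = suc h
  , ℕₚ.≤-trans (s≤s H<2^h) (ℕₚ.+-mono-≤ (ℕₚ.m^n>0 2 h) (ℕₚ.m≤m+n (2 ^ h) 0))
  , ℕₚ.m≤n⇒m≤1+n (ℕₚ.*-monoʳ-≤ 2 (ℕₚ.≮⇒≥ 1+H≮2^h))

level : ℕ → ℕ
level H = suc (proj₁ (∃-power-of-2 H))

2H<2^level : ∀ H → H + H < 2 ^ level H
2H<2^level H = let h , H<2^h , _ = ∃-power-of-2 H in
  subst (H + H <_) (cong (λ t → 2 ^ h + t) (sym (ℕₚ.+-identityʳ (2 ^ h)))) (ℕₚ.+-mono-< H<2^h H<2^h)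

2^level≤6H : ∀ H → H ≥ 1 → 2 ^ level H ≤ 6 * H
2^level≤6H H H≥1 = begin
  2 * 2 ^ h              ≤⟨ ℕₚ.*-monoʳ-≤ 2 2^h≤ ⟩
  2 * (1 + 2 * H)        ≤⟨ ℕₚ.*-monoʳ-≤ 2 (ℕₚ.+-monoˡ-≤ (2 * H) H≥1) ⟩
  2 * (3 * H)            ≡⟨ ℕₚ.*-assoc 2 3 H ⟨
  6 * H                  ∎
  where
  open ℕₚ.≤-Reasoning
  h = proj₁ (∃-power-of-2 H)
  2^h≤ = proj₂ (proj₂ (∃-power-of-2 H))

level≼0 : (λ H → suc (level H)) ≼ 0
level≼0 = powers≤cH^k⇒≼0 1 λ q → q ^ q * 6 , λ H H≥1 → begin
  suc (level H) ^ q          ≤⟨ [1+a]^q≤q^q*2^a q (level H) ⟩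
  q ^ q * 2 ^ level H        ≤⟨ ℕₚ.*-monoʳ-≤ (q ^ q) (2^level≤6H H H≥1) ⟩
  q ^ q * (6 * H)            ≡⟨ ℕₚ.*-assoc (q ^ q) 6 H ⟨
  q ^ q * 6 * H              ≡⟨ cong (q ^ q * 6 *_) (ℕₚ.^-identityʳ H) ⟨
  q ^ q * 6 * H ^ 1          ∎
  where open ℕₚ.≤-Reasoning

logFactor≼0 : ∀ n → (λ H → logFactor n (level H)) ≼ 0
logFactor≼0 n = ≼-* (≼-const (suc n)) (≼-^ level≼0 n)

boxSize≼n : ∀ n → (λ H → boxSize n (level H)) ≼ n
boxSize≼n n = subst ((λ H → boxSize n (level H)) ≼_) (ℕₚ.*-identityˡ n)
  (≼-^ (≼-mono 2^[3+level]≤ (≼-* (≼-const 48) ≼-id)) n)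
  where
  open ℕₚ.≤-Reasoning
  2^[3+level]≤ : ∀ H → H ≥ 1 → 2 ^ (3 + level H) ≤ 48 * H
  2^[3+level]≤ H H≥1 = begin
    2 ^ (3 + level H)          ≡⟨ ℕₚ.^-distribˡ-+-* 2 3 (level H) ⟩
    8 * 2 ^ level H            ≤⟨ ℕₚ.*-monoʳ-≤ 8 (2^level≤6H H H≥1) ⟩
    8 * (6 * H)                ≡⟨ ℕₚ.*-assoc 8 6 H ⟨
    48 * H                     ∎

-- Counting factorisations

boundedTuples : ∀ m n → ℕ → List (Vec (Matrix n) m)
boundedTuples m n H = vecsOf m (boundedMats n H)

boundedTuples-unique : ∀ m n H → Unique (boundedTuples m n H)
boundedTuples-unique m n H = vecsOf-unique m (vecsOf-unique n (vecsOf-unique n (range-unique H)))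

∈-boundedTuples⁺ : ∀ {H} {As : Vec (Matrix n) m} → VAll.All (BoundedMat H) As → As ∈ boundedTuples m n H
∈-boundedTuples⁺ bAs = ∈-vecsOf⁺ (VAll.map (∈-vecsOf⁺ ∘ VAll.map ∈-box⁺) bAs)

∈-boundedTuples⁻ : ∀ {H} {As : Vec (Matrix n) m} → As ∈ boundedTuples m n H → VAll.All (BoundedMat H) As
∈-boundedTuples⁻ As∈ = VAll.map (λ A∈ → VAll.map ∈-box⁻ (∈-vecsOf⁻ A∈)) (∈-vecsOf⁻ As∈)

length-boundedTuples : ∀ m n H → length (boundedTuples m n H) ≡ suc (2 * H) ^ (m * (n * n))
length-boundedTuples m n H = begin
  length (boundedTuples m n H)               ≡⟨ length-vecsOf m (boundedMats n H) ⟩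
  length (boundedMats n H) ^ m               ≡⟨ cong (_^ m) (length-vecsOf n (box n H)) ⟩
  (length (box n H) ^ n) ^ m                 ≡⟨ cong (λ t → (t ^ n) ^ m) (length-box n H) ⟩
  ((suc (2 * H) ^ n) ^ n) ^ m                ≡⟨ cong (_^ m) (ℕₚ.^-*-assoc (suc (2 * H)) n n) ⟩
  (suc (2 * H) ^ (n * n)) ^ m                ≡⟨ ℕₚ.^-*-assoc (suc (2 * H)) (n * n) m ⟩
  suc (2 * H) ^ (n * n * m)                  ≡⟨ cong (suc (2 * H) ^_) (ℕₚ.*-comm (n * n) m) ⟩
  suc (2 * H) ^ (m * (n * n))                ∎
  where open ≡-Reasoning

solutions : ∀ m n → ℕ → Matrix n → List (Vec (Matrix n) m)
solutions m n H C = List.filter (λ As → prodMats As ≟M C) (boundedTuples m n H)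

∈-solutions⁺ : ∀ {H C} {As : Vec (Matrix n) m} → Factorisation m H C As → As ∈ solutions m n H C
∈-solutions⁺ {C = C} (bAs , product≡) = ∈ₚ.∈-filter⁺ (λ As → prodMats As ≟M C) (∈-boundedTuples⁺ bAs) product≡

∈-solutions⁻ : ∀ {H C} {As : Vec (Matrix n) m} → As ∈ solutions m n H C → Factorisation m H C As
∈-solutions⁻ {n} {m} {H} {C} {As} As∈ =
  let As∈tuples , product≡ = ∈ₚ.∈-filter⁻ (λ As → prodMats As ≟M C) {v = As} {xs = boundedTuples m n H} As∈
  in ∈-boundedTuples⁻ {H = H} As∈tuples , product≡

countT≤ : ∀ {m n H C} → Atmost (Factorisation m H C) N → countT m n H C ≤ N
countT≤ {m = m} {n} {H} {C} bound = bound (solutions m n H C)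
  (Uniqueₚ.filter⁺ (λ As → prodMats As ≟M C) (boundedTuples-unique m n H))
  (All.tabulate ∈-solutions⁻)

countT-zeroMat≥ : ∀ m n H → H ^ (m * (n * n)) ≤ countT (suc m) n H (zeroMat n)
countT-zeroMat≥ m n H = begin
  H ^ (m * (n * n))                                 ≤⟨ ℕₚ.^-monoˡ-≤ (m * (n * n)) (ℕₚ.m≤n⇒m≤1+n (ℕₚ.m≤n*m H 2)) ⟩
  suc (2 * H) ^ (m * (n * n))                       ≡⟨ length-boundedTuples m n H ⟨
  length tuples                                     ≡⟨ Listₚ.length-map (zeroMat n ∷_) tuples ⟨
  length (List.map (zeroMat n ∷_) tuples)           ≤⟨ atmost-list (solutions (suc m) n H (zeroMat n)) id _
    (Uniqueₚ.map⁺ Vecₚ.∷-injectiveʳ (boundedTuples-unique m n H)) (Allₚ.map⁺ (All.tabulate zero∷∈solutions)) ⟩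
  countT (suc m) n H (zeroMat n)                    ∎
  where
  open ℕₚ.≤-Reasoning
  tuples = boundedTuples m n H
  zero∷∈solutions : ∀ {As} → As ∈ tuples → zeroMat n ∷ As ∈ solutions (suc m) n H (zeroMat n)
  zero∷∈solutions {As} As∈ = ∈-solutions⁺ {H = H}
    (VAll.map (λ { refl → bounded-𝟘 }) (zeroMat-rows n) ∷ ∈-boundedTuples⁻ As∈ , zeroMat-⊗ (prodMats As))

-- The bounds of the theorem

countT-two-factors≤ : ∀ n p q → ∃[ H₀ ] ∀ H → H ≥ H₀ → ∀ C → countT 2 n H C ^ suc q ≤ H ^ (n * n * suc q + suc p)
countT-two-factors≤ n p q =
  let H₀ , bound = ≼⇒^≤ (≼-* (≼-const (suc n)) (≼-* (logFactor≼0 n) (≼-^ (boxSize≼n n) n))) p q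
  in H₀ , λ H H≥ C → bound H H≥ (countT≤ (Counts.atmost-two-factors n (level H) H (2H<2^level H) C))

countT-zeroMat≤ : ∀ m n p q → ∃[ H₀ ] ∀ H → H ≥ H₀ →
  countT (suc m) n H (zeroMat n) ^ suc q ≤ H ^ (m * (n * n) * suc q + suc p)
countT-zeroMat≤ m n p q =
  let H₀ , bound = ≼⇒^≤ (subst (f ≼_) (exponent n m)
        (≼-* (≼-const (suc n ^ suc m)) (≼-* (≼-^ (logFactor≼0 n) (suc m)) (≼-^ (boxSize≼n n) (m * n))))) p q
  in H₀ , λ H H≥ → bound H H≥ (countT≤ (Counts.atmost-zero-products n (level H) H (2H<2^level H) m))
  where
  f : ℕ → ℕ
  f H = suc n ^ suc m * (logFactor n (level H) ^ suc m * boxSize n (level H) ^ (m * n))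
  exponent : ∀ n m → n * (m * n) ≡ m * (n * n)
  exponent = solve-∀ℕ

countT-nonzero≤ : ∀ m {n} → n ≥ 2 → ∃[ H₀ ] ∀ H → H ≥ H₀ → ∀ C → C ≢ zeroMat n →
  countT (suc m) n H C ≤ H ^ (suc m * (n * n) ∸ n)
countT-nonzero≤ m {n} n≥2 = let H₀ , bound = ≼-bound f≼ 1 in H₀ ⊔ 1 , λ H H≥ C C≢0 →
  let open Counts n (level H) H (2H<2^level H)
      instance _ = >-nonZero (ℕₚ.m⊔n≤o⇒n≤o H₀ 1 H≥)
  in begin
    countT (suc m) n H C                       ≤⟨ countT≤ (atmost-nonzero-products m C≢0) ⟩
    f H                                        ≡⟨ ℕₚ.^-identityʳ (f H) ⟨
    f H ^ 1                                    ≤⟨ bound H (ℕₚ.m⊔n≤o⇒m≤o H₀ 1 H≥) ⟩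
    H ^ suc (n * nonzeroExponent n m * 1)      ≤⟨ ℕₚ.^-monoʳ-≤ H (exponent n≥2) ⟩
    H ^ (suc m * (n * n) ∸ n)                  ∎
  where
  open ℕₚ.≤-Reasoning
  f : ℕ → ℕ
  f H = suc m * (suc n * logFactor n (level H)) * boxSize n (level H) ^ nonzeroExponent n m
  f≼ : f ≼ n * nonzeroExponent n m
  f≼ = ≼-* (≼-* (≼-const (suc m)) (≼-* (≼-const (suc n)) (logFactor≼0 n))) (≼-^ (boxSize≼n n) (nonzeroExponent n m))
  exponent : ∀ {n} → n ≥ 2 → suc (n * nonzeroExponent n m * 1) ≤ suc m * (n * n) ∸ n
  exponent {suc (suc k)} (s≤s (s≤s z≤n)) = ℕₚ.≤-trans (ℕₚ.m≤m+n _ (suc k)) (ℕₚ.≤-reflexive (sym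
    (trans (cong (_∸ suc (suc k)) (eq m k)) (ℕₚ.m+n∸n≡m _ (suc (suc k))))))
    where
    eq : ∀ m k → suc m * ((2 + k) * (2 + k)) ≡ suc ((2 + k) * ((2 + k) * m + k) * 1) + suc k + (2 + k)
    eq = solve-∀ℕ

bounded-unit : (i : Fin n) → Bounded 1 (unit i)
bounded-unit zero    = ℕₚ.≤-refl ∷ bounded-𝟘
bounded-unit (suc i) = z≤n ∷ bounded-unit i

bounded-⊗ : {A B : Matrix n} → BoundedMat M A → BoundedMat N B → BoundedMat (n * (M * N)) (A ⊗ B)
bounded-⊗ {n} {M} {N} {A} {B} bA bB = subst (BoundedMat (n * (M * N))) (sym (⊗≡map A B))
  (VAllₚ.map⁺ (VAll.map (λ ba → bounded-ᵛ* ba bB) bA))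

bounded-prodMats : ∀ {H} {As : Vec (Matrix n) m} → VAll.All (BoundedMat H) As →
  BoundedMat ((n * H) ^ m) (prodMats As)
bounded-prodMats {n} [] = subst (BoundedMat 1) (sym (identity≡tabulate-unit n)) (VAllₚ.tabulate⁺ bounded-unit)
bounded-prodMats {n} {suc m} {H} {As} (bA ∷ bAs) =
  subst (λ M → BoundedMat M (prodMats As)) (sym (ℕₚ.*-assoc n H ((n * H) ^ m))) (bounded-⊗ bA (bounded-prodMats bAs))

∣det-product∣≤ : ∀ {H} {As : Vec (Matrix n) m} → VAll.All (BoundedMat H) As →
  ∣ det (prodMats As) ∣ ≤ n ! * n ^ (m * n) * H ^ (m * n)
∣det-product∣≤ {n} {m} {H} {As} bAs = begin
  ∣ det (prodMats As) ∣                ≤⟨ ∣det∣≤ n (entry (prodMats As)) entry≤ ⟩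
  n ! * ((n * H) ^ m) ^ n              ≡⟨ cong (n ! *_) (ℕₚ.^-*-assoc (n * H) m n) ⟩
  n ! * (n * H) ^ (m * n)              ≡⟨ cong (n ! *_) (^-distribʳ-* n H (m * n)) ⟩
  n ! * (n ^ (m * n) * H ^ (m * n))    ≡⟨ ℕₚ.*-assoc (n !) (n ^ (m * n)) (H ^ (m * n)) ⟨
  n ! * n ^ (m * n) * H ^ (m * n)      ∎
  where
  open ℕₚ.≤-Reasoning
  entry≤ : ∀ i j → ∣ entry (prodMats As) i j ∣ ≤ (n * H) ^ m
  entry≤ i j = VAllₚ.lookup⁺ (VAllₚ.lookup⁺ (bounded-prodMats bAs) i) j

module _ (m n : ℕ) where

  private
    degree : ℕ
    degree = suc m * suc n

    detBound : ℕ → ℕ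
    detBound H = suc n ! * suc n ^ degree * H ^ degree

    divisorCount : ℕ → ℕ
    divisorCount H = logFactor (suc n) (level H) * (2 * maxDivisors (detBound H) * boxSize (suc n) (level H) ^ n)

  atmost-nonsingular-products : ∀ H C → det C ≢ 0ℤ → Atmost (Factorisation (suc m) H C) (divisorCount H ^ m)
  atmost-nonsingular-products H C d≢0 = atmost-inhabited λ { As (bAs , refl) →
    let ∣divisors∣≤ = divisors≤maxDivisors (∣d∣>0 d≢0) (∣det-product∣≤ bAs)
        divisors≤ = begin
          length (signedDivisors (det C))      ≡⟨ length-signedDivisors (det C) ⟩
          2 * length (divisors ∣ det C ∣)      ≤⟨ ℕₚ.*-monoʳ-≤ 2 ∣divisors∣≤ ⟩
          2 * maxDivisors (detBound H)         ∎
    in atmost-nonsingular-factorisations d≢0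
      (atmost-≤ (ℕₚ.*-monoʳ-≤ (logFactor (suc n) (level H)) (ℕₚ.*-monoˡ-≤ (boxSize (suc n) (level H) ^ n) divisors≤))
        (atmost-divisors {level H} (2H<2^level H) d≢0 {n} (∈-signedDivisors d≢0)))
      m (∣ᴹ-det C) }
    where open ℕₚ.≤-Reasoning

  divisorCount≼ : divisorCount ≼ suc n * n
  divisorCount≼ = ≼-* (logFactor≼0 (suc n)) (≼-*
    (≼-* (≼-const 2) (maxDivisors≼0 (suc n ! * suc n ^ degree) degree))
    (≼-^ (boxSize≼n (suc n)) n))

  divisorCount^m≼ : (λ H → divisorCount H ^ m) ≼ m * (suc n * suc n ∸ suc n)
  divisorCount^m≼ = subst ((λ H → divisorCount H ^ m) ≼_) exponent (≼-^ divisorCount≼ m)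
    where
    open ≡-Reasoning
    exponent : suc n * n * m ≡ m * (suc n * suc n ∸ suc n)
    exponent = begin
      suc n * n * m                          ≡⟨ ℕₚ.*-comm (suc n * n) m ⟩
      m * (suc n * n)                        ≡⟨ cong (m *_) (ℕₚ.m+n∸m≡n (suc n) (suc n * n)) ⟨
      m * (suc n + suc n * n ∸ suc n)        ≡⟨ cong (λ t → m * (t ∸ suc n)) (ℕₚ.*-suc (suc n) n) ⟨
      m * (suc n * suc n ∸ suc n)            ∎

  countT-nonsingular≤ : ∀ p q → ∃[ H₀ ] ∀ H → H ≥ H₀ → ∀ C → det C ≢ 0ℤ →
    countT (suc m) (suc n) H C ^ suc q ≤ H ^ (m * (suc n * suc n ∸ suc n) * suc q + suc p)
  countT-nonsingular≤ p q =
    let H₀ , bound = ≼⇒^≤ divisorCount^m≼ p q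
    in H₀ , λ H H≥ C d≢0 → bound H H≥ (countT≤ (atmost-nonsingular-products H C d≢0))

singular-1×1 : (C : Matrix 1) → det C ≡ 0ℤ → C ≡ zeroMat 1
singular-1×1 ((c ∷ []) ∷ []) det≡0 = cong (λ t → (t ∷ []) ∷ []) (trans (eq c) det≡0)
  where
  eq : ∀ c → c ≡ 1ℤ ℤ.* (c ℤ.* 1ℤ) ℤ.+ 0ℤ
  eq = solve-∀

countT-singular≤ : ∀ m n → ∃[ H₀ ] ∀ H → H ≥ H₀ → ∀ C → C ≢ zeroMat (suc n) → det C ≡ 0ℤ →
  countT (suc m) (suc n) H C ≤ H ^ (suc m * (suc n * suc n) ∸ suc n)
countT-singular≤ m zero    = 0 , λ H _ C C≢0 det≡0 → ⊥-elim (C≢0 (singular-1×1 C det≡0))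
countT-singular≤ m (suc n) =
  let H₀ , bound = countT-nonzero≤ m {suc (suc n)} (s≤s (s≤s z≤n))
  in H₀ , λ H H≥ C C≢0 _ → bound H H≥ C C≢0

theorem2p1 : (m n : ℕ) → 1 ≤ m → 1 ≤ n →
      -- C nonsingular: # ≤ H^((m-1)(n²-n) + ε), ε = (suc p)/(suc q), uniformly in C
      ((p q : ℕ) → ∃[ H₀ ] ((H : ℕ) → H ≥ H₀ → (C : Matrix n) → det C ≢ + 0 →
        countT m n H C ^ suc q ≤ H ^ (((m ∸ 1) * (n * n ∸ n)) * suc q + suc p)))
    × -- C ≠ O singular, m = 2: # ≤ H^(n² + ε), uniformly in C
      (m ≡ 2 → (p q : ℕ) → ∃[ H₀ ] ((H : ℕ) → H ≥ H₀ → (C : Matrix n) → C ≢ zeroMat n → det C ≡ + 0 →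
        countT m n H C ^ suc q ≤ H ^ ((n * n) * suc q + suc p)))
    × -- C ≠ O singular, m ≥ 3: # ≤ H^(mn² - n) for H large, uniformly in C
      (m ≥ 3 → ∃[ H₀ ] ((H : ℕ) → H ≥ H₀ → (C : Matrix n) → C ≢ zeroMat n → det C ≡ + 0 →
        countT m n H C ≤ H ^ (m * (n * n) ∸ n)))
    × -- C = O: H^((m-1)n²) ≪ #
      (∃[ c ] ((H : ℕ) → H ≥ 1 → H ^ ((m ∸ 1) * (n * n)) ≤ c * countT m n H (zeroMat n)))
    × -- C = O: # ≤ H^((m-1)n² + ε)
      ((p q : ℕ) → ∃[ H₀ ] ((H : ℕ) → H ≥ H₀ →
        countT m n H (zeroMat n) ^ suc q ≤ H ^ (((m ∸ 1) * (n * n)) * suc q + suc p)))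
theorem2p1 (suc m) (suc n) _ _ =
    countT-nonsingular≤ m n
  , (λ { refl p q → let H₀ , bound = countT-two-factors≤ (suc n) p q in H₀ , λ H H≥ C _ _ → bound H H≥ C })
  , (λ _ → countT-singular≤ m n)
  , (1 , λ H _ → ℕₚ.≤-trans (countT-zeroMat≥ m (suc n) H) (ℕₚ.m≤n*m _ 1))
  , countT-zeroMat≤ m (suc n)
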